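{- For every real $k\in\left(\frac{\sqrt{41}-5}{8},1\right)$, $$\sum_{n=0}^\infty \binom{2n}{n}^2 P_n\!\left(\frac{1-3k+2k^2-2k^3}{4k^2-3k+1}\right)\left(\frac{ -(1+k)(4k^2-3k+1)}{64k}\right)^n\bigl(C_3n^3+C_2n^2+C_1n+C_0\bigr)=\frac{8k^{3/2}(4k^2-3k+1)}{\pi},$$ where $$C_3=\frac{4(k-1)^2}{k+1}(2k-1)(4k^2+3k+1)^2,$$ $$C_2=12(k-1)(2k-1)(16k^4+k^2-1),$$ $$C_1=288k^6-400k^5+102k^4+97k^3-93k^2+47k-9,$$ $$C_0=2(32k^6-44k^5+9k^4+16k^3-14k^2+6k-1).$$
   Context: $P_n$ denotes the $n$-th Legendre polynomial, $P_n(x)={}_2F_1\bigl(-n,n+1;1;\tfrac{1-x}{2}\bigr)$. -}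

module Defs where

open import Data.Bool using (if_then_else_)
open import Data.Integer as ℤ using (ℤ)
open import Data.Integer.Properties as ℤₚ using ()
import Data.Nat.Literals as ℕLit
open import Data.Nat as ℕ using (ℕ; zero; suc; _!)
open import Data.Nat.Properties as ℕₚ using ()
open import Data.Product using (∃-syntax; _×_; _,_; proj₁; proj₂)
open import Data.Rational as ℚ using (ℚ; 0ℚ; 1ℚ; ½)
open import Data.Rational.Literals using (fromℤ)
open import Data.Rational.Properties as ℚₚ using ()
import Data.Rational.Unnormalised as ℚᵘ
import Data.Rational.Unnormalised.Properties as ℚᵘₚ
open import Data.Rational.Solver using (module +-*-Solver)
open import Data.Sum using (_⊎_; inj₁; inj₂)
open import Data.Unit public using (⊤; tt)
open import Relation.Binary.PropositionalEquality
open import Relation.Nullary using (¬_; does; yes; no; Dec)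

module RationalLemmas where
  open import Data.Rational
  open +-*-Solver

  abs-≤ : ∀ {p r} → p ≤ r → - p ≤ r → ∣ p ∣ ≤ r
  abs-≤ {p} a b with ℚₚ.∣p∣≡p∨∣p∣≡-p p
  ... | inj₁ e = subst (_≤ _) (sym e) a
  ... | inj₂ e = subst (_≤ _) (sym e) b

  abs-< : ∀ {p r} → p < r → - p < r → ∣ p ∣ < r
  abs-< {p} a b with ℚₚ.∣p∣≡p∨∣p∣≡-p p
  ... | inj₁ e = subst (_< _) (sym e) a
  ... | inj₂ e = subst (_< _) (sym e) b

  p≤∣p∣ : ∀ p → p ≤ ∣ p ∣
  p≤∣p∣ p with ℚₚ.≤-total 0ℚ p
  ... | inj₁ h = ℚₚ.≤-reflexive (sym (ℚₚ.0≤p⇒∣p∣≡p h))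
  ... | inj₂ h = ℚₚ.≤-trans h (ℚₚ.0≤∣p∣ p)

  ∣p-q∣≡∣q-p∣ : ∀ p q → ∣ p - q ∣ ≡ ∣ q - p ∣
  ∣p-q∣≡∣q-p∣ p q = trans (cong ∣_∣ (solve 2 (λ p q → p :- q := :- (q :- p)) refl p q)) (ℚₚ.∣-p∣≡∣p∣ (q - p))

  ∣p∣-∣q∣≤∣p-q∣ : ∀ p q → ∣ p ∣ - ∣ q ∣ ≤ ∣ p - q ∣
  ∣p∣-∣q∣≤∣p-q∣ p q = subst (∣ p ∣ - ∣ q ∣ ≤_)
      (solve 2 (λ d q → d :+ q :- q := d) refl ∣ p - q ∣ ∣ q ∣)
      (ℚₚ.+-monoˡ-≤ (- ∣ q ∣)
        (subst (λ t → ∣ t ∣ ≤ ∣ p - q ∣ + ∣ q ∣) (solve 2 (λ p q → p :- q :+ q := p) refl p q)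
          (ℚₚ.∣p+q∣≤∣p∣+∣q∣ (p - q) q)))

  ∣∣p∣-∣q∣∣≤∣p-q∣ : ∀ p q → ∣ ∣ p ∣ - ∣ q ∣ ∣ ≤ ∣ p - q ∣
  ∣∣p∣-∣q∣∣≤∣p-q∣ p q = abs-≤ (∣p∣-∣q∣≤∣p-q∣ p q)
    (subst₂ _≤_ (solve 2 (λ a b → b :- a := :- (a :- b)) refl ∣ p ∣ ∣ q ∣) (∣p-q∣≡∣q-p∣ q p)
      (∣p∣-∣q∣≤∣p-q∣ q p))

  ½-pos : ∀ {ε} → 0ℚ < ε → 0ℚ < ½ * ε
  ½-pos h = ℚₚ.*-monoʳ-<-pos ½ h

  ½+½ : ∀ ε → ½ * ε + ½ * ε ≡ ε
  ½+½ = solve 1 (λ e → con ½ :* e :+ con ½ :* e := e) refl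

  *-pos : ∀ {p q} → 0ℚ < p → 0ℚ < q → 0ℚ < p * q
  *-pos {p} {q} hp hq = subst (_< p * q) (ℚₚ.*-zeroʳ p) (ℚₚ.*-monoʳ-<-pos p {{positive hp}} hq)

  *-nonNeg : ∀ {p q} → 0ℚ ≤ p → 0ℚ ≤ q → 0ℚ ≤ p * q
  *-nonNeg {p} {q} hp hq = subst (_≤ p * q) (ℚₚ.*-zeroʳ p) (ℚₚ.*-monoˡ-≤-nonNeg p {{nonNegative hp}} hq)

  +-nonNeg : ∀ {p q} → 0ℚ ≤ p → 0ℚ ≤ q → 0ℚ ≤ p + q
  +-nonNeg {p} {q} hp hq = ℚₚ.≤-trans hq (subst (_≤ p + q) (ℚₚ.+-identityˡ q) (ℚₚ.+-monoˡ-≤ q hp))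

  +-pos : ∀ {p q} → 0ℚ < p → 0ℚ ≤ q → 0ℚ < p + q
  +-pos {p} {q} hp hq = ℚₚ.≤-<-trans hq (subst (_< p + q) (ℚₚ.+-identityˡ q) (ℚₚ.+-monoˡ-< q hp))

  square-nonNeg : ∀ p → 0ℚ ≤ p * p
  square-nonNeg p with ℚₚ.≤-total 0ℚ p
  ... | inj₁ h = *-nonNeg h h
  ... | inj₂ h = subst (0ℚ ≤_) (solve 1 (λ p → :- p :* :- p := p :* p) refl p) (*-nonNeg h′ h′)
    where h′ : 0ℚ ≤ - p
          h′ = ℚₚ.neg-antimono-≤ h

  *-mono : ∀ {a b c d} → 0ℚ ≤ a → 0ℚ ≤ d → a ≤ b → c ≤ d → a * c ≤ b * d
  *-mono {a} {b} {c} {d} ha hd p q = ℚₚ.≤-trans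
    (ℚₚ.*-monoˡ-≤-nonNeg a {{nonNegative ha}} q) (ℚₚ.*-monoʳ-≤-nonNeg d {{nonNegative hd}} p)

  recip : ∀ {c} → 0ℚ < c → ∃[ d ] 0ℚ < d × c * d ≡ 1ℚ
  recip {c} h = (1/ c) {{nz}} , ℚₚ.positive⁻¹ _ {{ℚₚ.1/pos⇒pos c {{positive h}}}} , ℚₚ.*-inverseʳ c {{nz}}
    where nz = ℚₚ.pos⇒nonZero c {{positive h}}

  -- 1/q, extended by 1/0 = 0.
  inv : ℚ → ℚ
  inv p@(mkℚ ℤ.+0 _ _) = 0ℚ
  inv p@(mkℚ ℤ.+[1+ _ ] _ _) = 1/ p
  inv p@(mkℚ ℤ.-[1+ _ ] _ _) = 1/ p

  *-inv : ∀ p → 0ℚ < ∣ p ∣ → p * inv p ≡ 1ℚ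
  *-inv p@(mkℚ ℤ.+0 _ _) (*<* (ℤ.+<+ ()))
  *-inv p@(mkℚ ℤ.+[1+ _ ] _ _) _ = ℚₚ.*-inverseʳ p
  *-inv p@(mkℚ ℤ.-[1+ _ ] _ _) _ = ℚₚ.*-inverseʳ p

  ι : ℕ → ℚ
  ι n = fromℤ (ℤ.+ n)

  ι-suc : ∀ n → ι (suc n) ≡ 1ℚ + ι n
  ι-suc n = ℚₚ.toℚᵘ-injective (ℚᵘₚ.≃-sym (ℚᵘₚ.≃-trans (ℚₚ.toℚᵘ-homo-+ 1ℚ (ι n))
    (ℚᵘ.*≡* (cong (ℤ._* ℤ.+ 1) (cong (ℤ._+_ (ℤ.+ 1)) (ℤₚ.*-identityʳ (ℤ.+ n)))))))

  ι-mono : ∀ {m n} → m ℕ.≤ n → ι m ≤ ι n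
  ι-mono h = *≤* (ℤₚ.*-monoʳ-≤-nonNeg (ℤ.+ 1) (ℤ.+≤+ h))

  0≤ι : ∀ n → 0ℚ ≤ ι n
  0≤ι n = ι-mono {0} {n} ℕ.z≤n

  archimedean : ∀ p → ∃[ N ] p ≤ ι N
  archimedean p@(mkℚ (ℤ.+ n) d-1 _) = n , *≤* (ℤₚ.≤-trans
    (ℤₚ.≤-reflexive (ℤₚ.*-identityʳ (ℤ.+ n)))
    (subst (ℤ.+ n ℤ.≤_) (ℤₚ.pos-* n (suc d-1)) (ℤ.+≤+ (ℕₚ.m≤m*n n (suc d-1)))))
  archimedean p@(mkℚ ℤ.-[1+ _ ] _ _) = 0 , *≤* ℤ.-≤+

  2^-_ : ℕ → ℚ
  2^- zero = 1ℚ
  2^- suc n = ½ * 2^- n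

  2^-pos : ∀ n → 0ℚ < 2^- n
  2^-pos zero = ℚₚ.positive⁻¹ 1ℚ
  2^-pos (suc n) = ½-pos (2^-pos n)

  2^-≤1 : ∀ n → 2^- n ≤ 1ℚ
  2^-≤1 zero = ℚₚ.≤-refl
  2^-≤1 (suc n) = ℚₚ.≤-trans (ℚₚ.*-monoˡ-≤-nonNeg ½ (2^-≤1 n)) (*≤* (ℤ.+≤+ (ℕ.s≤s ℕ.z≤n)))

  n*2^-n≤1 : ∀ n → ι n * 2^- n ≤ 1ℚ
  n*2^-n≤1 zero = *≤* (ℤ.+≤+ ℕ.z≤n)
  n*2^-n≤1 (suc n) = subst (_≤ 1ℚ)
    (sym (trans (cong (_* (½ * 2^- n)) (ι-suc n))
      (solve 2 (λ a b → (con 1ℚ :+ a) :* (con ½ :* b) := con ½ :* b :+ con ½ :* (a :* b)) refl (ι n) (2^- n))))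
    (ℚₚ.+-mono-≤ (ℚₚ.*-monoˡ-≤-nonNeg ½ (2^-≤1 n)) (ℚₚ.*-monoˡ-≤-nonNeg ½ (n*2^-n≤1 n)))

  2^-small : ∀ c ε → 0ℚ < ε → ∃[ N ] ∀ n → N ℕ.≤ n → c * 2^- n < ε
  2^-small c ε hε with recip hε
  ... | d , hd , εd with archimedean (1ℚ + c * d)
  ... | N , hN = N , λ n h → subst₂ _<_
          (trans (solve 4 (λ e c d t → e :* (c :* d :* t) := (e :* d) :* (c :* t)) refl ε c d (2^- n))
            (trans (cong (_* (c * 2^- n)) εd) (ℚₚ.*-identityˡ (c * 2^- n))))
          (ℚₚ.*-identityʳ ε)
          (ℚₚ.*-monoʳ-<-pos ε {{positive hε}}
            (ℚₚ.<-≤-trans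
              (ℚₚ.*-monoˡ-<-pos (2^- n) {{positive (2^-pos n)}}
                (ℚₚ.<-≤-trans (subst (_< 1ℚ + c * d) (ℚₚ.+-identityˡ (c * d)) (ℚₚ.+-monoˡ-< (c * d) (ℚₚ.positive⁻¹ 1ℚ)))
                  (ℚₚ.≤-trans hN (ι-mono h))))
              (n*2^-n≤1 n)))

  if-elim : ∀ {P : Set} (d : Dec P) (Q : ℚ → Set) {a b : ℚ} →
    (P → Q a) → (¬ P → Q b) → Q (if does d then a else b)
  if-elim (yes p) Q f g = f p
  if-elim (no ¬p) Q f g = g ¬p

  bisectStep : ℚ → ℚ → ℚ → ℚ
  bisectStep q w r = if does ((r + w) * (r + w) ≤? q) then r + w else r

  -- The lower endpoint after n bisections of [0 , 1 + q], keeping a point whose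
  -- square is at most q on the left.
  bisect : ℚ → ℕ → ℚ
  bisect q zero = 0ℚ
  bisect q (suc n) = bisectStep q ((1ℚ + q) * 2^- suc n) (bisect q n)

  bisect-spec : ∀ q → 0ℚ ≤ q → ∀ n →
    let r = bisect q n; w = (1ℚ + q) * 2^- n in
    0ℚ ≤ r × r * r ≤ q × q < (r + w) * (r + w)
  bisect-spec q hq zero = ℚₚ.≤-refl , hq ,
    subst (q <_) (solve 1 (λ q → q :+ (con 1ℚ :+ q :+ q :* q) :=
        (con 0ℚ :+ (con 1ℚ :+ q) :* con 1ℚ) :* (con 0ℚ :+ (con 1ℚ :+ q) :* con 1ℚ)) refl q)
      (subst (_< q + (1ℚ + q + q * q)) (ℚₚ.+-identityʳ q)
        (ℚₚ.+-monoʳ-< q (+-pos {1ℚ + q} {q * q} (+-pos {1ℚ} {q} (ℚₚ.positive⁻¹ 1ℚ) hq) (square-nonNeg q))))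
  bisect-spec q hq (suc n) with bisect-spec q hq n
  ... | h₀ , h₁ , h₂ = if-elim (m * m ≤? q)
      (λ r → 0ℚ ≤ r × r * r ≤ q × q < (r + (1ℚ + q) * 2^- suc n) * (r + (1ℚ + q) * 2^- suc n))
      (λ m²≤q →
        +-nonNeg {bisect q n} {(1ℚ + q) * 2^- suc n} h₀
          (*-nonNeg {1ℚ + q} {2^- suc n} (+-nonNeg {1ℚ} {q} (ℚₚ.<⇒≤ (ℚₚ.positive⁻¹ 1ℚ)) hq) (ℚₚ.<⇒≤ (2^-pos (suc n)))) ,
        m²≤q , subst (λ t → q < t * t)
          (solve 3 (λ r c t → r :+ c :* t := r :+ c :* (con ½ :* t) :+ c :* (con ½ :* t)) refl
            (bisect q n) (1ℚ + q) (2^- n)) h₂)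
      (λ m²≰q → h₀ , h₁ , ℚₚ.≰⇒> m²≰q)
    where
      m = bisect q n + (1ℚ + q) * 2^- suc n

  private
    1ℚ>0 : 0ℚ < 1ℚ
    1ℚ>0 = ℚₚ.positive⁻¹ 1ℚ

  Cauchy : (ℕ → ℚ) → Set
  Cauchy x = ∀ ε → 0ℚ < ε → ∃[ N ] ∀ m n → N ℕ.≤ m → N ℕ.≤ n → ∣ x m - x n ∣ < ε

  cauchy-scale : ∀ {x} C → 0ℚ < C →
    (∀ δ → 0ℚ < δ → ∃[ N ] ∀ m n → N ℕ.≤ m → N ℕ.≤ n → ∣ x m - x n ∣ < C * δ) → Cauchy x
  cauchy-scale {x} C hC h ε hε with recip hC
  ... | d , hd , Cd with h (d * ε) (*-pos {d} {ε} hd hε)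
  ... | N , hN = N , λ m n p q → subst (∣ x m - x n ∣ <_)
          (trans (sym (ℚₚ.*-assoc C d ε)) (trans (cong (_* ε) Cd) (ℚₚ.*-identityˡ ε)))
          (hN m n p q)

  cauchy-bounded : ∀ {x} → Cauchy x → ∃[ B ] 0ℚ < B × ∃[ N ] ∀ n → N ℕ.≤ n → ∣ x n ∣ ≤ B
  cauchy-bounded {x} hx with hx 1ℚ 1ℚ>0
  ... | N , hN = 1ℚ + ∣ x N ∣ , +-pos {1ℚ} {∣ x N ∣} 1ℚ>0 (ℚₚ.0≤∣p∣ (x N)) , N , λ n p →
        subst (_≤ 1ℚ + ∣ x N ∣) (solve 2 (λ a b → (a :- b) :+ b := a) refl ∣ x n ∣ ∣ x N ∣)
          (ℚₚ.+-monoˡ-≤ ∣ x N ∣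
            (ℚₚ.≤-trans (∣p∣-∣q∣≤∣p-q∣ (x n) (x N)) (ℚₚ.<⇒≤ (hN n N p ℕₚ.≤-refl))))

  opaque
    cauchy-const : ∀ q → Cauchy (λ _ → q)
    cauchy-const q ε hε = 0 , λ _ _ _ _ → subst (λ t → ∣ t ∣ < ε) (sym (ℚₚ.+-inverseʳ q)) hε

  opaque
    cauchy-neg : ∀ {x} → Cauchy x → Cauchy (λ n → - x n)
    cauchy-neg {x} hx ε hε with hx ε hε
    ... | N , hN = N , λ m n p q → subst (_< ε)
          (trans (∣p-q∣≡∣q-p∣ (x m) (x n)) (cong ∣_∣ (solve 2 (λ a b → b :- a := (:- a) :- (:- b)) refl (x m) (x n))))
          (hN m n p q)

  opaque
    cauchy-abs : ∀ {x} → Cauchy x → Cauchy (λ n → ∣ x n ∣)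
    cauchy-abs {x} hx ε hε with hx ε hε
    ... | N , hN = N , λ m n p q → ℚₚ.≤-<-trans (∣∣p∣-∣q∣∣≤∣p-q∣ (x m) (x n)) (hN m n p q)

  opaque
    cauchy-+ : ∀ {x y} → Cauchy x → Cauchy y → Cauchy (λ n → x n + y n)
    cauchy-+ {x} {y} hx hy ε hε with hx (½ * ε) (½-pos hε) | hy (½ * ε) (½-pos hε)
    ... | N , hN | M , hM = N ℕ.⊔ M , λ m n p q → subst₂ _<_
          refl (½+½ ε)
          (ℚₚ.≤-<-trans
            (subst (_≤ ∣ x m - x n ∣ + ∣ y m - y n ∣)
              (cong ∣_∣ (solve 4 (λ a b c d → (a :- b) :+ (c :- d) := (a :+ c) :- (b :+ d)) refl (x m) (x n) (y m) (y n)))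
              (ℚₚ.∣p+q∣≤∣p∣+∣q∣ (x m - x n) (y m - y n)))
            (ℚₚ.+-mono-<
              (hN m n (ℕₚ.m⊔n≤o⇒m≤o N M p) (ℕₚ.m⊔n≤o⇒m≤o N M q))
              (hM m n (ℕₚ.m⊔n≤o⇒n≤o N M p) (ℕₚ.m⊔n≤o⇒n≤o N M q))))

  ∣ac-bd∣≤ : ∀ a b c d → ∣ a * c - b * d ∣ ≤ ∣ a ∣ * ∣ c - d ∣ + ∣ d ∣ * ∣ a - b ∣
  ∣ac-bd∣≤ a b c d = subst₂ _≤_
    (cong ∣_∣ (solve 4 (λ a b c d → a :* (c :- d) :+ d :* (a :- b) := a :* c :- b :* d) refl a b c d))
    (cong₂ _+_ (ℚₚ.∣p*q∣≡∣p∣*∣q∣ a (c - d)) (ℚₚ.∣p*q∣≡∣p∣*∣q∣ d (a - b)))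
    (ℚₚ.∣p+q∣≤∣p∣+∣q∣ (a * (c - d)) (d * (a - b)))

  *-mono-< : ∀ a b c d → 0ℚ ≤ c → 0ℚ < b → a ≤ b → c < d → a * c < b * d
  *-mono-< a b c d hc hb p q = ℚₚ.≤-<-trans
    (ℚₚ.*-monoʳ-≤-nonNeg c {{nonNegative hc}} p)
    (ℚₚ.*-monoʳ-<-pos b {{positive hb}} q)

  *-bound : ∀ A B δ a b c d → 0ℚ < A → 0ℚ < B → ∣ a ∣ ≤ A → ∣ d ∣ ≤ B →
    ∣ a - b ∣ < δ → ∣ c - d ∣ < δ → ∣ a * c - b * d ∣ < (A + B) * δ
  *-bound A B δ a b c d hA hB ha hd hab hcd =
    subst (∣ a * c - b * d ∣ <_) (sym (ℚₚ.*-distribʳ-+ δ A B))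
      (ℚₚ.≤-<-trans (∣ac-bd∣≤ a b c d) (ℚₚ.+-mono-<
        (*-mono-< (∣ a ∣) A (∣ c - d ∣) δ (ℚₚ.0≤∣p∣ (c - d)) hA ha hcd)
        (*-mono-< (∣ d ∣) B (∣ a - b ∣) δ (ℚₚ.0≤∣p∣ (a - b)) hB hd hab)))

  opaque
    cauchy-* : ∀ {x y} → Cauchy x → Cauchy y → Cauchy (λ n → x n * y n)
    cauchy-* {x} {y} hx hy =
      let A , hA , N₁ , bx = cauchy-bounded {x} hx
          B , hB , N₂ , by = cauchy-bounded {y} hy
      in cauchy-scale {λ n → x n * y n} (A + B) (+-pos {A} {B} hA (ℚₚ.<⇒≤ hB)) λ δ hδ →
      let N₃ , cx = hx δ hδ
          N₄ , cy = hy δ hδ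
      in (N₁ ℕ.⊔ N₂) ℕ.⊔ (N₃ ℕ.⊔ N₄) , λ m n p q →
      let p₁₂ = ℕₚ.m⊔n≤o⇒m≤o (N₁ ℕ.⊔ N₂) _ p
          q₁₂ = ℕₚ.m⊔n≤o⇒m≤o (N₁ ℕ.⊔ N₂) _ q
          p₃₄ = ℕₚ.m⊔n≤o⇒n≤o (N₁ ℕ.⊔ N₂) _ p
          q₃₄ = ℕₚ.m⊔n≤o⇒n≤o (N₁ ℕ.⊔ N₂) _ q
      in *-bound A B δ (x m) (x n) (y m) (y n) hA hB
           (bx m (ℕₚ.m⊔n≤o⇒m≤o N₁ N₂ p₁₂)) (by n (ℕₚ.m⊔n≤o⇒n≤o N₁ N₂ q₁₂))
           (cx m n (ℕₚ.m⊔n≤o⇒m≤o N₃ N₄ p₃₄) (ℕₚ.m⊔n≤o⇒m≤o N₃ N₄ q₃₄))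
           (cy m n (ℕₚ.m⊔n≤o⇒n≤o N₃ N₄ p₃₄) (ℕₚ.m⊔n≤o⇒n≤o N₃ N₄ q₃₄))

  inv-bound : ∀ η C a a′ → 0ℚ < η → η * C ≡ 1ℚ → η ≤ ∣ a ∣ → a * a′ ≡ 1ℚ → ∣ a′ ∣ ≤ C
  inv-bound η C a a′ hη ηC h aa′ = ℚₚ.*-cancelˡ-≤-pos η {{positive hη}}
    (subst (η * ∣ a′ ∣ ≤_)
      (trans (sym (ℚₚ.∣p*q∣≡∣p∣*∣q∣ a a′)) (trans (cong ∣_∣ aa′) (sym ηC)))
      (ℚₚ.*-monoʳ-≤-nonNeg ∣ a′ ∣ {{nonNegative (ℚₚ.0≤∣p∣ a′)}} h))

  inv-diff : ∀ a b a′ b′ → a * a′ ≡ 1ℚ → b * b′ ≡ 1ℚ → (a′ * b′) * (b - a) ≡ a′ - b′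
  inv-diff a b a′ b′ ha hb = trans
    (solve 4 (λ a b a′ b′ → (a′ :* b′) :* (b :- a) := a′ :* (b :* b′) :- b′ :* (a :* a′)) refl a b a′ b′)
    (cong₂ _-_ (trans (cong (a′ *_) hb) (ℚₚ.*-identityʳ a′)) (trans (cong (b′ *_) ha) (ℚₚ.*-identityʳ b′)))

  inv-close : ∀ C δ a b a′ b′ → 0ℚ < C → a * a′ ≡ 1ℚ → b * b′ ≡ 1ℚ → ∣ a′ ∣ ≤ C → ∣ b′ ∣ ≤ C →
    ∣ b - a ∣ < δ → ∣ a′ - b′ ∣ < (C * C) * δ
  inv-close C δ a b a′ b′ hC ha hb ba bb h = subst (_< (C * C) * δ)
    (trans (cong (_* ∣ b - a ∣) (sym (ℚₚ.∣p*q∣≡∣p∣*∣q∣ a′ b′)))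
      (trans (sym (ℚₚ.∣p*q∣≡∣p∣*∣q∣ (a′ * b′) (b - a))) (cong ∣_∣ (inv-diff a b a′ b′ ha hb))))
    (*-mono-< (∣ a′ ∣ * ∣ b′ ∣) (C * C) ∣ b - a ∣ δ (ℚₚ.0≤∣p∣ (b - a)) (*-pos {C} {C} hC hC)
      (*-mono {∣ a′ ∣} {C} {∣ b′ ∣} {C} (ℚₚ.0≤∣p∣ a′) (ℚₚ.<⇒≤ hC) ba bb) h)

  opaque
    cauchy-inv : ∀ {x} → Cauchy x → (∃[ η ] 0ℚ < η × ∃[ N ] ∀ n → N ℕ.≤ n → η ≤ ∣ x n ∣) →
      Cauchy (λ n → inv (x n))
    cauchy-inv {x} hx (η , hη , N₁ , away) =
      let C , hC , ηC = recip hη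
          nz : ∀ n → N₁ ℕ.≤ n → x n * inv (x n) ≡ 1ℚ
          nz n p = *-inv (x n) (ℚₚ.<-≤-trans hη (away n p))
          bound : ∀ n → N₁ ℕ.≤ n → ∣ inv (x n) ∣ ≤ C
          bound n p = inv-bound η C (x n) (inv (x n)) hη ηC (away n p) (nz n p)
      in cauchy-scale {λ n → inv (x n)} (C * C) (*-pos {C} {C} hC hC) λ δ hδ →
      let N₂ , cx = hx δ hδ
      in N₁ ℕ.⊔ N₂ , λ m n p q →
      let p₁ = ℕₚ.m⊔n≤o⇒m≤o N₁ N₂ p
          q₁ = ℕₚ.m⊔n≤o⇒m≤o N₁ N₂ q
      in inv-close C δ (x m) (x n) (inv (x m)) (inv (x n)) hC (nz m p₁) (nz n q₁) (bound m p₁) (bound n q₁)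
           (cx n m (ℕₚ.m⊔n≤o⇒n≤o N₁ N₂ q) (ℕₚ.m⊔n≤o⇒n≤o N₁ N₂ p))

  neg-sub : ∀ a b → b - a ≡ - (a - b)
  neg-sub = solve 2 (λ a b → b :- a := :- (a :- b)) refl

  √-gap : ∀ r e → 0ℚ ≤ r → 0ℚ ≤ e → (r + ½ * e) * (r + ½ * e) + ½ * e * e ≤ (r + e) * (r + e)
  √-gap r e hr he = subst₂ _≤_ (ℚₚ.+-identityʳ ((r + ½ * e) * (r + ½ * e) + ½ * e * e))
    (solve 2 (λ r e → (r :+ con ½ :* e) :* (r :+ con ½ :* e) :+ con ½ :* e :* e :+ (r :* e :+ (con ½ :* e) :* (con ½ :* e))
        := (r :+ e) :* (r :+ e)) refl r e)
    (ℚₚ.+-monoʳ-≤ ((r + ½ * e) * (r + ½ * e) + ½ * e * e)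
      (+-nonNeg {r * e} {(½ * e) * (½ * e)} (*-nonNeg {r} {e} hr he) (square-nonNeg (½ * e))))

  √-close : ∀ r s w a b e → 0ℚ ≤ r → 0ℚ ≤ s → 0ℚ ≤ w → 0ℚ < e →
    r * r ≤ a → b < (s + w) * (s + w) → w ≤ ½ * e → a - b < ½ * e * e → r - s < e
  √-close r s w a b e hr hs hw he ra bs hwe hab = ℚₚ.≰⇒> λ e≤ →
    let t = s + ½ * e
        0≤t = +-nonNeg {s} {½ * e} hs (ℚₚ.<⇒≤ (½-pos he))
        0≤s+e = +-nonNeg {s} {e} hs (ℚₚ.<⇒≤ he)
        s+e≤r : s + e ≤ r
        s+e≤r = subst₂ _≤_ (ℚₚ.+-comm e s) (solve 2 (λ r s → (r :- s) :+ s := r) refl r s) (ℚₚ.+-monoˡ-≤ s e≤)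
        b≤t² : b ≤ t * t
        b≤t² = ℚₚ.≤-trans (ℚₚ.<⇒≤ bs)
          (*-mono {s + w} {t} {s + w} {t} (+-nonNeg {s} {w} hs hw) 0≤t (ℚₚ.+-monoʳ-≤ s hwe) (ℚₚ.+-monoʳ-≤ s hwe))
        a< : a < t * t + ½ * e * e
        a< = ℚₚ.<-≤-trans
          (subst (_< b + ½ * e * e) (solve 2 (λ a b → b :+ (a :- b) := a) refl a b) (ℚₚ.+-monoʳ-< b hab))
          (ℚₚ.+-monoˡ-≤ (½ * e * e) b≤t²)
        ≤a : (s + e) * (s + e) ≤ a
        ≤a = ℚₚ.≤-trans (*-mono {s + e} {r} {s + e} {r} 0≤s+e hr s+e≤r s+e≤r) ra
    in ℚₚ.<-irrefl refl (ℚₚ.<-≤-trans a< (ℚₚ.≤-trans (√-gap s e hs (ℚₚ.<⇒≤ he)) ≤a))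

  opaque
    cauchy-√ : ∀ {x} → Cauchy x → Cauchy (λ n → bisect ∣ x n ∣ n)
    cauchy-√ {x} hx ε hε =
      let B , hB , N₁ , bx = cauchy-bounded {x} hx
          N₂ , small = 2^-small (1ℚ + B) (½ * ε) (½-pos hε)
          N₃ , cx = hx (½ * ε * ε) (*-pos {½ * ε} {ε} (½-pos hε) hε)
          N = N₁ ℕ.⊔ (N₂ ℕ.⊔ N₃)
          upper : ∀ m n → N ℕ.≤ m → N ℕ.≤ n → r m - r n < ε
          upper m n p q = √-close (r m) (r n) (w n) ∣ x m ∣ ∣ x n ∣ ε
            (proj₁ (spec m)) (proj₁ (spec n)) (0≤w n) hε
            (proj₁ (proj₂ (spec m))) (proj₂ (proj₂ (spec n)))
            (ℚₚ.≤-trans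
              (w≤ n B (bx n (ℕₚ.m⊔n≤o⇒m≤o N₁ (N₂ ℕ.⊔ N₃) q)))
              (ℚₚ.<⇒≤ (small n (ℕₚ.m⊔n≤o⇒m≤o N₂ N₃ (ℕₚ.m⊔n≤o⇒n≤o N₁ (N₂ ℕ.⊔ N₃) q)))))
            (ℚₚ.≤-<-trans (∣p∣-∣q∣≤∣p-q∣ (x m) (x n))
              (cx m n (ℕₚ.m⊔n≤o⇒n≤o N₂ N₃ (ℕₚ.m⊔n≤o⇒n≤o N₁ (N₂ ℕ.⊔ N₃) p))
                      (ℕₚ.m⊔n≤o⇒n≤o N₂ N₃ (ℕₚ.m⊔n≤o⇒n≤o N₁ (N₂ ℕ.⊔ N₃) q))))
      in N , λ m n p q → abs-< (upper m n p q) (subst (_< ε) (neg-sub (r m) (r n)) (upper n m q p))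
      where
        r : ℕ → ℚ
        r n = bisect ∣ x n ∣ n
        w : ℕ → ℚ
        w n = (1ℚ + ∣ x n ∣) * 2^- n
        spec : ∀ n → 0ℚ ≤ r n × r n * r n ≤ ∣ x n ∣ × ∣ x n ∣ < (r n + w n) * (r n + w n)
        spec n = bisect-spec ∣ x n ∣ (ℚₚ.0≤∣p∣ (x n)) n
        0≤w : ∀ n → 0ℚ ≤ w n
        0≤w n = *-nonNeg {1ℚ + ∣ x n ∣} {2^- n} (+-nonNeg {1ℚ} {∣ x n ∣} (ℚₚ.<⇒≤ 1ℚ>0) (ℚₚ.0≤∣p∣ (x n))) (ℚₚ.<⇒≤ (2^-pos n))
        w≤ : ∀ n B → ∣ x n ∣ ≤ B → w n ≤ (1ℚ + B) * 2^- n
        w≤ n B h = ℚₚ.*-monoʳ-≤-nonNeg (2^- n) {{nonNegative (ℚₚ.<⇒≤ (2^-pos n))}} (ℚₚ.+-monoʳ-≤ 1ℚ h)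

  leibnizTerm : ℕ → ℚ
  leibnizTerm n = ℤ.+ 4 / suc (2 ℕ.* n)

  sign : ℕ → ℚ
  sign zero = 1ℚ
  sign (suc n) = - sign n

  leibniz : ℕ → ℚ
  leibniz zero = 0ℚ
  leibniz (suc n) = leibniz n + sign n * leibnizTerm n

  leibnizTail : ℕ → ℕ → ℚ
  leibnizTail n zero = 0ℚ
  leibnizTail n (suc d) = leibnizTerm n - leibnizTail (suc n) d

  leibniz-split : ∀ n d → leibniz (d ℕ.+ n) ≡ leibniz n + sign n * leibnizTail n d
  leibniz-split n zero = solve 2 (λ a b → a := a :+ b :* con 0ℚ) refl (leibniz n) (sign n)
  leibniz-split n (suc d) = trans (cong leibniz (sym (ℕₚ.+-suc d n))) (trans (leibniz-split (suc n) d)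
    (solve 4 (λ l s t r → l :+ s :* t :+ (:- s) :* r := l :+ s :* (t :- r)) refl
      (leibniz n) (sign n) (leibnizTerm n) (leibnizTail (suc n) d)))

  0≤leibnizTerm : ∀ n → 0ℚ ≤ leibnizTerm n
  0≤leibnizTerm n = ℚₚ.nonNegative⁻¹ (leibnizTerm n) {{ℚₚ.normalize-nonNeg 4 (suc (2 ℕ.* n))}}

  leibnizTerm-antitone : ∀ n → leibnizTerm (suc n) ≤ leibnizTerm n
  leibnizTerm-antitone n = ℚₚ.toℚᵘ-cancel-≤
    (ℚᵘₚ.≤-respˡ-≃ (ℚᵘₚ.≃-sym (ℚₚ.toℚᵘ-fromℚᵘ (ℚᵘ.mkℚᵘ (ℤ.+ 4) (2 ℕ.* suc n))))
      (ℚᵘₚ.≤-respʳ-≃ (ℚᵘₚ.≃-sym (ℚₚ.toℚᵘ-fromℚᵘ (ℚᵘ.mkℚᵘ (ℤ.+ 4) (2 ℕ.* n))))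
        (ℚᵘ.*≤* (ℤₚ.*-monoˡ-≤-nonNeg (ℤ.+ 4) (ℤ.+≤+ (ℕ.s≤s (ℕₚ.*-monoʳ-≤ 2 (ℕₚ.n≤1+n n))))))))

  leibnizTerm-small : ∀ ε → 0ℚ < ε → ∃[ N ] ∀ n → N ℕ.≤ n → leibnizTerm n < ε
  leibnizTerm-small (mkℚ (ℤ.+ zero) d-1 _) (*<* (ℤ.+<+ ()))
  leibnizTerm-small ε@(mkℚ ℤ.+[1+ c ] d-1 _) _ = 2 ℕ.* suc d-1 , λ n p → ℚₚ.toℚᵘ-cancel-<
    (ℚᵘₚ.<-respˡ-≃ (ℚᵘₚ.≃-sym (ℚₚ.toℚᵘ-fromℚᵘ (ℚᵘ.mkℚᵘ (ℤ.+ 4) (2 ℕ.* n))))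
      (ℚᵘ.*<* (ℤ.+<+ (bound n p))))
    where
      bound : ∀ n → 2 ℕ.* suc d-1 ℕ.≤ n → 4 ℕ.* suc d-1 ℕ.< suc c ℕ.* suc (2 ℕ.* n)
      bound n p = ℕₚ.≤-trans (ℕ.s≤s (subst (ℕ._≤ 2 ℕ.* n) (sym (ℕₚ.*-assoc 2 2 (suc d-1))) (ℕₚ.*-monoʳ-≤ 2 p)))
        (ℕₚ.m≤m+n (suc (2 ℕ.* n)) (c ℕ.* suc (2 ℕ.* n)))

  leibnizTail-bounds : ∀ n d → 0ℚ ≤ leibnizTail n d × leibnizTail n d ≤ leibnizTerm n
  leibnizTail-bounds n zero = ℚₚ.≤-refl , 0≤leibnizTerm n
  leibnizTail-bounds n (suc d) with leibnizTail-bounds (suc n) d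
  ... | lo , hi = ℚₚ.≤-trans (ℚₚ.≤-reflexive (sym (ℚₚ.+-inverseʳ R))) (ℚₚ.+-monoˡ-≤ (- R) (ℚₚ.≤-trans hi (leibnizTerm-antitone n)))
    , subst (leibnizTerm n - R ≤_) (ℚₚ.+-identityʳ (leibnizTerm n)) (ℚₚ.+-monoʳ-≤ (leibnizTerm n) (ℚₚ.neg-antimono-≤ lo))
    where R = leibnizTail (suc n) d

  ∣sign∣ : ∀ n → ∣ sign n ∣ ≡ 1ℚ
  ∣sign∣ zero = refl
  ∣sign∣ (suc n) = trans (ℚₚ.∣-p∣≡∣p∣ (sign n)) (∣sign∣ n)

  opaque
    cauchy-leibniz : Cauchy leibniz
    cauchy-leibniz ε hε with leibnizTerm-small ε hε
    ... | N , small = N , λ m n p q → go m n p q (ℕₚ.≤-total n m)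
      where
        ahead : ∀ n d → N ℕ.≤ n → ∣ leibniz (d ℕ.+ n) - leibniz n ∣ < ε
        ahead n d p = subst (_< ε) (sym eq) (ℚₚ.≤-<-trans (proj₂ (leibnizTail-bounds n d)) (small n p))
          where
            R : ℚ
            R = leibnizTail n d
            eq : ∣ leibniz (d ℕ.+ n) - leibniz n ∣ ≡ R
            eq = trans (cong ∣_∣ (trans (cong (_- leibniz n) (leibniz-split n d))
                   (solve 2 (λ a b → a :+ b :- a := b) refl (leibniz n) (sign n * R))))
                 (trans (ℚₚ.∣p*q∣≡∣p∣*∣q∣ (sign n) R) (trans (cong₂ _*_ (∣sign∣ n) (ℚₚ.0≤p⇒∣p∣≡p (proj₁ (leibnizTail-bounds n d))))
                   (ℚₚ.*-identityˡ R)))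
        go : ∀ m n → N ℕ.≤ m → N ℕ.≤ n → n ℕ.≤ m ⊎ m ℕ.≤ n → ∣ leibniz m - leibniz n ∣ < ε
        go m n p q (inj₁ n≤m) = subst (λ t → ∣ leibniz t - leibniz n ∣ < ε) (ℕₚ.m∸n+n≡m n≤m) (ahead n (m ℕ.∸ n) q)
        go m n p q (inj₂ m≤n) = subst (_< ε) (∣p-q∣≡∣q-p∣ (leibniz n) (leibniz m))
          (subst (λ t → ∣ leibniz t - leibniz m ∣ < ε) (ℕₚ.m∸n+n≡m m≤n) (ahead m (n ℕ.∸ m) p))

  1≤leibniz : ∀ n → 1 ℕ.≤ n → 1ℚ ≤ leibniz n
  1≤leibniz (suc d) _ = subst (1ℚ ≤_) (sym eq)
      (ℚₚ.≤-trans (≤ᵇ⇒≤′ tt) (ℚₚ.+-monoʳ-≤ (leibnizTerm 0) (ℚₚ.neg-antimono-≤ (proj₂ (leibnizTail-bounds 1 d)))))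
    where
      ≤ᵇ⇒≤′ = ℚₚ.≤ᵇ⇒≤ {1ℚ} {leibnizTerm 0 - leibnizTerm 1}
      eq : leibniz (suc d) ≡ leibnizTerm 0 - leibnizTail 1 d
      eq = trans (cong leibniz (cong suc (sym (ℕₚ.+-identityʳ d)))) (trans (leibniz-split 0 (suc d))
        (solve 1 (λ a → con 0ℚ :+ con 1ℚ :* a := a) refl (leibnizTail 0 (suc d))))

  neg-bound : ∀ p η → p + η ≤ 0ℚ → η ≤ ∣ p ∣
  neg-bound p η h = subst (η ≤_) (ℚₚ.∣-p∣≡∣p∣ p) (ℚₚ.≤-trans
    (subst₂ _≤_ (solve 2 (λ p η → (:- p) :+ (p :+ η) := η) refl p η) (ℚₚ.+-identityʳ (- p)) (ℚₚ.+-monoʳ-≤ (- p) h))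
    (p≤∣p∣ (- p)))

  √41-step : ∀ r w → 0ℚ ≤ r → 0ℚ ≤ w → w ≤ 1ℚ → ι 41 < (r + w) * (r + w) → ι 5 ≤ r
  √41-step r w hr hw w≤1 h = ℚₚ.≮⇒≥ λ r<5 →
    let r+w≤6 : r + w ≤ ι 6
        r+w≤6 = ℚₚ.+-mono-≤ {r} {ι 5} {w} {1ℚ} (ℚₚ.<⇒≤ r<5) w≤1
    in ℚₚ.<-irrefl refl (ℚₚ.<-≤-trans h (ℚₚ.≤-trans
        (*-mono {r + w} {ι 6} {r + w} {ι 6} (+-nonNeg {r} {w} hr hw) (0≤ι 6) r+w≤6 r+w≤6)
        (ι-mono {36} {41} (ℕₚ.≤ᵇ⇒≤ 36 41 tt))))

  √41 : ∃[ N ] ∀ n → N ℕ.≤ n → ι 5 ≤ bisect (ι 41) n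
  √41 = let N , small = 2^-small (1ℚ + ι 41) 1ℚ 1ℚ>0 in N , λ n p →
    let h₀ , _ , h₂ = bisect-spec (ι 41) (0≤ι 41) n
    in √41-step (bisect (ι 41) n) ((1ℚ + ι 41) * 2^- n) h₀
        (*-nonNeg {1ℚ + ι 41} {2^- n} (0≤ι 42) (ℚₚ.<⇒≤ (2^-pos n))) (ℚₚ.<⇒≤ (small n p)) h₂

  shift : ∀ r ε p → ι 5 ≤ r → (r - ι 5) * inv (ι 8) + ε ≤ p → ε ≤ p
  shift r ε p h₁ h₂ = ℚₚ.≤-trans
    (subst (_≤ (r - ι 5) * inv (ι 8) + ε) (ℚₚ.+-identityˡ ε)
      (ℚₚ.+-monoˡ-≤ ε (*-nonNeg {r - ι 5} {inv (ι 8)}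
        (subst (_≤ r - ι 5) (ℚₚ.+-inverseʳ (ι 5)) (ℚₚ.+-monoˡ-≤ (- ι 5) h₁)) (ℚₚ.<⇒≤ (ℚₚ.positive⁻¹ (inv (ι 8)))))))
    h₂

  add-lower : ∀ q p ε → 0ℚ ≤ q → ε ≤ p → ε ≤ q + p
  add-lower q p ε hq h = ℚₚ.≤-trans h (subst (_≤ q + p) (ℚₚ.+-identityˡ p) (ℚₚ.+-monoˡ-≤ p hq))

  quadratic-lower : ∀ p ε → 0ℚ < ε → ε ≤ p → ε ≤ ι 4 * (p * (p * ι 1)) + - (ι 3 * p) + ι 1
  quadratic-lower p ε hε h = subst (ε ≤_)
    (solve 1 (λ p → (con (ι 2) :* p :- con 1ℚ) :* (con (ι 2) :* p :- con 1ℚ) :+ p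
       := con (ι 4) :* (p :* (p :* con (ι 1))) :+ (:- (con (ι 3) :* p)) :+ con (ι 1)) refl p)
    (add-lower ((ι 2 * p - 1ℚ) * (ι 2 * p - 1ℚ)) p ε (square-nonNeg (ι 2 * p - 1ℚ)) h)

  64-lower : ∀ p ε → 0ℚ < ε → ε ≤ p → ε ≤ ι 64 * p
  64-lower p ε hε h = subst (ε ≤_) (solve 1 (λ p → con (ι 63) :* p :+ p := con (ι 64) :* p) refl p)
    (add-lower (ι 63 * p) p ε (*-nonNeg {ι 63} {p} (0≤ι 63) (ℚₚ.≤-trans (ℚₚ.<⇒≤ hε) h)) h)

  +1-lower : ∀ p ε → 0ℚ < ε → ε ≤ p → ε ≤ p + ι 1
  +1-lower p ε hε h = subst (ε ≤_) (ℚₚ.+-comm (ι 1) p) (add-lower (ι 1) p ε (0≤ι 1) h)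

open import Agda.Builtin.FromNat public using (Number; fromNat)

instance
  numberℕ : Number ℕ
  numberℕ = ℕLit.number

open RationalLemmas using (Cauchy)

-- Sequences of rationals that are Cauchy, with a modulus: no quotient is taken,
-- so equality of reals is not _≡_ but vanishing of the difference in the limit.
record ℝ : Set where
  constructor mkℝ
  field
    seq    : ℕ → ℚ
    cauchy : Cauchy seq
open ℝ public

infix  4 _<_ _#_
infixl 6 _+_ _-_
infixl 7 _*_ _/_[_]
infix  8 -_
infixr 9 _^_

fromℚ : ℚ → ℝ
fromℚ q = mkℝ (λ _ → q) (RationalLemmas.cauchy-const q)

fromℕ : ℕ → ℝ
fromℕ n = fromℚ (fromℤ (ℤ.+ n))

instance
  numberℝ : Number ℝ
  numberℝ = record { Constraint = λ _ → ⊤ ; fromNat = λ n → fromℕ n }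

_+_ : ℝ → ℝ → ℝ
x + y = mkℝ (λ n → seq x n ℚ.+ seq y n) (RationalLemmas.cauchy-+ {seq x} {seq y} (cauchy x) (cauchy y))

-_ : ℝ → ℝ
- x = mkℝ (λ n → ℚ.- seq x n) (RationalLemmas.cauchy-neg {seq x} (cauchy x))

_-_ : ℝ → ℝ → ℝ
x - y = x + (- y)

_*_ : ℝ → ℝ → ℝ
x * y = mkℝ (λ n → seq x n ℚ.* seq y n) (RationalLemmas.cauchy-* {seq x} {seq y} (cauchy x) (cauchy y))

_^_ : ℝ → ℕ → ℝ
x ^ zero  = 1
x ^ suc n = x * x ^ n

∣_∣ : ℝ → ℝ
∣ x ∣ = mkℝ (λ n → ℚ.∣ seq x n ∣) (RationalLemmas.cauchy-abs {seq x} (cauchy x))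

record _<_ (x y : ℝ) : Set where
  constructor separated
  field
    gap       : ℚ
    gap>0     : 0ℚ ℚ.< gap
    from      : ℕ
    separates : ∀ n → from ℕ.≤ n → seq x n ℚ.+ gap ℚ.≤ seq y n

_#_ : ℝ → ℝ → Set
x # y = x < y ⊎ y < x

inverse : (x : ℝ) → x # 0 → ℝ
inverse x x#0 = mkℝ (λ n → RationalLemmas.inv (seq x n))
    (RationalLemmas.cauchy-inv {seq x} (cauchy x) (away x#0))
  where
    away : x # 0 → ∃[ η ] 0ℚ ℚ.< η × ∃[ N ] ∀ n → N ℕ.≤ n → η ℚ.≤ ℚ.∣ seq x n ∣
    away (inj₁ (separated η hη N h)) = η , hη , N , λ n p → RationalLemmas.neg-bound (seq x n) η (h n p)
    away (inj₂ (separated η hη N h)) = η , hη , N , λ n p → ℚₚ.≤-trans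
      (subst (ℚ._≤ seq x n) (ℚₚ.+-identityˡ η) (h n p)) (RationalLemmas.p≤∣p∣ (seq x n))

_/_[_] : (x y : ℝ) → y # 0 → ℝ
x / y [ y#0 ] = x * inverse y y#0

-- Computes √∣x∣, so the usual square root wherever 0 ≤ x.
√_ : ℝ → ℝ
√ x = mkℝ (λ n → RationalLemmas.bisect ℚ.∣ seq x n ∣ n) (RationalLemmas.cauchy-√ {seq x} (cauchy x))
infix 10 √_

-- π = 4 (1 - 1/3 + 1/5 - …)
π : ℝ
π = mkℝ RationalLemmas.leibniz RationalLemmas.cauchy-leibniz

partialSum : (ℕ → ℝ) → ℕ → ℝ
partialSum f zero    = 0
partialSum f (suc n) = partialSum f n + f n

HasSum : (ℕ → ℝ) → ℝ → Set
HasSum f s = ∀ (ε : ℝ) → 0 < ε → ∃[ N ] ∀ n → N ℕ.≤ n → ∣ partialSum f n - s ∣ < ε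

eventually⇒0< : (x : ℝ) (ε : ℚ) → 0ℚ ℚ.< ε → (N : ℕ) → (∀ n → N ℕ.≤ n → ε ℚ.≤ seq x n) → 0 < x
eventually⇒0< x ε hε N h = separated ε hε N
  λ n p → subst (ℚ._≤ seq x n) (sym (ℚₚ.+-identityˡ ε)) (h n p)

numeral#0 : ∀ n .{{_ : ℕ.NonZero n}} → fromℕ n # 0
numeral#0 (suc n) = inj₂ (eventually⇒0< (fromℕ (suc n)) 1ℚ (ℚₚ.positive⁻¹ 1ℚ) 0
  λ _ _ → RationalLemmas.ι-mono {1} {suc n} (ℕ.s≤s ℕ.z≤n))

π#0 : π # 0
π#0 = inj₂ (eventually⇒0< π 1ℚ (ℚₚ.positive⁻¹ 1ℚ) 1 RationalLemmas.1≤leibniz)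

-- (a)ⱼ = a (a + 1) ⋯ (a + j - 1)
pochhammer : ℤ → ℕ → ℤ
pochhammer a zero    = ℤ.+ 1
pochhammer a (suc j) = pochhammer a j ℤ.* (a ℤ.+ ℤ.+ j)

-- ₂F₁(-n, b; 1; z). The series stops at j = n because (-n)ⱼ = 0 for j > n,
-- and the denominator (1)ⱼ j! is j! j!.
terminating₂F₁ : ℕ → ℤ → ℝ → ℝ
terminating₂F₁ n b z = partialSum term (suc n)
  where
    term : ℕ → ℝ
    term j = fromℚ ((pochhammer (ℤ.- (ℤ.+ n)) j ℤ.* pochhammer b j) ℚ./ (j ! ℕ.* j !)) * z ^ j
      where instance _ = j ℕₚ.!* j !≢0

legendre : ℕ → ℝ → ℝ
legendre n x = terminating₂F₁ n (ℤ.+ suc n) ((1 - x) / 2 [ numeral#0 2 ])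

lowerBound : ℝ
lowerBound = (√ 41 - 5) / 8 [ numeral#0 8 ]

quadratic : ℝ → ℝ
quadratic k = 4 * k ^ 2 - 3 * k + 1

module _ {k : ℝ} where

  0<k : lowerBound < k → 0 < k
  0<k (separated ε hε N h) = eventually⇒0< k ε hε (N ℕ.⊔ proj₁ RationalLemmas.√41) λ n p →
    RationalLemmas.shift (RationalLemmas.bisect (fromℤ (ℤ.+ 41)) n) ε (seq k n)
      (proj₂ RationalLemmas.√41 n (ℕₚ.m⊔n≤o⇒n≤o N _ p)) (h n (ℕₚ.m⊔n≤o⇒m≤o N _ p))

  private
    lift : (y : ℝ) (f : ℚ → ℚ) → (∀ n → seq y n ≡ f (seq k n)) →
      (∀ p ε → 0ℚ ℚ.< ε → ε ℚ.≤ p → ε ℚ.≤ f p) → 0 < k → y # 0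
    lift y f eq h (separated ε hε N hN) = inj₂ (eventually⇒0< y ε hε N λ n p →
      subst (ε ℚ.≤_) (sym (eq n))
        (h (seq k n) ε hε (subst (ℚ._≤ seq k n) (ℚₚ.+-identityˡ ε) (hN n p))))

  quadratic#0 : lowerBound < k → quadratic k # 0
  quadratic#0 l = lift (quadratic k) (λ p → fromℤ (ℤ.+ 4) ℚ.* (p ℚ.* (p ℚ.* fromℤ (ℤ.+ 1))) ℚ.+ ℚ.- (fromℤ (ℤ.+ 3) ℚ.* p) ℚ.+ fromℤ (ℤ.+ 1)) (λ n → refl) RationalLemmas.quadratic-lower (0<k l)

  64k#0 : lowerBound < k → 64 * k # 0
  64k#0 l = lift (64 * k) (λ p → fromℤ (ℤ.+ 64) ℚ.* p) (λ n → refl) RationalLemmas.64-lower (0<k l)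

  k+1#0 : lowerBound < k → k + 1 # 0
  k+1#0 l = lift (k + 1) (λ p → p ℚ.+ fromℤ (ℤ.+ 1)) (λ n → refl) RationalLemmas.+1-lower (0<k l)

-- With ζ = -16 z one has |ζ| < 1 exactly on the given interval of k, and |x| < 1
-- there, so |Pₙ(x)| ≤ 1 and the series converges geometrically. Telescoping in n
-- turns its partial sums into 2kQ times those of a series M with coefficients of
-- degree one in n (Q = 4k² - 3k + 1), up to a negligible boundary term. The
-- derivative in k of M also telescopes: 2k M′ - M is a single negligible term, so
-- M/√k is constant on the interval. As k → 1 one has x → -1 and (-1)ⁿ Pₙ(x) → 1
-- fast enough that M is compared with 4 (1 - ζ) Σ n aₙ ζⁿ, aₙ = binom(2n,n)²/16ⁿ,
-- whose limit is 4 lim n aₙ = 4/π. This last limit is Wallis' product; it is tied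
-- to the Leibniz series, which defines π here, by averaging the latter with
-- binomial weights.
--
-- Real operations act pointwise on Cauchy sequences, so it is enough to make these
-- estimates for rational k, uniformly.
module Submission where

open import Data.Integer as ℤ using (ℤ)
import Data.Integer.Properties as ℤₚ
open import Data.Nat as ℕ using (ℕ; zero; suc; _!)
open import Data.Nat.Combinatorics using (_C_; nCk≡n!/k![n-k]!; k![n∸k]!∣n!)
open import Data.Nat.DivMod using (m/n*n≡m)
import Data.Nat.Properties as ℕₚ
open import Data.Product using (∃-syntax; _×_; _,_; proj₁; proj₂)
open import Data.Rational.Literals using (fromℤ)
open import Data.Rational.Properties as ℚₚ using ()
import Data.Rational.Unnormalised as ℚᵘ
import Data.Rational.Unnormalised.Properties as ℚᵘₚ
open import Data.Sum using (_⊎_; inj₁; inj₂)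
open import Relation.Binary.PropositionalEquality
open import Relation.Nullary.Decidable.Core using (dec⇒maybe)
open import Tactic.RingSolver using (solve-∀)
open import Tactic.RingSolver.Core.AlmostCommutativeRing using (AlmostCommutativeRing; fromCommutativeRing)

-- A rational need not have a rational square root: at stage m, `√` only supplies a bisection value
-- r with r² near κ. Constancy of M/√k is therefore proved in the variable q = √k, with q rational,
-- and the sum at κ is moved to r² at the cost of a Lipschitz constant for `M`. That constant
-- depends on the number n of terms, which is why n is fixed before the stage m. Likewise the point
-- near 1 where the sum is evaluated is fixed before n, since all exponential decay is measured by a
-- contraction factor that gets worse as k approaches 1.
--
-- The number π enters through finite sums only. The smoothed Leibniz sum `V l` has a closed form in
-- terms of aₗ, and for every n ≤ l it satisfies n aₙ ≤ 1/`V l` ≤ (n + ½) aₙ. So the comparison near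
-- k = 1 is made with `V l` in place of π, and `V l` is exchanged for the partial sums that define π
-- only at the end.

module Rationals where
  open import Data.Rational
  open ℚₚ using (≤-trans; ≤-refl; ≤-reflexive; <⇒≤)
  open import Defs using (module RationalLemmas; pochhammer)
  open RationalLemmas

  -- Ordered-field arithmetic and finite sums over ℚ

  ringℚ : AlmostCommutativeRing _ _
  ringℚ = fromCommutativeRing ℚₚ.+-*-commutativeRing λ x → dec⇒maybe (0ℚ ≟ x)

  ¼ : ℚ
  ¼ = ℤ.+ 1 / 4

  0≤1 : 0ℚ ≤ 1ℚ
  0≤1 = 0≤ι 1

  0<1 : 0ℚ < 1ℚ
  0<1 = ℚₚ.positive⁻¹ 1ℚ

  -- Inequalities are certified by their slack `d`, written so that its sign is visible; the
  -- remaining identity is left to the ring solver.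
  ≤-by : ∀ {a b} d → 0ℚ ≤ d → a + d ≡ b → a ≤ b
  ≤-by {a} d h refl = ≤-trans (≤-reflexive (sym (ℚₚ.+-identityʳ a))) (ℚₚ.+-monoʳ-≤ a h)

  -- An identity modulo the hypothesis a ≡ b is reduced, by its cofactor c, to one
  -- that the ring solver can check.
  modulo : ∀ {l r a b c} → a ≡ b → l ≡ r + (a - b) * c → l ≡ r
  modulo {r = r} {a} {c = c} refl e = trans e (lemma r c a)
    where
      lemma : ∀ r c a → r + (a - a) * c ≡ r
      lemma = solve-∀ ringℚ

  difference≥0 : ∀ {a b} → a ≤ b → 0ℚ ≤ b - a
  difference≥0 {a} {b} h = ≤-trans (≤-reflexive (sym (ℚₚ.+-inverseʳ a))) (ℚₚ.+-monoˡ-≤ (- a) h)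

  ∣+∣≤ : ∀ {a b x y} → ∣ a ∣ ≤ x → ∣ b ∣ ≤ y → ∣ a + b ∣ ≤ x + y
  ∣+∣≤ {a} {b} p q = ≤-trans (ℚₚ.∣p+q∣≤∣p∣+∣q∣ a b) (ℚₚ.+-mono-≤ p q)

  ∣*∣≤ : ∀ {a b x y} → ∣ a ∣ ≤ x → ∣ b ∣ ≤ y → ∣ a * b ∣ ≤ x * y
  ∣*∣≤ {a} {b} {x} {y} p q = ≤-trans (≤-reflexive (ℚₚ.∣p*q∣≡∣p∣*∣q∣ a b))
    (*-mono {∣ a ∣} {x} {∣ b ∣} {y} (ℚₚ.0≤∣p∣ a) (≤-trans (ℚₚ.0≤∣p∣ b) q) p q)

  ∣-∣≤ : ∀ {a x} → ∣ a ∣ ≤ x → ∣ - a ∣ ≤ x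
  ∣-∣≤ {a} = subst (_≤ _) (sym (ℚₚ.∣-p∣≡∣p∣ a))

  ∣≥0∣ : ∀ {a} → 0ℚ ≤ a → ∣ a ∣ ≤ a
  ∣≥0∣ h = ≤-reflexive (ℚₚ.0≤p⇒∣p∣≡p h)

  cancel : ∀ {c x y} → 0ℚ < c → c * x ≡ c * y → x ≡ y
  cancel {c} {x} {y} hc e with recip hc
  ... | d , _ , cd = trans (sym (lemma x)) (trans (cong (d *_) e) (lemma y))
    where
      lemma : ∀ z → d * (c * z) ≡ z
      lemma z = trans (sym (ℚₚ.*-assoc d c z)) (trans (cong (_* z) (trans (ℚₚ.*-comm d c) cd)) (ℚₚ.*-identityˡ z))

  cancel-≤ : ∀ {c x y} → 0ℚ < c → c * x ≤ c * y → x ≤ y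
  cancel-≤ {c} hc = ℚₚ.*-cancelˡ-≤-pos c {{positive hc}}

  *-monoˡ : ∀ {c x y} → 0ℚ ≤ c → x ≤ y → c * x ≤ c * y
  *-monoˡ {c} hc = ℚₚ.*-monoˡ-≤-nonNeg c {{nonNegative hc}}

  0<ι : ∀ n → 0ℚ < ι (suc n)
  0<ι n = ℚₚ.<-≤-trans 0<1 (ι-mono {1} {suc n} (ℕ.s≤s ℕ.z≤n))

  *-inv⁺ : ∀ {p} → 0ℚ < p → p * inv p ≡ 1ℚ
  *-inv⁺ {p} h = *-inv p (subst (0ℚ <_) (sym (ℚₚ.0≤p⇒∣p∣≡p (<⇒≤ h))) h)

  inv-pos : ∀ {p} → 0ℚ < p → 0ℚ < inv p
  inv-pos {p} h = ℚₚ.≰⇒> λ q → ℚₚ.<-irrefl refl (ℚₚ.<-≤-trans 0<1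
    (subst (_≤ 0ℚ) (*-inv⁺ h) (subst (p * inv p ≤_) (ℚₚ.*-zeroʳ p) (*-monoˡ (<⇒≤ h) q))))

  sum : (ℕ → ℚ) → ℕ → ℚ
  sum f zero = 0ℚ
  sum f (suc n) = sum f n + f n

  sum-cong : ∀ {f g} → (∀ n → f n ≡ g n) → ∀ n → sum f n ≡ sum g n
  sum-cong e zero = refl
  sum-cong e (suc n) = cong₂ _+_ (sum-cong e n) (e n)

  sum-abs : ∀ {f g} n → (∀ i → i ℕ.< n → ∣ f i ∣ ≤ g i) → ∣ sum f n ∣ ≤ sum g n
  sum-abs zero h = ≤-refl
  sum-abs (suc n) h = ∣+∣≤ (sum-abs n λ i p → h i (ℕₚ.m≤n⇒m≤1+n p)) (h n ℕₚ.≤-refl)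

  sum-nonNeg : ∀ {f} → (∀ n → 0ℚ ≤ f n) → ∀ n → 0ℚ ≤ sum f n
  sum-nonNeg h zero = ≤-refl
  sum-nonNeg h (suc n) = +-nonNeg (sum-nonNeg h n) (h n)

  difference>0 : ∀ {a b} → a < b → 0ℚ < b - a
  difference>0 {a} {b} h = subst (_< b - a) (ℚₚ.+-inverseʳ a) (ℚₚ.+-monoˡ-< (- a) h)

  square<1 : ∀ {x} → 0ℚ ≤ x → x < 1ℚ → x * x < 1ℚ
  square<1 {x} 0≤x x<1 = ℚₚ.≤-<-trans (*-monoˡ 0≤x (<⇒≤ x<1)) (subst (_< 1ℚ) (sym (ℚₚ.*-identityʳ x)) x<1)

  ι-+ : ∀ m n → ι (m ℕ.+ n) ≡ ι m + ι n
  ι-+ zero n = sym (ℚₚ.+-identityˡ (ι n))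
  ι-+ (suc m) n = trans (ι-suc (m ℕ.+ n)) (trans (cong (1ℚ +_) (ι-+ m n))
    (trans (sym (ℚₚ.+-assoc 1ℚ (ι m) (ι n))) (cong (_+ ι n) (sym (ι-suc m)))))

  ι-* : ∀ m n → ι (m ℕ.* n) ≡ ι m * ι n
  ι-* zero n = sym (ℚₚ.*-zeroˡ (ι n))
  ι-* (suc m) n = trans (ι-+ n (m ℕ.* n)) (trans (cong (ι n +_) (ι-* m n))
    (trans (lemma (ι m) (ι n)) (cong (_* ι n) (sym (ι-suc m)))))
    where
      lemma : ∀ m n → n + m * n ≡ (1ℚ + m) * n
      lemma = solve-∀ ringℚ

  ι*/ : ∀ i d → ι (suc d) * (i / suc d) ≡ fromℤ i
  ι*/ i d = ℚₚ.toℚᵘ-injective (ℚᵘₚ.≃-trans (ℚₚ.toℚᵘ-homo-* (ι (suc d)) (i / suc d))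
    (ℚᵘₚ.≃-trans (ℚᵘₚ.*-congˡ (ℚₚ.toℚᵘ-fromℚᵘ (ℚᵘ.mkℚᵘ i d)))
      (ℚᵘ.*≡* (trans (ℤₚ.*-identityʳ _) (trans (ℤₚ.*-comm (ℤ.+ suc d) i) (cong (λ t → i ℤ.* ℤ.+ suc t) (sym (ℕₚ.+-identityʳ d))))))))

  -- Legendre polynomials by recurrence, and the reduction of the series

  -- leg τ s n = cⁿ Pₙ(τ/c) where s = c², and leg⁻ τ s n = leg τ s (n-1), with 0 at n = 0.
  mutual
    leg : ℚ → ℚ → ℕ → ℚ
    leg τ s zero = 1ℚ
    leg τ s (suc n) = ((ι 2 * ι n + 1ℚ) * (τ * leg τ s n) - ι n * (s * leg⁻ τ s n)) * inv (ι (suc n))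

    leg⁻ : ℚ → ℚ → ℕ → ℚ
    leg⁻ τ s zero = 0ℚ
    leg⁻ τ s (suc n) = leg τ s n

  *-inv-cancel : ∀ n x y → y ≡ x * inv (ι (suc n)) → (1ℚ + ι n) * y ≡ x
  *-inv-cancel n x y refl = trans (cong (_* (x * inv (ι (suc n)))) (sym (ι-suc n)))
    (trans (lemma (ι (suc n)) x (inv (ι (suc n)))) (trans (cong (x *_) (*-inv⁺ (0<ι n))) (ℚₚ.*-identityʳ x)))
    where
      lemma : ∀ a x b → a * (x * b) ≡ x * (a * b)
      lemma = solve-∀ ringℚ

  leg-rec : ∀ τ s n → (1ℚ + ι n) * leg τ s (suc n) ≡ (ι 2 * ι n + 1ℚ) * (τ * leg τ s n) - ι n * (s * leg⁻ τ s n)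
  leg-rec τ s n = *-inv-cancel n _ _ refl

  -- The recurrence shifted down by one, with `leg⁻ τ s (ℕ.pred n)` in the role of Pₙ₋₂. Since
  -- `leg⁻` is 0 at 0, it also holds at n = 0, so later inductions need no separate case.
  leg⁻-rec : ∀ τ s n → ι n * leg τ s n ≡ (ι 2 * ι n - 1ℚ) * (τ * leg⁻ τ s n) - (ι n - 1ℚ) * (s * leg⁻ τ s (ℕ.pred n))
  leg⁻-rec τ s zero = lemma τ s
    where
      lemma : ∀ τ s → 0ℚ * 1ℚ ≡ (ι 2 * 0ℚ - 1ℚ) * (τ * 0ℚ) - (0ℚ - 1ℚ) * (s * 0ℚ)
      lemma = solve-∀ ringℚ
  leg⁻-rec τ s (suc n) = subst
    (λ ν → ν * leg τ s (suc n) ≡ (ι 2 * ν - 1ℚ) * (τ * leg τ s n) - (ν - 1ℚ) * (s * leg⁻ τ s n)) (sym (ι-suc n))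
    (trans (leg-rec τ s n) (lemma (ι n) (τ * leg τ s n) (s * leg⁻ τ s n)))
    where
      lemma : ∀ n a b → (ι 2 * n + 1ℚ) * a - n * b ≡ (ι 2 * (1ℚ + n) - 1ℚ) * a - (1ℚ + n - 1ℚ) * b
      lemma = solve-∀ ringℚ

  -- binom(2n,n)² / 16ⁿ
  coeff : ℕ → ℚ
  coeff zero = 1ℚ
  coeff (suc n) = ¼ * ((ι 2 * ι n + 1ℚ) * (ι 2 * ι n + 1ℚ)) * coeff n * inv (ι (suc n)) * inv (ι (suc n))

  coeff-rec : ∀ n → (1ℚ + ι n) * ((1ℚ + ι n) * coeff (suc n)) ≡ ¼ * ((ι 2 * ι n + 1ℚ) * (ι 2 * ι n + 1ℚ)) * coeff n
  coeff-rec n = trans (cong ((1ℚ + ι n) *_) (*-inv-cancel n _ _ refl)) (*-inv-cancel n _ _ refl)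

  -- In the notation of the theorem, ζ = -16 z, τ = 16 z x and p k n = (16 z)ⁿ Pₙ(x).
  Q ζ τ : ℚ → ℚ
  Q k = ι 4 * k * k - ι 3 * k + 1ℚ
  ζ k = ¼ * (ι 4 * k * k + k - ι 2 + inv k)
  τ k = ¼ * (ι 2 + k + ι 2 * k * k * k - inv k)

  p p⁻ : ℚ → ℕ → ℚ
  p k = leg (τ k) (ζ k * ζ k)
  p⁻ k = leg⁻ (τ k) (ζ k * ζ k)

  -- The series left after telescoping; M k n tends to 4 √k / π.
  term : ℚ → ℕ → ℚ
  term k n = coeff n * ((ι 2 * (ι 2 - k * k) * ι n + (1ℚ - k * k)) * p k n - ι 2 * (ι 2 * k - 1ℚ) * (ι n * (ζ k * p⁻ k n)))

  M : ℚ → ℕ → ℚ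
  M k = sum (term k)

  module _ (k : ℚ) (k≢0 : k * inv k ≡ 1ℚ) where

    4kζ : ι 4 * (k * ζ k) ≡ (1ℚ + k) * Q k
    4kζ = modulo k≢0 (lemma k (inv k))
      where
        lemma : ∀ k w → ι 4 * (k * (¼ * (ι 4 * k * k + k - ι 2 + w))) ≡
          (1ℚ + k) * (ι 4 * k * k - ι 3 * k + 1ℚ) + (k * w - 1ℚ) * 1ℚ
        lemma = solve-∀ ringℚ

    4kτ : ι 4 * (k * τ k) ≡ - (1ℚ + k) * (1ℚ - ι 3 * k + ι 2 * k * k - ι 2 * k * k * k)
    4kτ = modulo k≢0 (lemma k (inv k))
      where
        lemma : ∀ k w → ι 4 * (k * (¼ * (ι 2 + k + ι 2 * k * k * k - w))) ≡
          - (1ℚ + k) * (1ℚ - ι 3 * k + ι 2 * k * k - ι 2 * k * k * k) + (k * w - 1ℚ) * - 1ℚ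
        lemma = solve-∀ ringℚ

    module Original (v : ℚ) (k+1≢0 : (1ℚ + k) * v ≡ 1ℚ) where

      r C₃ C₂ C₁ C₀ : ℚ
      r = - ι 64 * k * k * (ι 2 * k - 1ℚ) * v
      C₃ = ι 4 * ((k - 1ℚ) * (k - 1ℚ)) * v * (ι 2 * k - 1ℚ) * ((ι 4 * k * k + ι 3 * k + 1ℚ) * (ι 4 * k * k + ι 3 * k + 1ℚ))
      C₂ = ι 12 * (k - 1ℚ) * (ι 2 * k - 1ℚ) * (ι 16 * (k * k * k * k) + k * k - 1ℚ)
      C₁ = ι 288 * (k * k * k * k * k * k) - ι 400 * (k * k * k * k * k) + ι 102 * (k * k * k * k) + ι 97 * (k * k * k) - ι 93 * (k * k) + ι 47 * k - ι 9
      C₀ = ι 2 * (ι 32 * (k * k * k * k * k * k) - ι 44 * (k * k * k * k * k) + ι 9 * (k * k * k * k) + ι 16 * (k * k * k) - ι 14 * (k * k) + ι 6 * k - 1ℚ)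

      rτ : r * τ k ≡ ι 16 * k * (ι 2 * k - 1ℚ) * (1ℚ - ι 3 * k + ι 2 * k * k - ι 2 * k * k * k)
      rτ = trans (lemma₁ k v (τ k)) (trans (cong (- ι 16 * k * (ι 2 * k - 1ℚ) * v *_) 4kτ) (modulo k+1≢0 (lemma₂ k v)))
        where
          lemma₁ : ∀ k v t → - ι 64 * k * k * (ι 2 * k - 1ℚ) * v * t ≡ - ι 16 * k * (ι 2 * k - 1ℚ) * v * (ι 4 * (k * t))
          lemma₁ = solve-∀ ringℚ
          lemma₂ : ∀ k v → - ι 16 * k * (ι 2 * k - 1ℚ) * v * (- (1ℚ + k) * (1ℚ - ι 3 * k + ι 2 * k * k - ι 2 * k * k * k)) ≡
            ι 16 * k * (ι 2 * k - 1ℚ) * (1ℚ - ι 3 * k + ι 2 * k * k - ι 2 * k * k * k) +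
            ((1ℚ + k) * v - 1ℚ) * (ι 16 * k * (ι 2 * k - 1ℚ) * (1ℚ - ι 3 * k + ι 2 * k * k - ι 2 * k * k * k))
          lemma₂ = solve-∀ ringℚ

      rζζ : r * (ζ k * ζ k) ≡ - ι 4 * (ι 2 * k - 1ℚ) * (1ℚ + k) * (Q k * Q k)
      rζζ = trans (lemma₁ k v (ζ k)) (trans (cong (λ t → - ι 4 * (ι 2 * k - 1ℚ) * v * (t * t)) 4kζ) (modulo k+1≢0 (lemma₂ k v (Q k))))
        where
          lemma₁ : ∀ k v t → - ι 64 * k * k * (ι 2 * k - 1ℚ) * v * (t * t) ≡ - ι 4 * (ι 2 * k - 1ℚ) * v * (ι 4 * (k * t) * (ι 4 * (k * t)))
          lemma₁ = solve-∀ ringℚ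
          lemma₂ : ∀ k v q → - ι 4 * (ι 2 * k - 1ℚ) * v * ((1ℚ + k) * q * ((1ℚ + k) * q)) ≡
            - ι 4 * (ι 2 * k - 1ℚ) * (1ℚ + k) * (q * q) + ((1ℚ + k) * v - 1ℚ) * (- ι 4 * (ι 2 * k - 1ℚ) * (1ℚ + k) * (q * q))
          lemma₂ = solve-∀ ringℚ

      -- The n³ coefficient of `p k n` in `step` vanishes exactly when C₃ = -r + 2rτ - rζ²; this is
      -- what determines `r`. Here rτ and rζ² are already replaced by their polynomial values.
      C₃-r : C₃ ≡ - r + ι 2 * (ι 16 * k * (ι 2 * k - 1ℚ) * (1ℚ - ι 3 * k + ι 2 * k * k - ι 2 * k * k * k)) - (- ι 4 * (ι 2 * k - 1ℚ) * (1ℚ + k) * (Q k * Q k))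
      C₃-r = modulo k+1≢0 (lemma k v)
        where
          lemma : ∀ k v → ι 4 * ((k - 1ℚ) * (k - 1ℚ)) * v * (ι 2 * k - 1ℚ) * ((ι 4 * k * k + ι 3 * k + 1ℚ) * (ι 4 * k * k + ι 3 * k + 1ℚ)) ≡
            - (- ι 64 * k * k * (ι 2 * k - 1ℚ) * v) + ι 2 * (ι 16 * k * (ι 2 * k - 1ℚ) * (1ℚ - ι 3 * k + ι 2 * k * k - ι 2 * k * k * k))
              - (- ι 4 * (ι 2 * k - 1ℚ) * (1ℚ + k) * ((ι 4 * k * k - ι 3 * k + 1ℚ) * (ι 4 * k * k - ι 3 * k + 1ℚ)))
            + ((1ℚ + k) * v - 1ℚ) * ((- ι 4 - ι 4 * k + ι 76 * k * k - ι 140 * (k * k * k) + ι 168 * (k * k * k * k) - ι 256 * (k * k * k * k * k) + ι 128 * (k * k * k * k * k * k)))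
          lemma = solve-∀ ringℚ

      original : ℕ → ℚ
      original n = coeff n * p k n * (C₃ * (ι n * ι n * ι n) + C₂ * (ι n * ι n) + C₁ * ι n + C₀)

      -- Found by undetermined coefficients, so as to cancel the terms in n³ and n².
      boundary : ℕ → ℚ
      boundary n = r * (coeff n * (ι n * ι n * ι n * p k n - ζ k * ζ k * (ι n * ι n * (1ℚ + ι n) * p⁻ k n)))

      -- Both weights, n³ and n²(n + 1), contain n². At n + 1 this square clears the denominators of
      -- `coeff-rec`, and the third factor of the cube clears that of `leg-rec`, so everything is
      -- expressed by the values at n.
      boundary-suc : ∀ n → boundary (suc n) ≡ r * (¼ * ((ι 2 * ι n + 1ℚ) * (ι 2 * ι n + 1ℚ)) * coeff n *
        ((ι 2 * ι n + 1ℚ) * (τ k * p k n) - ι n * (ζ k * ζ k * p⁻ k n) - ζ k * ζ k * (ι 2 + ι n) * p k n))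
      boundary-suc n = trans
        (cong (λ ν → r * (coeff (suc n) * (ν * ν * ν * p k (suc n) - ζ k * ζ k * (ν * ν * (1ℚ + ν) * p k n)))) (ι-suc n))
        (trans (lemma r (coeff (suc n)) (ι n) (p k (suc n)) (p k n) (ζ k * ζ k))
          (cong₂ (λ a b → r * (a * (b - ζ k * ζ k * (ι 2 + ι n) * p k n))) (coeff-rec n) (leg-rec (τ k) (ζ k * ζ k) n)))
        where
          lemma : ∀ r a n p′ p s → r * (a * ((1ℚ + n) * (1ℚ + n) * (1ℚ + n) * p′ - s * ((1ℚ + n) * (1ℚ + n) * (1ℚ + (1ℚ + n)) * p))) ≡
            r * ((1ℚ + n) * ((1ℚ + n) * a) * ((1ℚ + n) * p′ - s * (ι 2 + n) * p))
          lemma = solve-∀ ringℚ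

      step : ∀ n → original n + boundary n ≡ ι 2 * k * Q k * term k n + boundary (suc n)
      step n = trans (modulo rτ (modulo rζζ (modulo C₃-r (modulo 4kζ
          (lemma k (ι n) (coeff n) (p k n) (p⁻ k n) (ζ k) (τ k) r C₃ (ζ k * ζ k))))))
        (cong (ι 2 * k * Q k * term k n +_) (sym (boundary-suc n)))
        where
          lemma : ∀ k n a p pm z t r C₃ s →
            let Q = ι 4 * k * k - ι 3 * k + 1ℚ
                C₂ = ι 12 * (k - 1ℚ) * (ι 2 * k - 1ℚ) * (ι 16 * (k * k * k * k) + k * k - 1ℚ)
                C₁ = ι 288 * (k * k * k * k * k * k) - ι 400 * (k * k * k * k * k) + ι 102 * (k * k * k * k) + ι 97 * (k * k * k) - ι 93 * (k * k) + ι 47 * k - ι 9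
                C₀ = ι 2 * (ι 32 * (k * k * k * k * k * k) - ι 44 * (k * k * k * k * k) + ι 9 * (k * k * k * k) + ι 16 * (k * k * k) - ι 14 * (k * k) + ι 6 * k - 1ℚ)
            in a * p * (C₃ * (n * n * n) + C₂ * (n * n) + C₁ * n + C₀) + r * (a * (n * n * n * p - s * (n * n * (1ℚ + n) * pm))) ≡
            (((ι 2 * k * Q * (a * ((ι 2 * (ι 2 - k * k) * n + (1ℚ - k * k)) * p - ι 2 * (ι 2 * k - 1ℚ) * (n * (z * pm))))
            + r * (¼ * ((ι 2 * n + 1ℚ) * (ι 2 * n + 1ℚ)) * a * ((ι 2 * n + 1ℚ) * (t * p) - n * (s * pm) - s * (ι 2 + n) * p)))
            + (r * t - ι 16 * k * (ι 2 * k - 1ℚ) * (1ℚ - ι 3 * k + ι 2 * k * k - ι 2 * k * k * k)) * (- (a * p * ¼ * ((ι 2 * n + 1ℚ) * (ι 2 * n + 1ℚ) * (ι 2 * n + 1ℚ)))))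
            + (r * s - - ι 4 * (ι 2 * k - 1ℚ) * (1ℚ + k) * (Q * Q)) * (¼ * a * ((ι 2 * n + 1ℚ) * (ι 2 * n + 1ℚ) * (n + ι 2) * p + n * pm))
            + (C₃ - (- r + ι 2 * (ι 16 * k * (ι 2 * k - 1ℚ) * (1ℚ - ι 3 * k + ι 2 * k * k - ι 2 * k * k * k)) - (- ι 4 * (ι 2 * k - 1ℚ) * (1ℚ + k) * (Q * Q)))) * (a * n * n * n * p))
            + (ι 4 * (k * z) - (1ℚ + k) * Q) * (a * Q * (ι 2 * k - 1ℚ) * n * pm)
          lemma = solve-∀ ringℚ

      sum-original : ∀ n → sum original n ≡ ι 2 * k * Q k * M k n + boundary n
      sum-original zero = lemma r (ζ k) (ι 2 * k * Q k)
        where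
          lemma : ∀ r z c → 0ℚ ≡ c * 0ℚ + r * (1ℚ * (0ℚ * 0ℚ * 0ℚ * 1ℚ - z * z * (0ℚ * 0ℚ * (1ℚ + 0ℚ) * 0ℚ)))
          lemma = solve-∀ ringℚ
      sum-original (suc n) = trans (cong (_+ original n) (sum-original n))
        (trans (lemma₁ (ι 2 * k * Q k) (M k n) (boundary n) (original n))
          (trans (cong (ι 2 * k * Q k * M k n +_) (step n)) (lemma₂ (ι 2 * k * Q k) (M k n) (term k n) (boundary (suc n)))))
        where
          lemma₁ : ∀ c m b o → c * m + b + o ≡ c * m + (o + b)
          lemma₁ = solve-∀ ringℚ
          lemma₂ : ∀ c m t b → c * m + (c * t + b) ≡ c * (m + t) + b
          lemma₂ = solve-∀ ringℚ

  -- Wallis' product and the Leibniz series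

  0<1+ι : ∀ n → 0ℚ < 1ℚ + ι n
  0<1+ι n = +-pos 0<1 (0≤ι n)

  0<2ι+1 : ∀ n → 0ℚ < ι 2 * ι n + 1ℚ
  0<2ι+1 n = subst (0ℚ <_) (ℚₚ.+-comm 1ℚ (ι 2 * ι n)) (+-pos 0<1 (*-nonNeg (0≤ι 2) (0≤ι n)))

  coeff>0 : ∀ n → 0ℚ < coeff n
  coeff>0 zero = 0<1
  coeff>0 (suc n) = *-pos (*-pos (*-pos (*-pos {¼} (ℚₚ.positive⁻¹ ¼) (*-pos (0<2ι+1 n) (0<2ι+1 n))) (coeff>0 n)) (inv-pos (0<ι n))) (inv-pos (0<ι n))

  -- Comes down to n(n + 1) + ¼ = (n + ½)². Together with the opposite monotonicity of (2n + 1) aₙ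
  -- below, it encloses the Wallis limit from both sides.
  ι*coeff-mono : ∀ n → ι n * coeff n ≤ ι (suc n) * coeff (suc n)
  ι*coeff-mono n = cancel-≤ (0<1+ι n) (subst ((1ℚ + ι n) * (ι n * coeff n) ≤_)
    (trans (sym (coeff-rec n)) (cong (λ ν → (1ℚ + ι n) * (ν * coeff (suc n))) (sym (ι-suc n))))
    (≤-by (¼ * coeff n) (*-nonNeg (<⇒≤ (ℚₚ.positive⁻¹ ¼)) (<⇒≤ (coeff>0 n))) (lemma (ι n) (coeff n))))
    where
      lemma : ∀ n a → (1ℚ + n) * (n * a) + ¼ * a ≡ ¼ * ((ι 2 * n + 1ℚ) * (ι 2 * n + 1ℚ)) * a
      lemma = solve-∀ ringℚ

  [2ι+1]*coeff-anti : ∀ n → (ι 2 * ι (suc n) + 1ℚ) * coeff (suc n) ≤ (ι 2 * ι n + 1ℚ) * coeff n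
  [2ι+1]*coeff-anti n = cancel-≤ (*-pos (0<1+ι n) (0<1+ι n)) (subst (_≤ (1ℚ + ι n) * (1ℚ + ι n) * ((ι 2 * ι n + 1ℚ) * coeff n))
    (trans (cong ((ι 2 * (1ℚ + ι n) + 1ℚ) *_) (sym (coeff-rec n)))
      (trans (lemma₁ (ι n) (coeff (suc n))) (cong (λ ν → (1ℚ + ι n) * (1ℚ + ι n) * ((ι 2 * ν + 1ℚ) * coeff (suc n))) (sym (ι-suc n)))))
    (≤-by (¼ * ((ι 2 * ι n + 1ℚ) * coeff n)) (*-nonNeg (<⇒≤ (ℚₚ.positive⁻¹ ¼)) (*-nonNeg (<⇒≤ (0<2ι+1 n)) (<⇒≤ (coeff>0 n)))) (lemma₂ (ι n) (coeff n))))
    where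
      lemma₁ : ∀ n a → (ι 2 * (1ℚ + n) + 1ℚ) * ((1ℚ + n) * ((1ℚ + n) * a)) ≡ (1ℚ + n) * (1ℚ + n) * ((ι 2 * (1ℚ + n) + 1ℚ) * a)
      lemma₁ = solve-∀ ringℚ
      lemma₂ : ∀ n a → (ι 2 * (1ℚ + n) + 1ℚ) * (¼ * ((ι 2 * n + 1ℚ) * (ι 2 * n + 1ℚ)) * a) + ¼ * ((ι 2 * n + 1ℚ) * a) ≡
        (1ℚ + n) * (1ℚ + n) * ((ι 2 * n + 1ℚ) * a)
      lemma₂ = solve-∀ ringℚ

  monotone : ∀ (f : ℕ → ℚ) → (∀ n → f n ≤ f (suc n)) → ∀ {m n} → m ℕ.≤ n → f m ≤ f n
  monotone f h {n = zero} ℕ.z≤n = ≤-refl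
  monotone f h {n = suc n} m≤n with ℕₚ.m≤n⇒m<n∨m≡n m≤n
  ... | inj₁ (ℕ.s≤s m≤n′) = ≤-trans (monotone f h m≤n′) (h n)
  ... | inj₂ refl = ≤-refl

  [2ι+1]*coeff≤1 : ∀ n → (ι 2 * ι n + 1ℚ) * coeff n ≤ 1ℚ
  [2ι+1]*coeff≤1 zero = ≤-refl
  [2ι+1]*coeff≤1 (suc n) = ≤-trans ([2ι+1]*coeff-anti n) ([2ι+1]*coeff≤1 n)

  ι*coeff≤1 : ∀ n → ι n * coeff n ≤ 1ℚ
  ι*coeff≤1 n = ≤-trans (≤-by ((ι n + 1ℚ) * coeff n) (*-nonNeg (+-nonNeg (0≤ι n) 0≤1) (<⇒≤ (coeff>0 n))) (lemma (ι n) (coeff n))) ([2ι+1]*coeff≤1 n)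
    where
      lemma : ∀ n a → n * a + (n + 1ℚ) * a ≡ (ι 2 * n + 1ℚ) * a
      lemma = solve-∀ ringℚ

  coeff≤1 : ∀ n → coeff n ≤ 1ℚ
  coeff≤1 n = ≤-trans (≤-by (ι 2 * ι n * coeff n) (*-nonNeg (*-nonNeg (0≤ι 2) (0≤ι n)) (<⇒≤ (coeff>0 n))) (lemma (ι n) (coeff n))) ([2ι+1]*coeff≤1 n)
    where
      lemma : ∀ n a → a + ι 2 * n * a ≡ (ι 2 * n + 1ℚ) * a
      lemma = solve-∀ ringℚ

  -- binom(2l+1, l-j) / binom(2l+1, l)
  weight : ℕ → ℕ → ℚ
  weight l zero = 1ℚ
  weight l (suc j) = weight l j * (ι l - ι j) * inv (ι 2 + ι l + ι j)

  0<2+ι+ι : ∀ l j → 0ℚ < ι 2 + ι l + ι j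
  0<2+ι+ι l j = +-pos (+-pos (0<ι 1) (0≤ι l)) (0≤ι j)

  weight-rec : ∀ l j → (ι 2 + ι l + ι j) * weight l (suc j) ≡ weight l j * (ι l - ι j)
  weight-rec l j = trans (lemma (ι 2 + ι l + ι j) (weight l j * (ι l - ι j)) (inv (ι 2 + ι l + ι j)))
    (trans (cong (weight l j * (ι l - ι j) *_) (*-inv⁺ (0<2+ι+ι l j))) (ℚₚ.*-identityʳ (weight l j * (ι l - ι j))))
    where
      lemma : ∀ a x b → a * (x * b) ≡ x * (a * b)
      lemma = solve-∀ ringℚ

  weight-end : ∀ l → weight l (suc l) ≡ 0ℚ
  weight-end l = trans (cong (λ t → weight l l * t * inv (ι 2 + ι l + ι l)) (ℚₚ.+-inverseʳ (ι l))) (lemma (weight l l) (inv (ι 2 + ι l + ι l)))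
    where
      lemma : ∀ a b → a * 0ℚ * b ≡ 0ℚ
      lemma = solve-∀ ringℚ

  weight-step : ∀ l j → (1ℚ + ι l) * (ι 2 + ι l) * weight l j ≡ weight (suc l) j * ((1ℚ + ι l - ι j) * (ι 2 + ι l + ι j))
  weight-step l zero = lemma (ι l)
    where
      lemma : ∀ l → (1ℚ + l) * (ι 2 + l) * 1ℚ ≡ 1ℚ * ((1ℚ + l - 0ℚ) * (ι 2 + l + 0ℚ))
      lemma = solve-∀ ringℚ
  weight-step l (suc j) = cancel (0<2+ι+ι l j) (trans (lemma₁ (1ℚ + ι l) (ι 2 + ι l) (ι 2 + ι l + ι j) (weight l (suc j)))
    (trans (cong ((1ℚ + ι l) * (ι 2 + ι l) *_) (weight-rec l j))
    (trans (lemma₂ (1ℚ + ι l) (ι 2 + ι l) (weight l j) (ι l - ι j))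
    (trans (cong (_* (ι l - ι j)) (weight-step l j))
    (trans (lemma₃ (ι l) (ι j) (weight (suc l) j))
    (trans (cong ((ι l - ι j) * (ι 2 + ι l + ι j) *_) (trans (cong (λ ν → weight (suc l) j * (ν - ι j)) (sym (ι-suc l)))
      (trans (sym (weight-rec (suc l) j)) (cong (λ ν → (ι 2 + ν + ι j) * weight (suc l) (suc j)) (ι-suc l)))))
    (trans (lemma₄ (ι l) (ι j) (weight (suc l) (suc j)))
      (cong (λ ν → (ι 2 + ι l + ι j) * (weight (suc l) (suc j) * ((1ℚ + ι l - ν) * (ι 2 + ι l + ν)))) (sym (ι-suc j))))))))))
    where
      lemma₁ : ∀ a b c w → c * (a * b * w) ≡ a * b * (c * w)
      lemma₁ = solve-∀ ringℚ
      lemma₂ : ∀ a b w d → a * b * (w * d) ≡ a * b * w * d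
      lemma₂ = solve-∀ ringℚ
      lemma₃ : ∀ l j w → w * ((1ℚ + l - j) * (ι 2 + l + j)) * (l - j) ≡ (l - j) * (ι 2 + l + j) * (w * (1ℚ + l - j))
      lemma₃ = solve-∀ ringℚ
      lemma₄ : ∀ l j w → (l - j) * (ι 2 + l + j) * ((ι 2 + (1ℚ + l) + j) * w) ≡ (ι 2 + l + j) * (w * ((1ℚ + l - (1ℚ + j)) * (ι 2 + l + (1ℚ + j))))
      lemma₄ = solve-∀ ringℚ

  [2ι+1]*leibnizTerm : ∀ j → (ι 2 * ι j + 1ℚ) * leibnizTerm j ≡ ι 4
  [2ι+1]*leibnizTerm j = trans (cong (_* leibnizTerm j) (sym (trans (ι-suc (2 ℕ.* j)) (trans (cong (1ℚ +_) (ι-* 2 j)) (ℚₚ.+-comm 1ℚ (ι 2 * ι j))))))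
    (ι*/ (ℤ.+ 4) (2 ℕ.* j))

  weighted : ℕ → ℕ → ℚ
  weighted l j = sign j * leibnizTerm j * weight l j

  -- The Leibniz series smoothed by binomial weights.
  V : ℕ → ℚ
  V l = sum (weighted l) (suc l)

  -- Creative telescoping in the summation index: the two sums differ termwise by a difference of ±4
  -- n (l + 2 + n) `weight (suc l) n`, which vanishes at both ends.
  V-recurrence : ∀ l → (ι 2 * ι l + ι 3) * (ι 2 * ι l + ι 3) * V (suc l) ≡ ι 4 * (1ℚ + ι l) * (ι 2 + ι l) * V l
  V-recurrence l = cancel (0<1+ι l) (trans (modulo (weight-end (suc l)) (lemma₁ (ι l) (sign N) (ι N) (weight (suc l) N) (V (suc l))))
    (trans (sym (telescope N)) (modulo (weight-end l) (lemma₂ (ι l) (V l) (sign (suc l)) (leibnizTerm (suc l)) (weight l (suc l))))))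
    where
      -- `V (suc l)` has l + 2 terms. The one term too many for `V l`, and the telescoped quantity
      -- at `N`, both vanish by `weight-end`.
      N : ℕ
      N = suc (suc l)
      telescope : ∀ n → (1ℚ + ι l) * (ι 4 * (1ℚ + ι l) * (ι 2 + ι l) * sum (weighted l) n) ≡
        (1ℚ + ι l) * ((ι 2 * ι l + ι 3) * (ι 2 * ι l + ι 3) * sum (weighted (suc l)) n) + ι 4 * sign n * (ι n * (ι 2 + ι l + ι n) * weight (suc l) n)
      telescope zero = lemma (ι l)
        where
          lemma : ∀ l → (1ℚ + l) * (ι 4 * (1ℚ + l) * (ι 2 + l) * 0ℚ) ≡ (1ℚ + l) * ((ι 2 * l + ι 3) * (ι 2 * l + ι 3) * 0ℚ) + ι 4 * 1ℚ * (0ℚ * (ι 2 + l + 0ℚ) * 1ℚ)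
          lemma = solve-∀ ringℚ
      telescope (suc n) = trans (modulo (telescope n) (modulo (weight-step l n) (modulo ([2ι+1]*leibnizTerm n) (modulo weight-rec′
          (lemma (ι l) (ι n) (sum (weighted l) n) (sum (weighted (suc l)) n) (sign n) (leibnizTerm n) (weight l n) (weight (suc l) n) (weight (suc l) (suc n)))))))
        (cong (λ ν → (1ℚ + ι l) * ((ι 2 * ι l + ι 3) * (ι 2 * ι l + ι 3) * (sum (weighted (suc l)) n + sign n * leibnizTerm n * weight (suc l) n))
          + ι 4 * - sign n * (ν * (ι 2 + ι l + ν) * weight (suc l) (suc n))) (sym (ι-suc n)))
        where
          weight-rec′ : (ι 3 + ι l + ι n) * weight (suc l) (suc n) ≡ weight (suc l) n * (1ℚ + ι l - ι n)
          weight-rec′ = trans (cong (λ t → (t + ι n) * weight (suc l) (suc n)) (lemma₀ (ι l)))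
            (subst (λ ν → (ι 2 + ν + ι n) * weight (suc l) (suc n) ≡ weight (suc l) n * (ν - ι n)) (ι-suc l) (weight-rec (suc l) n))
            where
              lemma₀ : ∀ l → ι 3 + l ≡ ι 2 + (1ℚ + l)
              lemma₀ = solve-∀ ringℚ
          lemma : ∀ l n S S′ s t w w′ w″ →
            (1ℚ + l) * (ι 4 * (1ℚ + l) * (ι 2 + l) * (S + s * t * w)) ≡
            ((((1ℚ + l) * ((ι 2 * l + ι 3) * (ι 2 * l + ι 3) * (S′ + s * t * w′)) + ι 4 * - s * ((1ℚ + n) * (ι 2 + l + (1ℚ + n)) * w″)
            + ((1ℚ + l) * (ι 4 * (1ℚ + l) * (ι 2 + l) * S) - ((1ℚ + l) * ((ι 2 * l + ι 3) * (ι 2 * l + ι 3) * S′) + ι 4 * s * (n * (ι 2 + l + n) * w′))) * 1ℚ)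
            + ((1ℚ + l) * (ι 2 + l) * w - w′ * ((1ℚ + l - n) * (ι 2 + l + n))) * (ι 4 * (1ℚ + l) * s * t))
            + ((ι 2 * n + 1ℚ) * t - ι 4) * (- (1ℚ + l) * s * w′ * (ι 2 * n + 1ℚ)))
            + ((ι 3 + l + n) * w″ - w′ * (1ℚ + l - n)) * (ι 4 * s * (1ℚ + n))
          lemma = solve-∀ ringℚ
      lemma₁ : ∀ l s n w V → (1ℚ + l) * ((ι 2 * l + ι 3) * (ι 2 * l + ι 3) * V) ≡
        ((1ℚ + l) * ((ι 2 * l + ι 3) * (ι 2 * l + ι 3) * V) + ι 4 * s * (n * (ι 2 + l + n) * w)) + (w - 0ℚ) * (- ι 4 * s * n * (ι 2 + l + n))
      lemma₁ = solve-∀ ringℚ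
      lemma₂ : ∀ l V s t w → (1ℚ + l) * (ι 4 * (1ℚ + l) * (ι 2 + l) * (V + s * t * w)) ≡
        (1ℚ + l) * (ι 4 * (1ℚ + l) * (ι 2 + l) * V) + (w - 0ℚ) * ((1ℚ + l) * (ι 4 * (1ℚ + l) * (ι 2 + l)) * s * t)
      lemma₂ = solve-∀ ringℚ

  -- Both sides satisfy the same first-order recurrence. This links Wallis to Leibniz: l aₗ `V l` =
  -- 4 l (l + 1) / (2l + 1)², which tends to 1.
  V-closed : ∀ l → (ι 2 * ι l + 1ℚ) * (ι 2 * ι l + 1ℚ) * coeff l * V l ≡ ι 4 * (1ℚ + ι l)
  V-closed zero = refl
  V-closed (suc l) = cancel (*-pos (0<1+ι l) (0<1+ι l)) (subst
    (λ ν → (1ℚ + ι l) * (1ℚ + ι l) * ((ι 2 * ν + 1ℚ) * (ι 2 * ν + 1ℚ) * coeff (suc l) * V (suc l)) ≡ (1ℚ + ι l) * (1ℚ + ι l) * (ι 4 * (1ℚ + ν))) (sym (ι-suc l))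
    (modulo (coeff-rec l) (modulo (V-recurrence l) (modulo (V-closed l) (lemma (ι l) (coeff l) (coeff (suc l)) (V l) (V (suc l)))))))
    where
      lemma : ∀ l a a′ v v′ →
        (1ℚ + l) * (1ℚ + l) * ((ι 2 * (1ℚ + l) + 1ℚ) * (ι 2 * (1ℚ + l) + 1ℚ) * a′ * v′) ≡
        (((1ℚ + l) * (1ℚ + l) * (ι 4 * (1ℚ + (1ℚ + l)))
        + ((1ℚ + l) * ((1ℚ + l) * a′) - ¼ * ((ι 2 * l + 1ℚ) * (ι 2 * l + 1ℚ)) * a) * ((ι 2 * l + ι 3) * (ι 2 * l + ι 3) * v′))
        + ((ι 2 * l + ι 3) * (ι 2 * l + ι 3) * v′ - ι 4 * (1ℚ + l) * (ι 2 + l) * v) * (¼ * ((ι 2 * l + 1ℚ) * (ι 2 * l + 1ℚ)) * a))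
        + ((ι 2 * l + 1ℚ) * (ι 2 * l + 1ℚ) * a * v - ι 4 * (1ℚ + l)) * ((1ℚ + l) * (ι 2 + l))
      lemma = solve-∀ ringℚ

  V>0 : ∀ l → 0ℚ < V l
  V>0 l = ℚₚ.≰⇒> λ V≤0 → ℚₚ.<-irrefl refl (ℚₚ.<-≤-trans (*-pos {ι 4} (0<ι 3) (0<1+ι l))
    (≤-trans (≤-reflexive (sym (V-closed l))) (≤-trans
      (*-monoˡ {(ι 2 * ι l + 1ℚ) * (ι 2 * ι l + 1ℚ) * coeff l} (*-nonNeg (*-nonNeg (<⇒≤ (0<2ι+1 l)) (<⇒≤ (0<2ι+1 l))) (<⇒≤ (coeff>0 l))) V≤0)
      (≤-reflexive (ℚₚ.*-zeroʳ ((ι 2 * ι l + 1ℚ) * (ι 2 * ι l + 1ℚ) * coeff l))))))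

  -- By monotonicity it suffices to take n = l, where `V-closed` reduces the claim to 4 l (l + 1) ≤
  -- (2l + 1)². With the lower bound that follows, `V l` can stand for π in every estimate on terms
  -- up to l.
  ι*coeff*V≤1 : ∀ {n l} → n ℕ.≤ l → ι n * coeff n * V l ≤ 1ℚ
  ι*coeff*V≤1 {n} {l} n≤l = ≤-trans
    (ℚₚ.*-monoʳ-≤-nonNeg (V l) {{nonNegative (<⇒≤ (V>0 l))}} (monotone (λ n → ι n * coeff n) ι*coeff-mono n≤l))
    (cancel-≤ (*-pos (0<2ι+1 l) (0<2ι+1 l)) (≤-by 1ℚ 0≤1 (modulo (V-closed l) (lemma (ι l) (coeff l) (V l)))))
    where
      lemma : ∀ l a v → (ι 2 * l + 1ℚ) * (ι 2 * l + 1ℚ) * (l * a * v) + 1ℚ ≡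
        (ι 2 * l + 1ℚ) * (ι 2 * l + 1ℚ) * 1ℚ + ((ι 2 * l + 1ℚ) * (ι 2 * l + 1ℚ) * a * v - ι 4 * (1ℚ + l)) * l
      lemma = solve-∀ ringℚ

  2≤[2ι+1]*coeff*V : ∀ {n l} → n ℕ.≤ l → ι 2 ≤ (ι 2 * ι n + 1ℚ) * coeff n * V l
  2≤[2ι+1]*coeff*V {n} {l} n≤l = ≤-trans
    (cancel-≤ (0<2ι+1 l) (≤-by (ι 2) (0≤ι 2) (sym (modulo (V-closed l) (lemma (ι l) (coeff l) (V l))))))
    (ℚₚ.*-monoʳ-≤-nonNeg (V l) {{nonNegative (<⇒≤ (V>0 l))}}
      (subst₂ _≤_ (neg-involutive _) (neg-involutive _) (ℚₚ.neg-antimono-≤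
        (monotone (λ n → - ((ι 2 * ι n + 1ℚ) * coeff n)) (λ n → ℚₚ.neg-antimono-≤ ([2ι+1]*coeff-anti n)) n≤l))))
    where
      neg-involutive : ∀ x → - - x ≡ x
      neg-involutive = solve-∀ ringℚ
      lemma : ∀ l a v → (ι 2 * l + 1ℚ) * ((ι 2 * l + 1ℚ) * a * v) ≡
        ((ι 2 * l + 1ℚ) * ι 2 + ι 2) + ((ι 2 * l + 1ℚ) * (ι 2 * l + 1ℚ) * a * v - ι 4 * (1ℚ + l)) * 1ℚ
      lemma = solve-∀ ringℚ

  V≤4 : ∀ l → V l ≤ ι 4
  V≤4 zero = ≤-refl
  V≤4 (suc l) = cancel-≤ {¼} (ℚₚ.positive⁻¹ ¼) (ι*coeff*V≤1 {1} {suc l} (ℕ.s≤s ℕ.z≤n))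

  2≤V : ∀ l → ι 2 ≤ V l
  2≤V l = ≤-trans (2≤[2ι+1]*coeff*V {0} {l} ℕ.z≤n) (≤-reflexive (ℚₚ.*-identityˡ (V l)))

  module _ (l : ℕ) where

    private
      w : ℕ → ℚ
      w = weight l

    weight≥0 : ∀ {j} → j ℕ.≤ suc l → 0ℚ ≤ w j
    weight≥0 {zero} _ = 0≤1
    weight≥0 {suc j} (ℕ.s≤s j≤l) = *-nonNeg (*-nonNeg (weight≥0 (ℕₚ.m≤n⇒m≤1+n j≤l)) (difference≥0 (ι-mono j≤l))) (<⇒≤ (inv-pos (0<2+ι+ι l j)))

    weight-drop : ∀ j → (ι 2 + ι l + ι j) * (w j - w (suc j)) ≡ w j * (ι 2 * (1ℚ + ι j))
    weight-drop j = modulo (weight-rec l j) (lemma (ι l) (ι j) (w j) (w (suc j)))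
      where
        lemma : ∀ l j w w′ → (ι 2 + l + j) * (w - w′) ≡ w * (ι 2 * (1ℚ + j)) + ((ι 2 + l + j) * w′ - w * (l - j)) * - 1ℚ
        lemma = solve-∀ ringℚ

    weight-anti : ∀ {j} → j ℕ.≤ l → 0ℚ ≤ w j - w (suc j)
    weight-anti {j} j≤l = cancel-≤ (0<2+ι+ι l j) (subst₂ _≤_ (sym (ℚₚ.*-zeroʳ (ι 2 + ι l + ι j))) (sym (weight-drop j))
      (*-nonNeg (weight≥0 (ℕₚ.m≤n⇒m≤1+n j≤l)) (*-nonNeg (0≤ι 2) (<⇒≤ (0<1+ι j)))))

    1-weight≥0 : ∀ {j} → j ℕ.≤ suc l → 0ℚ ≤ 1ℚ - w j
    1-weight≥0 {zero} _ = ≤-refl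
    1-weight≥0 {suc j} (ℕ.s≤s j≤l) = subst (0ℚ ≤_) (lemma (w j) (w (suc j))) (+-nonNeg (1-weight≥0 (ℕₚ.m≤n⇒m≤1+n j≤l)) (weight-anti j≤l))
      where
        lemma : ∀ a b → 1ℚ - a + (a - b) ≡ 1ℚ - b
        lemma = solve-∀ ringℚ

    -- Each drop from i to i + 1 is at most 2(i + 1)/(l + 2), and these add up to j(j + 1)/(l + 2).
    -- So for fixed j the weight tends to 1 as l grows.
    1-weight≤ : ∀ {j} → j ℕ.≤ suc l → (ι 2 + ι l) * (1ℚ - w j) ≤ ι j * (1ℚ + ι j)
    1-weight≤ {zero} _ = ≤-reflexive (ℚₚ.*-zeroʳ (ι 2 + ι l))
    1-weight≤ {suc j} (ℕ.s≤s j≤l) = subst₂ _≤_ (lemma₁ (ι l) (w j) (w (suc j))) (trans (lemma₂ (ι j)) (cong (λ ν → ν * (1ℚ + ν)) (sym (ι-suc j))))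
      (ℚₚ.+-mono-≤ (1-weight≤ (ℕₚ.m≤n⇒m≤1+n j≤l)) drop)
      where
        lemma₁ : ∀ l a b → (ι 2 + l) * (1ℚ - a) + (ι 2 + l) * (a - b) ≡ (ι 2 + l) * (1ℚ - b)
        lemma₁ = solve-∀ ringℚ
        lemma₂ : ∀ j → j * (1ℚ + j) + ι 2 * (1ℚ + j) ≡ (1ℚ + j) * (1ℚ + (1ℚ + j))
        lemma₂ = solve-∀ ringℚ
        drop : (ι 2 + ι l) * (w j - w (suc j)) ≤ ι 2 * (1ℚ + ι j)
        drop = ≤-by (ι j * (w j - w (suc j)) + (1ℚ - w j) * (ι 2 * (1ℚ + ι j)))
          (+-nonNeg (*-nonNeg (0≤ι j) (weight-anti j≤l)) (*-nonNeg (1-weight≥0 (ℕₚ.m≤n⇒m≤1+n j≤l)) (*-nonNeg (0≤ι 2) (<⇒≤ (0<1+ι j)))))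
          (modulo (weight-drop j) (lemma (ι l) (ι j) (w j) (w (suc j))))
          where
            lemma : ∀ l j a b → (ι 2 + l) * (a - b) + (j * (a - b) + (1ℚ - a) * (ι 2 * (1ℚ + j))) ≡ ι 2 * (1ℚ + j) + ((ι 2 + l + j) * (a - b) - a * (ι 2 * (1ℚ + j))) * 1ℚ
            lemma = solve-∀ ringℚ

    -- Summation by parts: V l is an average of the partial sums of the Leibniz series.
    weighted-sum : ∀ c n → sum (weighted l) n ≡ sum (λ j → (w j - w (suc j)) * (leibniz (suc j) - c)) n + w n * (leibniz n - c) + c
    weighted-sum c zero = lemma c
      where
        lemma : ∀ c → 0ℚ ≡ 0ℚ + 1ℚ * (0ℚ - c) + c
        lemma = solve-∀ ringℚ
    weighted-sum c (suc n) = trans (cong (_+ weighted l n) (weighted-sum c n))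
      (lemma c (sum (λ j → (w j - w (suc j)) * (leibniz (suc j) - c)) n) (w n) (w (suc n)) (leibniz n) (sign n) (leibnizTerm n))
      where
        lemma : ∀ c S w w′ x s t → S + w * (x - c) + c + s * t * w ≡ S + (w - w′) * (x + s * t - c) + w′ * (x + s * t - c) + c
        lemma = solve-∀ ringℚ

  ∣leibniz∣≤4 : ∀ n → ∣ leibniz n ∣ ≤ ι 4
  ∣leibniz∣≤4 n = subst (λ t → ∣ t ∣ ≤ ι 4) (sym eq) (≤-trans (∣≥0∣ (proj₁ (leibnizTail-bounds 0 n))) (proj₂ (leibnizTail-bounds 0 n)))
    where
      eq : leibniz n ≡ leibnizTail 0 n
      eq = trans (cong leibniz (sym (ℕₚ.+-identityʳ n))) (trans (leibniz-split 0 n) (lemma (leibnizTail 0 n)))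
        where
          lemma : ∀ x → 0ℚ + 1ℚ * x ≡ x
          lemma = solve-∀ ringℚ

  -- An average of a Cauchy sequence: the partial sums before `j₀` carry total weight 1 - `w j₀`,
  -- which is O(1/l), and all later ones are within ½ε of `leibniz m`.
  V-limit : ∀ ε → 0ℚ < ε → ∃[ N ] ∀ l m → N ℕ.≤ l → N ℕ.≤ m → ∣ V l - leibniz m ∣ ≤ ε
  V-limit ε 0<ε = j₀ ℕ.+ l₀ , λ l m N≤l N≤m → bound l m (ℕₚ.m+n≤o⇒m≤o j₀ N≤l) (ℕₚ.m+n≤o⇒n≤o j₀ N≤l) (ℕₚ.m+n≤o⇒m≤o j₀ N≤m)
    where
      j₀ l₀ : ℕ
      j₀ = proj₁ (cauchy-leibniz (½ * ε) (½-pos 0<ε))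
      close : ∀ m n → j₀ ℕ.≤ m → j₀ ℕ.≤ n → ∣ leibniz m - leibniz n ∣ < ½ * ε
      close = proj₂ (cauchy-leibniz (½ * ε) (½-pos 0<ε))
      early : ℚ
      -- The 8 is 4 + 4, the crude bound for the difference of two partial sums of the Leibniz
      -- series; the rest is from `1-weight≤`.
      early = ι 8 * (ι j₀ * (1ℚ + ι j₀))
      l₀ = proj₁ (archimedean (early * inv (½ * ε)))
      bound : ∀ l m → j₀ ℕ.≤ l → l₀ ℕ.≤ l → j₀ ℕ.≤ m → ∣ V l - leibniz m ∣ ≤ ε
      bound l m j₀≤l l₀≤l j₀≤m = subst (λ t → ∣ t ∣ ≤ ε) (sym V-c) (≤-trans (late (suc l ℕ.∸ j₀) (ℕₚ.m∸n+n≡m j₀≤1+l))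
          (≤-trans (ℚₚ.+-mono-≤ early-small late-small) (≤-reflexive (½+½ ε))))
        where
          w : ℕ → ℚ
          w = weight l
          c : ℚ
          c = leibniz m
          S : ℕ → ℚ
          S = sum (λ j → (w j - w (suc j)) * (leibniz (suc j) - c))
          j₀≤1+l : j₀ ℕ.≤ suc l
          j₀≤1+l = ℕₚ.m≤n⇒m≤1+n j₀≤l
          V-c : V l - c ≡ S (suc l)
          V-c = trans (cong (_- c) (weighted-sum l c (suc l))) (modulo (weight-end l) (lemma (S (suc l)) (w (suc l)) (leibniz (suc l)) c))
            where
              lemma : ∀ S w x c → S + w * (x - c) + c - c ≡ S + (w - 0ℚ) * (x - c)
              lemma = solve-∀ ringℚ
          initial : ∀ n → n ℕ.≤ suc l → ∣ S n ∣ ≤ ι 8 * (1ℚ - w n)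
          initial zero _ = ≤-refl
          initial (suc n) (ℕ.s≤s n≤l) = subst (∣ S (suc n) ∣ ≤_) (lemma (w n) (w (suc n)))
            (∣+∣≤ (initial n (ℕₚ.m≤n⇒m≤1+n n≤l)) (∣*∣≤ (∣≥0∣ (weight-anti l n≤l)) (∣+∣≤ (∣leibniz∣≤4 (suc n)) (∣-∣≤ (∣leibniz∣≤4 m)))))
            where
              lemma : ∀ a b → ι 8 * (1ℚ - a) + (a - b) * (ι 4 + ι 4) ≡ ι 8 * (1ℚ - b)
              lemma = solve-∀ ringℚ
          further : ∀ d → d ℕ.+ j₀ ℕ.≤ suc l → ∣ S (d ℕ.+ j₀) ∣ ≤ ι 8 * (1ℚ - w j₀) + ½ * ε * (w j₀ - w (d ℕ.+ j₀))
          further zero j₀≤ = ≤-trans (initial j₀ j₀≤) (≤-reflexive (lemma (ι 8 * (1ℚ - w j₀)) (½ * ε) (w j₀)))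
            where
              lemma : ∀ a e w → a ≡ a + e * (w - w)
              lemma = solve-∀ ringℚ
          further (suc d) (ℕ.s≤s d+j₀≤l) = subst (∣ S (suc d ℕ.+ j₀) ∣ ≤_) (lemma (ι 8 * (1ℚ - w j₀)) (½ * ε) (w j₀) (w (d ℕ.+ j₀)) (w (suc d ℕ.+ j₀)))
            (∣+∣≤ (further d (ℕₚ.m≤n⇒m≤1+n d+j₀≤l)) (∣*∣≤ (∣≥0∣ (weight-anti l d+j₀≤l)) (<⇒≤ (close (suc d ℕ.+ j₀) m (ℕₚ.m≤n+m j₀ (suc d)) j₀≤m))))
            where
              lemma : ∀ a e w x y → a + e * (w - x) + (x - y) * e ≡ a + e * (w - y)
              lemma = solve-∀ ringℚ
          late : ∀ d → d ℕ.+ j₀ ≡ suc l → ∣ S (suc l) ∣ ≤ ι 8 * (1ℚ - w j₀) + ½ * ε * (w j₀ - w (suc l))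
          late d e = subst (λ n → ∣ S n ∣ ≤ ι 8 * (1ℚ - w j₀) + ½ * ε * (w j₀ - w n)) e (further d (ℕₚ.≤-reflexive e))
          late-small : ½ * ε * (w j₀ - w (suc l)) ≤ ½ * ε
          late-small = ≤-by (½ * ε * (1ℚ - w j₀)) (*-nonNeg (<⇒≤ (½-pos 0<ε)) (1-weight≥0 l j₀≤1+l))
            (modulo (weight-end l) (lemma (½ * ε) (w j₀) (w (suc l))))
            where
              lemma : ∀ e w x → e * (w - x) + e * (1ℚ - w) ≡ e + (x - 0ℚ) * - e
              lemma = solve-∀ ringℚ
          early-small : ι 8 * (1ℚ - w j₀) ≤ ½ * ε
          early-small = cancel-≤ (+-pos {ι 2} (0<ι 1) (0≤ι l)) (≤-trans
            (≤-reflexive (lemma₁ (ι 2 + ι l) (1ℚ - w j₀))) (≤-trans (*-monoˡ (0≤ι 8) (1-weight≤ l j₀≤1+l))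
            (≤-trans (≤-reflexive (sym early≡)) (≤-trans
              (ℚₚ.*-monoʳ-≤-nonNeg (½ * ε) {{nonNegative (<⇒≤ (½-pos 0<ε))}} (≤-trans (proj₂ (archimedean (early * inv (½ * ε)))) (ι-mono l₀≤l)))
              (≤-by (ι 2 * (½ * ε)) (*-nonNeg (0≤ι 2) (<⇒≤ (½-pos 0<ε))) (lemma₂ (ι l) (½ * ε)))))))
            where
              lemma₁ : ∀ a x → a * (ι 8 * x) ≡ ι 8 * (a * x)
              lemma₁ = solve-∀ ringℚ
              lemma₂ : ∀ l e → l * e + ι 2 * e ≡ (ι 2 + l) * e
              lemma₂ = solve-∀ ringℚ
              early≡ : early * inv (½ * ε) * (½ * ε) ≡ early
              early≡ = modulo (*-inv⁺ (½-pos 0<ε)) (lemma₃ early (½ * ε) (inv (½ * ε)))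
                where
                  lemma₃ : ∀ a e i → a * i * e ≡ a + (e * i - 1ℚ) * a
                  lemma₃ = solve-∀ ringℚ

  -- Derivatives in k

  -- The derivative of leg along a curve (τ , s) with velocity (τ′ , s′).
  mutual
    leg′ : ℚ → ℚ → ℚ → ℚ → ℕ → ℚ
    leg′ τ s τ′ s′ zero = 0ℚ
    leg′ τ s τ′ s′ (suc n) = ((ι 2 * ι n + 1ℚ) * (τ′ * leg τ s n + τ * leg′ τ s τ′ s′ n)
      - ι n * (s′ * leg⁻ τ s n + s * leg⁻′ τ s τ′ s′ n)) * inv (ι (suc n))

    leg⁻′ : ℚ → ℚ → ℚ → ℚ → ℕ → ℚ
    leg⁻′ τ s τ′ s′ zero = 0ℚ
    leg⁻′ τ s τ′ s′ (suc n) = leg′ τ s τ′ s′ n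

  ζ′ τ′ : ℚ → ℚ
  ζ′ k = ¼ * (ι 8 * k + 1ℚ - inv k * inv k)
  τ′ k = ¼ * (1ℚ + ι 6 * k * k + inv k * inv k)

  p′ p⁻′ : ℚ → ℕ → ℚ
  p′ k = leg′ (τ k) (ζ k * ζ k) (τ′ k) (ζ′ k * ζ k + ζ k * ζ′ k)
  p⁻′ k = leg⁻′ (τ k) (ζ k * ζ k) (τ′ k) (ζ′ k * ζ k + ζ k * ζ′ k)

  term′ : ℚ → ℕ → ℚ
  term′ k n = coeff n * ((- ι 4 * k * ι n - ι 2 * k) * p k n + (ι 2 * (ι 2 - k * k) * ι n + (1ℚ - k * k)) * p′ k n
    - (ι 4 * (ι n * (ζ k * p⁻ k n)) + ι 2 * (ι 2 * k - 1ℚ) * (ι n * (ζ′ k * p⁻ k n + ζ k * p⁻′ k n))))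

  M′ : ℚ → ℕ → ℚ
  M′ k = sum (term′ k)

  -- The value of 2k M′ - M: a single, exponentially small term.
  residue : ℚ → ℕ → ℚ
  residue k n = - ι 4 * (ι 3 * k * k + 1ℚ) * (coeff n * (ι n * ι n * p⁻ k n))

  module _ (k : ℚ) (k≢0 : k * inv k ≡ 1ℚ) where

    private
      e : ℚ
      e = k * (1ℚ - k * k)

    -- With `ζ′-relation` this is a linear system symmetric in τ and ζ. It implies e (τ/ζ)′ = (1 +
    -- 2k)(1 - (τ/ζ)²), the source of `p′-formula`.
    τ′-relation : e * τ′ k + ι 3 * k * k * τ k ≡ (1ℚ + ι 2 * k) * ζ k
    τ′-relation = modulo k≢0 (lemma k (inv k))
      where
        lemma : ∀ k w → k * (1ℚ - k * k) * (¼ * (1ℚ + ι 6 * k * k + w * w)) + ι 3 * k * k * (¼ * (ι 2 + k + ι 2 * k * k * k - w)) ≡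
          (1ℚ + ι 2 * k) * (¼ * (ι 4 * k * k + k - ι 2 + w)) + (k * w - 1ℚ) * (¼ * (w - k * k * w - ι 4 * k - ι 2))
        lemma = solve-∀ ringℚ

    ζ′-relation : e * ζ′ k + ι 3 * k * k * ζ k ≡ (1ℚ + ι 2 * k) * τ k
    ζ′-relation = modulo k≢0 (lemma k (inv k))
      where
        lemma : ∀ k w → k * (1ℚ - k * k) * (¼ * (ι 8 * k + 1ℚ - w * w)) + ι 3 * k * k * (¼ * (ι 4 * k * k + k - ι 2 + w)) ≡
          (1ℚ + ι 2 * k) * (¼ * (ι 2 + k + ι 2 * k * k * k - w)) + (k * w - 1ℚ) * (¼ * (k * k * w - w + ι 4 * k + ι 2))
        lemma = solve-∀ ringℚ

    -- Matches the coefficient of n² `p⁻ k n` in `term′-telescopes` with that of the residue.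
    ζτ-relation : (ι 4 * (ι 2 - k * k) * (1ℚ + ι 2 * k) + ι 12 * k * k * (ι 2 * k - 1ℚ)) * ζ k - ι 8 * (ι 2 * k - 1ℚ) * (1ℚ + ι 2 * k) * τ k
      ≡ ι 4 * (ι 3 * k * k + 1ℚ) * (1ℚ - k * k)
    ζτ-relation = modulo k≢0 (lemma k (inv k))
      where
        lemma : ∀ k w → (ι 4 * (ι 2 - k * k) * (1ℚ + ι 2 * k) + ι 12 * k * k * (ι 2 * k - 1ℚ)) * (¼ * (ι 4 * k * k + k - ι 2 + w))
            - ι 8 * (ι 2 * k - 1ℚ) * (1ℚ + ι 2 * k) * (¼ * (ι 2 + k + ι 2 * k * k * k - w)) ≡
          ι 4 * (ι 3 * k * k + 1ℚ) * (1ℚ - k * k) + (k * w - 1ℚ) * (ι 4 + ι 4 * k + ι 4 * k * k)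
        lemma = solve-∀ ringℚ

    mutual
      -- Legendre's rule (1 - y²) Pₙ′ = n (Pₙ₋₁ - y Pₙ) at y = τ/ζ: its factor 1 - y² cancels
      -- against e y′ = (1 + 2k)(1 - y²), so only the factor `e` remains on the left. The proof is
      -- an induction along the differentiated recurrence.
      p′-formula : ∀ n → e * p′ k n ≡ ι n * (- ι 3 * k * k * p k n + (1ℚ + ι 2 * k) * (ζ k * p⁻ k n))
      p′-formula zero = lemma e k (ζ k)
        where
          lemma : ∀ e k z → e * 0ℚ ≡ 0ℚ * (- ι 3 * k * k * 1ℚ + (1ℚ + ι 2 * k) * (z * 0ℚ))
          lemma = solve-∀ ringℚ
      p′-formula (suc n) = cancel (0<ι n) (subst
        (λ ν → ν * (e * p′ k (suc n)) ≡ ν * (ν * (- ι 3 * k * k * p k (suc n) + (1ℚ + ι 2 * k) * (ζ k * p k n)))) (sym (ι-suc n))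
        (trans (lemma₁ (ι n) e (p′ k (suc n))) (trans (cong (e *_) (*-inv-cancel n _ _ refl))
          (trans (modulo (p′-formula n) (modulo (p⁻′-formula n) (modulo (leg⁻-rec (τ k) (ζ k * ζ k) n) (modulo τ′-relation (modulo ζ′-relation
              (lemma₂ k (ι n) e (p k n) (p⁻ k n) (p⁻ k (ℕ.pred n)) (p′ k n) (p⁻′ k n) (ζ k) (τ k) (ζ′ k) (τ′ k)))))))
            (trans (cong (λ t → - ι 3 * k * k * (1ℚ + ι n) * t + (1ℚ + ι n) * (1ℚ + ι n) * (1ℚ + ι 2 * k) * (ζ k * p k n)) (sym (leg-rec (τ k) (ζ k * ζ k) n)))
              (lemma₃ k (ι n) (p k (suc n)) (ζ k * p k n)))))))
        where
          lemma₁ : ∀ n e x → (1ℚ + n) * (e * x) ≡ e * ((1ℚ + n) * x)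
          lemma₁ = solve-∀ ringℚ
          lemma₂ : ∀ k n e p q q₂ d d⁻ z t z′ t′ →
            e * ((ι 2 * n + 1ℚ) * (t′ * p + t * d) - n * ((z′ * z + z * z′) * q + z * z * d⁻)) ≡
            (((- ι 3 * k * k * (1ℚ + n) * ((ι 2 * n + 1ℚ) * (t * p) - n * (z * z * q)) + (1ℚ + n) * (1ℚ + n) * (1ℚ + ι 2 * k) * (z * p)
            + (e * d - n * (- ι 3 * k * k * p + (1ℚ + ι 2 * k) * (z * q))) * ((ι 2 * n + 1ℚ) * t))
            + (e * d⁻ - (n - 1ℚ) * (- ι 3 * k * k * q + (1ℚ + ι 2 * k) * (z * q₂))) * (- n * (z * z)))
            + (n * p - ((ι 2 * n - 1ℚ) * (t * q) - (n - 1ℚ) * (z * z * q₂))) * (- n * (1ℚ + ι 2 * k) * z))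
            + (e * t′ + ι 3 * k * k * t - (1ℚ + ι 2 * k) * z) * ((ι 2 * n + 1ℚ) * p)
            + (e * z′ + ι 3 * k * k * z - (1ℚ + ι 2 * k) * t) * (- ι 2 * n * z * q)
          lemma₂ = solve-∀ ringℚ
          lemma₃ : ∀ k n p′ x → - ι 3 * k * k * (1ℚ + n) * ((1ℚ + n) * p′) + (1ℚ + n) * (1ℚ + n) * (1ℚ + ι 2 * k) * x ≡
            (1ℚ + n) * ((1ℚ + n) * (- ι 3 * k * k * p′ + (1ℚ + ι 2 * k) * x))
          lemma₃ = solve-∀ ringℚ

      p⁻′-formula : ∀ n → e * p⁻′ k n ≡ (ι n - 1ℚ) * (- ι 3 * k * k * p⁻ k n + (1ℚ + ι 2 * k) * (ζ k * p⁻ k (ℕ.pred n)))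
      p⁻′-formula zero = lemma e k (ζ k)
        where
          lemma : ∀ e k z → e * 0ℚ ≡ (0ℚ - 1ℚ) * (- ι 3 * k * k * 0ℚ + (1ℚ + ι 2 * k) * (z * 0ℚ))
          lemma = solve-∀ ringℚ
      p⁻′-formula (suc n) = trans (p′-formula n) (cong (_* (- ι 3 * k * k * p k n + (1ℚ + ι 2 * k) * (ζ k * p⁻ k n))) (trans (lemma (ι n)) (cong (_- 1ℚ) (sym (ι-suc n)))))
        where
          lemma : ∀ n → n ≡ 1ℚ + n - 1ℚ
          lemma = solve-∀ ringℚ

    residue-suc : ∀ n → residue k (suc n) ≡ - ι 4 * (ι 3 * k * k + 1ℚ) * (¼ * ((ι 2 * ι n + 1ℚ) * (ι 2 * ι n + 1ℚ)) * coeff n * p k n)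
    residue-suc n = cong (- ι 4 * (ι 3 * k * k + 1ℚ) *_) (trans (cong (λ ν → coeff (suc n) * (ν * ν * p k n)) (ι-suc n))
      (trans (lemma (coeff (suc n)) (ι n) (p k n)) (cong (_* p k n) (coeff-rec n))))
      where
        lemma : ∀ a n p → a * ((1ℚ + n) * (1ℚ + n) * p) ≡ (1ℚ + n) * ((1ℚ + n) * a) * p
        lemma = solve-∀ ringℚ

    module _ (k<1 : 0ℚ < 1ℚ - k * k) where

      -- The derivative formulas are available only after multiplication by k(1 - k²); hence the
      -- cancelled factor 1 - k². What remains is polynomial modulo those formulas and the relations
      -- for ζ and τ.
      term′-telescopes : ∀ n → ι 2 * k * term′ k n - term k n ≡ residue k (suc n) - residue k n
      term′-telescopes n = cancel k<1 (trans (lemma₁ k (1ℚ - k * k) (term′ k n) (term k n))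
        (trans (modulo (p′-formula n) (modulo (p⁻′-formula n) (modulo (leg⁻-rec (τ k) (ζ k * ζ k) n) (modulo ζ′-relation (modulo ζτ-relation
            (lemma₂ k (ι n) (coeff n) (p k n) (p⁻ k n) (p⁻ k (ℕ.pred n)) (p′ k n) (p⁻′ k n) (ζ k) (τ k) (ζ′ k)))))))
          (cong (λ t → (1ℚ - k * k) * (t - residue k n)) (sym (residue-suc n)))))
        where
          lemma₁ : ∀ k c x y → c * (ι 2 * k * x - y) ≡ ι 2 * (k * c) * x - c * y
          lemma₁ = solve-∀ ringℚ
          lemma₂ : ∀ k n a p q q₂ d d⁻ z t z′ →
            let e = k * (1ℚ - k * k)
            in ι 2 * e * (a * ((- ι 4 * k * n - ι 2 * k) * p + (ι 2 * (ι 2 - k * k) * n + (1ℚ - k * k)) * d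
                - (ι 4 * (n * (z * q)) + ι 2 * (ι 2 * k - 1ℚ) * (n * (z′ * q + z * d⁻)))))
              - (1ℚ - k * k) * (a * ((ι 2 * (ι 2 - k * k) * n + (1ℚ - k * k)) * p - ι 2 * (ι 2 * k - 1ℚ) * (n * (z * q)))) ≡
            (((((1ℚ - k * k) * (- ι 4 * (ι 3 * k * k + 1ℚ) * (¼ * ((ι 2 * n + 1ℚ) * (ι 2 * n + 1ℚ)) * a * p) - - ι 4 * (ι 3 * k * k + 1ℚ) * (a * (n * n * q)))
            + (e * d - n * (- ι 3 * k * k * p + (1ℚ + ι 2 * k) * (z * q))) * (a * (ι 4 * (ι 2 - k * k) * n + ι 2 * (1ℚ - k * k))))
            + (e * d⁻ - (n - 1ℚ) * (- ι 3 * k * k * q + (1ℚ + ι 2 * k) * (z * q₂))) * (- ι 4 * (ι 2 * k - 1ℚ) * a * n * z))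
            + (n * p - ((ι 2 * n - 1ℚ) * (t * q) - (n - 1ℚ) * (z * z * q₂))) * (- ι 4 * (ι 2 * k - 1ℚ) * a * n * (1ℚ + ι 2 * k)))
            + (e * z′ + ι 3 * k * k * z - (1ℚ + ι 2 * k) * t) * (- ι 4 * (ι 2 * k - 1ℚ) * a * n * q))
            + ((ι 4 * (ι 2 - k * k) * (1ℚ + ι 2 * k) + ι 12 * k * k * (ι 2 * k - 1ℚ)) * z - ι 8 * (ι 2 * k - 1ℚ) * (1ℚ + ι 2 * k) * t
              - ι 4 * (ι 3 * k * k + 1ℚ) * (1ℚ - k * k)) * (a * n * n * q)
          lemma₂ = solve-∀ ringℚ

      M′-formula : ∀ n → ι 2 * k * M′ k n - M k n ≡ residue k n
      M′-formula zero = lemma k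
        where
          lemma : ∀ k → ι 2 * k * 0ℚ - 0ℚ ≡ - ι 4 * (ι 3 * k * k + 1ℚ) * (1ℚ * (0ℚ * 0ℚ * 0ℚ))
          lemma = solve-∀ ringℚ
      M′-formula (suc n) = trans (lemma₁ k (M′ k n) (M k n) (term′ k n) (term k n))
        (trans (cong₂ _+_ (M′-formula n) (term′-telescopes n)) (lemma₂ (residue k n) (residue k (suc n))))
        where
          lemma₁ : ∀ k m′ m t′ t → ι 2 * k * (m′ + t′) - (m + t) ≡ (ι 2 * k * m′ - m) + (ι 2 * k * t′ - t)
          lemma₁ = solve-∀ ringℚ
          lemma₂ : ∀ a b → a + (b - a) ≡ b
          lemma₂ = solve-∀ ringℚ

  -- Differentiation on rational intervals

  _∈[_,_] : ℚ → ℚ → ℚ → Set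
  x ∈[ a , b ] = a ≤ x × x ≤ b

  -- f is differentiable on [a , b] with derivative f′, the remainder being
  -- quadratic; one constant serves for all four bounds.
  record Diff (a b : ℚ) (f f′ : ℚ → ℚ) : Set where
    field
      bound     : ℚ
      0≤bound   : 0ℚ ≤ bound
      values    : ∀ x → x ∈[ a , b ] → ∣ f x ∣ ≤ bound
      slopes    : ∀ x → x ∈[ a , b ] → ∣ f′ x ∣ ≤ bound
      lipschitz : ∀ x y → x ∈[ a , b ] → y ∈[ a , b ] → ∣ f y - f x ∣ ≤ bound * ∣ y - x ∣
      remainder : ∀ x y → x ∈[ a , b ] → y ∈[ a , b ] →
        ∣ f y - f x - f′ x * (y - x) ∣ ≤ bound * (∣ y - x ∣ * ∣ y - x ∣)

  open Diff public

  grow : ∀ {B B′ t x} → 0ℚ ≤ t → B ≤ B′ → x ≤ B * t → x ≤ B′ * t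
  grow {B} {B′} {t} 0≤t B≤B′ h = ≤-trans h (ℚₚ.*-monoʳ-≤-nonNeg t {{nonNegative 0≤t}} B≤B′)

  0≤∣∣² : ∀ h → 0ℚ ≤ ∣ h ∣ * ∣ h ∣
  0≤∣∣² h = square-nonNeg ∣ h ∣

  module _ {a b : ℚ} where

    diff-cong : ∀ {f f′ g g′} → (∀ x → f x ≡ g x) → (∀ x → x ∈[ a , b ] → f′ x ≡ g′ x) → Diff a b f f′ → Diff a b g g′
    diff-cong {f} {f′} {g} {g′} e e′ d = record
      { bound = bound d
      ; 0≤bound = 0≤bound d
      ; values = λ x p → subst (λ t → ∣ t ∣ ≤ bound d) (e x) (values d x p)
      ; slopes = λ x p → subst (λ t → ∣ t ∣ ≤ bound d) (e′ x p) (slopes d x p)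
      ; lipschitz = λ x y p q → subst₂ (λ s t → ∣ s - t ∣ ≤ bound d * ∣ y - x ∣) (e y) (e x) (lipschitz d x y p q)
      ; remainder = λ x y p q → subst (λ t → ∣ t ∣ ≤ bound d * (∣ y - x ∣ * ∣ y - x ∣))
          (trans (cong₂ (λ s t → s - t - f′ x * (y - x)) (e y) (e x)) (cong (λ t → g y - g x - t * (y - x)) (e′ x p)))
          (remainder d x y p q)
      }

    diff-const : ∀ c → Diff a b (λ _ → c) (λ _ → 0ℚ)
    diff-const c = record
      { bound = ∣ c ∣
      ; 0≤bound = ℚₚ.0≤∣p∣ c
      ; values = λ _ _ → ≤-refl
      ; slopes = λ _ _ → ℚₚ.0≤∣p∣ c
      ; lipschitz = λ x y _ _ → subst (λ t → ∣ t ∣ ≤ ∣ c ∣ * ∣ y - x ∣) (sym (ℚₚ.+-inverseʳ c)) (*-nonNeg (ℚₚ.0≤∣p∣ c) (ℚₚ.0≤∣p∣ (y - x)))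
      ; remainder = λ x y _ _ → subst (λ t → ∣ t ∣ ≤ ∣ c ∣ * (∣ y - x ∣ * ∣ y - x ∣)) (sym (lemma c (y - x)))
          (*-nonNeg (ℚₚ.0≤∣p∣ c) (0≤∣∣² (y - x)))
      }
      where
        lemma : ∀ c h → c - c - 0ℚ * h ≡ 0ℚ
        lemma = solve-∀ ringℚ

    diff-+ : ∀ {f f′ g g′} → Diff a b f f′ → Diff a b g g′ → Diff a b (λ x → f x + g x) (λ x → f′ x + g′ x)
    diff-+ {f} {f′} {g} {g′} d₁ d₂ = record
      { bound = B + B′
      ; 0≤bound = +-nonNeg (0≤bound d₁) (0≤bound d₂)
      ; values = λ x p → ∣+∣≤ (values d₁ x p) (values d₂ x p)
      ; slopes = λ x p → ∣+∣≤ (slopes d₁ x p) (slopes d₂ x p)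
      ; lipschitz = λ x y p q → subst₂ _≤_ (cong ∣_∣ (lemma₁ (f y) (f x) (g y) (g x))) (sym (ℚₚ.*-distribʳ-+ ∣ y - x ∣ B B′))
          (∣+∣≤ (lipschitz d₁ x y p q) (lipschitz d₂ x y p q))
      ; remainder = λ x y p q → subst₂ _≤_ (cong ∣_∣ (lemma₂ (f y) (f x) (f′ x) (g y) (g x) (g′ x) (y - x))) (sym (ℚₚ.*-distribʳ-+ (∣ y - x ∣ * ∣ y - x ∣) B B′))
          (∣+∣≤ (remainder d₁ x y p q) (remainder d₂ x y p q))
      }
      where
        B B′ : ℚ
        B = bound d₁
        B′ = bound d₂
        lemma₁ : ∀ fy fx gy gx → (fy - fx) + (gy - gx) ≡ fy + gy - (fx + gx)
        lemma₁ = solve-∀ ringℚ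
        lemma₂ : ∀ fy fx f′ gy gx g′ h → (fy - fx - f′ * h) + (gy - gx - g′ * h) ≡ fy + gy - (fx + gx) - (f′ + g′) * h
        lemma₂ = solve-∀ ringℚ

    diff-* : ∀ {f f′ g g′} → Diff a b f f′ → Diff a b g g′ → Diff a b (λ x → f x * g x) (λ x → f′ x * g x + f x * g′ x)
    diff-* {f} {f′} {g} {g′} d₁ d₂ = record
      { bound = K
      ; 0≤bound = *-nonNeg (0≤ι 3) 0≤BC
      ; values = λ x p → ≤-trans (∣*∣≤ (values d₁ x p) (values d₂ x p)) BC≤K
      ; slopes = λ x p → ≤-trans (∣+∣≤ (∣*∣≤ (slopes d₁ x p) (values d₂ x p)) (∣*∣≤ (values d₁ x p) (slopes d₂ x p))) 2BC≤K
      ; lipschitz = λ x y p q → grow (ℚₚ.0≤∣p∣ (y - x)) 2BC≤K (subst₂ _≤_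
          (cong ∣_∣ (lemma₁ (f y) (f x) (g y) (g x))) (lemma₂ B B′ ∣ y - x ∣)
          (∣+∣≤ (∣*∣≤ (values d₁ y q) (lipschitz d₂ x y p q)) (∣*∣≤ (values d₂ x p) (lipschitz d₁ x y p q))))
      ; remainder = λ x y p q → subst₂ _≤_
          (cong ∣_∣ (lemma₃ (f y) (f x) (f′ x) (g y) (g x) (g′ x) (y - x))) (lemma₄ B B′ ∣ y - x ∣)
          (∣+∣≤ (∣+∣≤ (∣*∣≤ (values d₁ y q) (remainder d₂ x y p q)) (∣*∣≤ (values d₂ x p) (remainder d₁ x y p q)))
            (∣*∣≤ (∣*∣≤ (slopes d₂ x p) (≤-refl {∣ y - x ∣})) (lipschitz d₁ x y p q)))
      }
      where
        B B′ K : ℚ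
        B = bound d₁
        B′ = bound d₂
        -- The remainder of a product splits into three pieces, each at most B B′ h²; values, slopes
        -- and differences need less.
        K = ι 3 * (B * B′)
        0≤BC : 0ℚ ≤ B * B′
        0≤BC = *-nonNeg (0≤bound d₁) (0≤bound d₂)
        BC≤K : B * B′ ≤ K
        BC≤K = ≤-by (ι 2 * (B * B′)) (*-nonNeg (0≤ι 2) 0≤BC) (lemma B B′)
          where
            lemma : ∀ B B′ → B * B′ + ι 2 * (B * B′) ≡ ι 3 * (B * B′)
            lemma = solve-∀ ringℚ
        2BC≤K : B * B′ + B * B′ ≤ K
        2BC≤K = ≤-by (B * B′) 0≤BC (lemma B B′)
          where
            lemma : ∀ B B′ → B * B′ + B * B′ + B * B′ ≡ ι 3 * (B * B′)
            lemma = solve-∀ ringℚ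
        lemma₁ : ∀ fy fx gy gx → fy * (gy - gx) + gx * (fy - fx) ≡ fy * gy - fx * gx
        lemma₁ = solve-∀ ringℚ
        lemma₂ : ∀ B B′ h → B * (B′ * h) + B′ * (B * h) ≡ (B * B′ + B * B′) * h
        lemma₂ = solve-∀ ringℚ
        lemma₃ : ∀ fy fx f′ gy gx g′ h → fy * (gy - gx - g′ * h) + gx * (fy - fx - f′ * h) + g′ * h * (fy - fx) ≡
          fy * gy - fx * gx - (f′ * gx + fx * g′) * h
        lemma₃ = solve-∀ ringℚ
        lemma₄ : ∀ B B′ h → B * (B′ * (h * h)) + B′ * (B * (h * h)) + B′ * h * (B * h) ≡ ι 3 * (B * B′) * (h * h)
        lemma₄ = solve-∀ ringℚ

    diff-scale : ∀ {f f′} c → Diff a b f f′ → Diff a b (λ x → c * f x) (λ x → c * f′ x)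
    diff-scale {f} {f′} c d = diff-cong (λ _ → refl) (λ x _ → lemma c (f x) (f′ x)) (diff-* (diff-const c) d)
      where
        lemma : ∀ c f f′ → 0ℚ * f + c * f′ ≡ c * f′
        lemma = solve-∀ ringℚ

    diff-scaleʳ : ∀ {f f′} c → Diff a b f f′ → Diff a b (λ x → f x * c) (λ x → f′ x * c)
    diff-scaleʳ {f} {f′} c d = diff-cong (λ x → ℚₚ.*-comm c (f x)) (λ x _ → ℚₚ.*-comm c (f′ x)) (diff-scale c d)

    diff-neg : ∀ {f f′} → Diff a b f f′ → Diff a b (λ x → - f x) (λ x → - f′ x)
    diff-neg {f} {f′} d = diff-cong (λ x → lemma (f x)) (λ x _ → lemma (f′ x)) (diff-scale (- 1ℚ) d)
      where
        lemma : ∀ x → - 1ℚ * x ≡ - x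
        lemma = solve-∀ ringℚ

    diff-- : ∀ {f f′ g g′} → Diff a b f f′ → Diff a b g g′ → Diff a b (λ x → f x - g x) (λ x → f′ x - g′ x)
    diff-- d₁ d₂ = diff-+ d₁ (diff-neg d₂)

    diff-sum : ∀ {f f′ : ℚ → ℕ → ℚ} → (∀ n → Diff a b (λ x → f x n) (λ x → f′ x n)) →
      ∀ n → Diff a b (λ x → sum (f x) n) (λ x → sum (f′ x) n)
    diff-sum d zero = diff-const 0ℚ
    diff-sum d (suc n) = diff-+ (diff-sum d n) (d n)

    diff-id : 0ℚ ≤ a → 0ℚ ≤ b → Diff a b (λ x → x) (λ _ → 1ℚ)
    diff-id 0≤a 0≤b = record
      { bound = 1ℚ + b
      ; 0≤bound = +-nonNeg 0≤1 0≤b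
      ; values = λ x (a≤x , x≤b) → ≤-trans (∣≥0∣ (≤-trans 0≤a a≤x)) (≤-trans x≤b (≤-by 1ℚ 0≤1 (ℚₚ.+-comm b 1ℚ)))
      ; slopes = λ _ _ → 1≤
      ; lipschitz = λ x y _ _ → grow (ℚₚ.0≤∣p∣ (y - x)) 1≤ (≤-reflexive (sym (ℚₚ.*-identityˡ ∣ y - x ∣)))
      ; remainder = λ x y _ _ → subst (λ t → ∣ t ∣ ≤ (1ℚ + b) * (∣ y - x ∣ * ∣ y - x ∣)) (sym (lemma (y - x)))
          (*-nonNeg (+-nonNeg 0≤1 0≤b) (0≤∣∣² (y - x)))
      }
      where
        1≤ : 1ℚ ≤ 1ℚ + b
        1≤ = ≤-by b 0≤b refl
        lemma : ∀ h → h - 1ℚ * h ≡ 0ℚ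
        lemma = solve-∀ ringℚ

    diff-inv : 0ℚ < a → Diff a b inv (λ x → - (inv x * inv x))
    diff-inv 0<a = record
      { bound = K
      ; 0≤bound = 0≤K
      ; values = λ x p → ≤-trans (∣inv∣ x p) i≤K
      ; slopes = λ x p → ≤-trans (∣-∣≤ (∣*∣≤ (∣inv∣ x p) (∣inv∣ x p))) ii≤K
      ; lipschitz = λ x y p q → grow (ℚₚ.0≤∣p∣ (y - x)) ii≤K
          (subst (λ t → ∣ t ∣ ≤ i * i * ∣ y - x ∣) (sym (Δ x y p q)) (∣-∣≤ (∣*∣≤ (∣*∣≤ (∣inv∣ x p) (∣inv∣ y q)) (≤-refl {∣ y - x ∣}))))
      ; remainder = λ x y p q → grow (0≤∣∣² (y - x)) iii≤K
          (subst₂ (λ s t → ∣ s ∣ ≤ t)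
            (sym (trans (cong (λ t → t - (- (inv x * inv x)) * (y - x)) (Δ x y p q))
              (trans (lemma₁ (inv x) (inv y) (y - x)) (trans (cong (λ t → inv x * - (y - x) * t) (Δ x y p q)) (lemma₂ (inv x) (inv y) (y - x))))))
            refl
            (∣*∣≤ (∣*∣≤ (∣*∣≤ (∣inv∣ x p) (∣inv∣ x p)) (∣inv∣ y q)) (∣*∣≤ (≤-refl {∣ y - x ∣}) (≤-refl {∣ y - x ∣}))))
      }
      where
        i K : ℚ
        i = inv a
        K = i + i * i + i * i * i
        0≤i : 0ℚ ≤ i
        0≤i = <⇒≤ (inv-pos 0<a)
        0≤ii : 0ℚ ≤ i * i
        0≤ii = *-nonNeg 0≤i 0≤i
        0≤iii : 0ℚ ≤ i * i * i
        0≤iii = *-nonNeg 0≤ii 0≤i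
        0≤K : 0ℚ ≤ K
        0≤K = +-nonNeg (+-nonNeg 0≤i 0≤ii) 0≤iii
        i≤K : i ≤ K
        i≤K = ≤-by (i * i + i * i * i) (+-nonNeg 0≤ii 0≤iii) (sym (ℚₚ.+-assoc i (i * i) (i * i * i)))
        ii≤K : i * i ≤ K
        ii≤K = ≤-by (i + i * i * i) (+-nonNeg 0≤i 0≤iii) (lemma i (i * i) (i * i * i))
          where
            lemma : ∀ a b c → b + (a + c) ≡ a + b + c
            lemma = solve-∀ ringℚ
        iii≤K : i * i * i ≤ K
        iii≤K = ≤-by (i + i * i) (+-nonNeg 0≤i 0≤ii) (ℚₚ.+-comm (i * i * i) (i + i * i))
        0<x : ∀ x → x ∈[ a , b ] → 0ℚ < x
        0<x x (a≤x , _) = ℚₚ.<-≤-trans 0<a a≤x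
        inv≤ : ∀ x → x ∈[ a , b ] → inv x ≤ i
        inv≤ x p = cancel-≤ (0<x x p) (subst (_≤ x * i) (sym (*-inv⁺ (0<x x p)))
          (subst (_≤ x * i) (*-inv⁺ 0<a) (ℚₚ.*-monoʳ-≤-nonNeg i {{nonNegative 0≤i}} (proj₁ p))))
        ∣inv∣ : ∀ x → x ∈[ a , b ] → ∣ inv x ∣ ≤ i
        ∣inv∣ x p = ≤-trans (∣≥0∣ (<⇒≤ (inv-pos (0<x x p)))) (inv≤ x p)
        Δ : ∀ x y → x ∈[ a , b ] → y ∈[ a , b ] → inv y - inv x ≡ - (inv x * inv y * (y - x))
        Δ x y p q = trans (sym (inv-diff y x (inv y) (inv x) (*-inv⁺ (0<x y q)) (*-inv⁺ (0<x x p)))) (lemma x y (inv x) (inv y))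
          where
            lemma : ∀ x y u v → v * u * (x - y) ≡ - (u * v * (y - x))
            lemma = solve-∀ ringℚ
        lemma₁ : ∀ u v h → - (u * v * h) - (- (u * u)) * h ≡ u * - h * (v - u)
        lemma₁ = solve-∀ ringℚ
        lemma₂ : ∀ u v h → u * - h * - (u * v * h) ≡ u * u * v * (h * h)
        lemma₂ = solve-∀ ringℚ

  -- The one chain rule that is needed, for the substitution k = q².
  diff-∘-square : ∀ {a b f f′} → 0ℚ ≤ a → a ≤ b → Diff (a * a) (b * b) f f′ →
    Diff a b (λ x → f (x * x)) (λ x → f′ (x * x) * (ι 2 * x))
  diff-∘-square {a} {b} {f} {f′} 0≤a a≤b d = record
    { bound = K
    ; 0≤bound = 0≤K
    ; values = λ x p → ≤-trans (values d (x * x) (square x p)) B≤K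
    ; slopes = λ x p → ≤-trans (∣*∣≤ (slopes d (x * x) (square x p)) (∣2x∣ x p)) B2b≤K
    ; lipschitz = λ x y p q → grow (ℚₚ.0≤∣p∣ (y - x)) B2b≤K (≤-trans (lipschitz d (x * x) (y * y) (square x p) (square y q))
        (subst (B * ∣ y * y - x * x ∣ ≤_) (sym (ℚₚ.*-assoc B (ι 2 * b) ∣ y - x ∣)) (*-monoˡ 0≤B (∣Δ∣ x y p q))))
    ; remainder = λ x y p q → grow (0≤∣∣² (y - x)) B+≤K (subst₂ _≤_ (cong ∣_∣ (lemma₃ (f (y * y)) (f (x * x)) (f′ (x * x)) x y)) (lemma₄ B b ∣ y - x ∣)
        (∣+∣≤ (≤-trans (remainder d (x * x) (y * y) (square x p) (square y q))
                (*-monoˡ 0≤B (*-mono (ℚₚ.0≤∣p∣ (y * y - x * x)) (*-nonNeg 0≤2b (ℚₚ.0≤∣p∣ (y - x))) (∣Δ∣ x y p q) (∣Δ∣ x y p q))))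
              (∣*∣≤ (slopes d (x * x) (square x p)) (∣*∣≤ (≤-refl {∣ y - x ∣}) (≤-refl {∣ y - x ∣})))))
    }
    where
      B K : ℚ
      B = bound d
      K = B * (1ℚ + ι 2 * b + ι 2 * b * (ι 2 * b))
      0≤b : 0ℚ ≤ b
      0≤b = ≤-trans 0≤a a≤b
      0≤2b : 0ℚ ≤ ι 2 * b
      0≤2b = *-nonNeg (0≤ι 2) 0≤b
      0≤B : 0ℚ ≤ B
      0≤B = 0≤bound d
      0≤4bb : 0ℚ ≤ ι 2 * b * (ι 2 * b)
      0≤4bb = *-nonNeg 0≤2b 0≤2b
      0≤K : 0ℚ ≤ K
      0≤K = *-nonNeg 0≤B (+-nonNeg (+-nonNeg 0≤1 0≤2b) 0≤4bb)
      B≤K : B ≤ K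
      B≤K = ≤-by (B * (ι 2 * b + ι 2 * b * (ι 2 * b))) (*-nonNeg 0≤B (+-nonNeg 0≤2b 0≤4bb)) (lemma B (ι 2 * b))
        where
          lemma : ∀ B c → B + B * (c + c * c) ≡ B * (1ℚ + c + c * c)
          lemma = solve-∀ ringℚ
      B2b≤K : B * (ι 2 * b) ≤ K
      B2b≤K = ≤-by (B * (1ℚ + ι 2 * b * (ι 2 * b))) (*-nonNeg 0≤B (+-nonNeg 0≤1 0≤4bb)) (lemma B (ι 2 * b))
        where
          lemma : ∀ B c → B * c + B * (1ℚ + c * c) ≡ B * (1ℚ + c + c * c)
          lemma = solve-∀ ringℚ
      B+≤K : B * (1ℚ + ι 2 * b * (ι 2 * b)) ≤ K
      B+≤K = ≤-by (B * (ι 2 * b)) (*-nonNeg 0≤B 0≤2b) (lemma B (ι 2 * b))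
        where
          lemma : ∀ B c → B * (1ℚ + c * c) + B * c ≡ B * (1ℚ + c + c * c)
          lemma = solve-∀ ringℚ
      square : ∀ x → x ∈[ a , b ] → (x * x) ∈[ a * a , b * b ]
      square x (p , q) = *-mono 0≤a (≤-trans 0≤a p) p p , *-mono (≤-trans 0≤a p) 0≤b q q
      ∣2x∣ : ∀ x → x ∈[ a , b ] → ∣ ι 2 * x ∣ ≤ ι 2 * b
      ∣2x∣ x (p , q) = ≤-trans (∣≥0∣ (*-nonNeg (0≤ι 2) (≤-trans 0≤a p))) (*-monoˡ (0≤ι 2) q)
      ∣Δ∣ : ∀ x y → x ∈[ a , b ] → y ∈[ a , b ] → ∣ y * y - x * x ∣ ≤ ι 2 * b * ∣ y - x ∣
      ∣Δ∣ x y (p , q) (r , s) = subst (λ t → ∣ t ∣ ≤ ι 2 * b * ∣ y - x ∣) (lemma₁ x y)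
        (∣*∣≤ (≤-trans (∣≥0∣ (+-nonNeg (≤-trans 0≤a r) (≤-trans 0≤a p))) (≤-trans (ℚₚ.+-mono-≤ s q) (≤-reflexive (lemma₂ b)))) (≤-refl {∣ y - x ∣}))
        where
          lemma₁ : ∀ x y → (y + x) * (y - x) ≡ y * y - x * x
          lemma₁ = solve-∀ ringℚ
          lemma₂ : ∀ b → b + b ≡ ι 2 * b
          lemma₂ = solve-∀ ringℚ
      lemma₃ : ∀ fy fx f′ x y → (fy - fx - f′ * (y * y - x * x)) + f′ * ((y - x) * (y - x)) ≡ fy - fx - f′ * (ι 2 * x) * (y - x)
      lemma₃ = solve-∀ ringℚ
      lemma₄ : ∀ B b h → B * (ι 2 * b * h * (ι 2 * b * h)) + B * (h * h) ≡ B * (1ℚ + ι 2 * b * (ι 2 * b)) * (h * h)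
      lemma₄ = solve-∀ ringℚ

  -- After n bisections the quadratic remainder B h² has become 2ⁿ pieces of size B (h/2ⁿ)², in all
  -- B h²/2ⁿ, while the contributions of the slope still add up to ε h. A violation of the bound
  -- would leave a gap that some n contradicts.
  mean-value : ∀ {a b f f′ ε} → a ≤ b → Diff a b f f′ → (∀ x → x ∈[ a , b ] → ∣ f′ x ∣ ≤ ε) → ∣ f b - f a ∣ ≤ ε * (b - a)
  mean-value {a} {b} {f} {f′} {ε} a≤b d hε = ℚₚ.≮⇒≥ λ gap →
    let 0<g = subst (_< ∣ f b - f a ∣ - ε * (b - a)) (ℚₚ.+-inverseʳ (ε * (b - a))) (ℚₚ.+-monoˡ-< (- (ε * (b - a))) gap)
        N , small = 2^-small (B * ((b - a) * (b - a))) (∣ f b - f a ∣ - ε * (b - a)) 0<g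
    in ℚₚ.<-irrefl refl (ℚₚ.<-≤-trans (subst (ε * (b - a) + B * ((b - a) * (b - a)) * 2^- N <_)
        (regroup ∣ f b - f a ∣ (ε * (b - a))) (ℚₚ.+-monoʳ-< (ε * (b - a)) (small N ℕₚ.≤-refl)))
        (bisected N a b (≤-refl , a≤b) (a≤b , ≤-refl) a≤b))
    where
      B : ℚ
      B = bound d
      regroup : ∀ x y → y + (x - y) ≡ x
      regroup = solve-∀ ringℚ
      bisected : ∀ n x y → x ∈[ a , b ] → y ∈[ a , b ] → x ≤ y →
        ∣ f y - f x ∣ ≤ ε * (y - x) + B * ((y - x) * (y - x)) * 2^- n
      bisected zero x y p q x≤y = subst₂ _≤_ (cong ∣_∣ (lemma₁ (f y) (f x) (f′ x * (y - x))))
        (trans (cong (λ h → ε * h + B * (h * h)) (ℚₚ.0≤p⇒∣p∣≡p (difference≥0 x≤y))) (lemma₂ (ε * (y - x)) (B * ((y - x) * (y - x)))))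
        (∣+∣≤ (∣*∣≤ (hε x p) (≤-refl {∣ y - x ∣})) (remainder d x y p q))
        where
          lemma₁ : ∀ fy fx t → t + (fy - fx - t) ≡ fy - fx
          lemma₁ = solve-∀ ringℚ
          lemma₂ : ∀ s t → s + t ≡ s + t * 1ℚ
          lemma₂ = solve-∀ ringℚ
      bisected (suc n) x y p q x≤y = subst₂ _≤_ (cong ∣_∣ (lemma₁ (f y) (f x) (f m))) (lemma₂ ε x y B (2^- n))
          (∣+∣≤ (bisected n x m p m∈ x≤m) (bisected n m y m∈ q m≤y))
        where
          m : ℚ
          m = ½ * (x + y)
          x≤m : x ≤ m
          x≤m = ≤-by (½ * (y - x)) (*-nonNeg (<⇒≤ (ℚₚ.positive⁻¹ ½)) (difference≥0 x≤y)) (lemma x y)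
            where
              lemma : ∀ x y → x + ½ * (y - x) ≡ ½ * (x + y)
              lemma = solve-∀ ringℚ
          m≤y : m ≤ y
          m≤y = ≤-by (½ * (y - x)) (*-nonNeg (<⇒≤ (ℚₚ.positive⁻¹ ½)) (difference≥0 x≤y)) (lemma x y)
            where
              lemma : ∀ x y → ½ * (x + y) + ½ * (y - x) ≡ y
              lemma = solve-∀ ringℚ
          m∈ : m ∈[ a , b ]
          m∈ = ≤-trans (proj₁ p) x≤m , ≤-trans m≤y (proj₂ q)
          lemma₁ : ∀ fy fx fm → (fm - fx) + (fy - fm) ≡ fy - fx
          lemma₁ = solve-∀ ringℚ
          lemma₂ : ∀ ε x y B t → let m = ½ * (x + y) in
            ε * (m - x) + B * ((m - x) * (m - x)) * t + (ε * (y - m) + B * ((y - m) * (y - m)) * t) ≡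
            ε * (y - x) + B * ((y - x) * (y - x)) * (½ * t)
          lemma₂ = solve-∀ ringℚ

  module _ {a b : ℚ} (0<a : 0ℚ < a) (a≤b : a ≤ b) where

    private
      d : Diff a b (λ x → x) (λ _ → 1ℚ)
      d = diff-id (<⇒≤ 0<a) (≤-trans (<⇒≤ 0<a) a≤b)
      d-inv : Diff a b inv (λ x → - (inv x * inv x))
      d-inv = diff-inv 0<a

    diff-ζ : Diff a b ζ ζ′
    diff-ζ = diff-cong (λ _ → refl) (λ x _ → lemma x (inv x))
      (diff-scale ¼ (diff-+ (diff-- (diff-+ (diff-* (diff-scale (ι 4) d) d) d) (diff-const (ι 2))) d-inv))
      where
        lemma : ∀ x w → ¼ * (ι 4 * 1ℚ * x + ι 4 * x * 1ℚ + 1ℚ + - 0ℚ + - (w * w)) ≡ ¼ * (ι 8 * x + 1ℚ - w * w)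
        lemma = solve-∀ ringℚ

    diff-τ : Diff a b τ τ′
    diff-τ = diff-cong (λ _ → refl) (λ x _ → lemma x (inv x))
      (diff-scale ¼ (diff-- (diff-+ (diff-+ (diff-const (ι 2)) d) (diff-* (diff-* (diff-scale (ι 2) d) d) d)) d-inv))
      where
        lemma : ∀ x w → ¼ * (0ℚ + 1ℚ + ((ι 2 * 1ℚ * x + ι 2 * x * 1ℚ) * x + ι 2 * x * x * 1ℚ) + - - (w * w)) ≡ ¼ * (1ℚ + ι 6 * x * x + w * w)
        lemma = solve-∀ ringℚ

    mutual
      diff-p : ∀ n → Diff a b (λ x → p x n) (λ x → p′ x n)
      diff-p zero = diff-const 1ℚ
      diff-p (suc n) = diff-scaleʳ (inv (ι (suc n))) (diff-- (diff-scale (ι 2 * ι n + 1ℚ) (diff-* diff-τ (diff-p n)))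
        (diff-scale (ι n) (diff-* (diff-* diff-ζ diff-ζ) (diff-p⁻ n))))

      diff-p⁻ : ∀ n → Diff a b (λ x → p⁻ x n) (λ x → p⁻′ x n)
      diff-p⁻ zero = diff-const 0ℚ
      diff-p⁻ (suc n) = diff-p n

    diff-term : ∀ n → Diff a b (λ x → term x n) (λ x → term′ x n)
    diff-term n = diff-cong (λ _ → refl)
      (λ x _ → cong (coeff n *_) (lemma x (ι n) (p x n) (p′ x n) (ζ x * p⁻ x n) (ζ′ x * p⁻ x n + ζ x * p⁻′ x n)))
      (diff-scale (coeff n) (diff--
        (diff-* (diff-+ (diff-* (diff-scale (ι 2) (diff-- (diff-const (ι 2)) (diff-* d d))) (diff-const (ι n))) (diff-- (diff-const 1ℚ) (diff-* d d))) (diff-p n))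
        (diff-* (diff-scale (ι 2) (diff-- (diff-scale (ι 2) d) (diff-const 1ℚ))) (diff-scale (ι n) (diff-* diff-ζ (diff-p⁻ n))))))
      where
        lemma : ∀ x n p p′ q q′ →
          (ι 2 * (0ℚ + - (1ℚ * x + x * 1ℚ)) * n + ι 2 * (ι 2 - x * x) * 0ℚ + (0ℚ + - (1ℚ * x + x * 1ℚ))) * p
            + (ι 2 * (ι 2 - x * x) * n + (1ℚ - x * x)) * p′
            + - (ι 2 * (ι 2 * 1ℚ + - 0ℚ) * (n * q) + ι 2 * (ι 2 * x - 1ℚ) * (n * q′)) ≡
          (- ι 4 * x * n - ι 2 * x) * p + (ι 2 * (ι 2 - x * x) * n + (1ℚ - x * x)) * p′
            - (ι 4 * (n * q) + ι 2 * (ι 2 * x - 1ℚ) * (n * q′))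
        lemma = solve-∀ ringℚ

    diff-M : ∀ n → Diff a b (λ x → M x n) (λ x → M′ x n)
    diff-M = diff-sum diff-term

  -- M / √k in the variable q = √k, which keeps everything rational.
  ratio : ℕ → ℚ → ℚ
  ratio n q = M (q * q) n * inv q

  -- With k = q², the derivative of M(q²)/q is (2k M′ - M)/q², and `M′-formula` collapses the
  -- numerator. The bound b < 1 supplies the positivity of 1 - k² required there.
  diff-ratio : ∀ {a b} → 0ℚ < a → a ≤ b → b < 1ℚ → ∀ n → Diff a b (ratio n) (λ q → inv q * inv q * residue (q * q) n)
  diff-ratio {a} {b} 0<a a≤b b<1 n = diff-cong (λ _ → refl) derivative
    (diff-* (diff-∘-square (<⇒≤ 0<a) a≤b (diff-M (*-pos 0<a 0<a) (*-mono (<⇒≤ 0<a) (≤-trans (<⇒≤ 0<a) a≤b) a≤b a≤b) n)) (diff-inv 0<a))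
    where
      derivative : ∀ q → q ∈[ a , b ] → M′ (q * q) n * (ι 2 * q) * inv q + M (q * q) n * - (inv q * inv q) ≡ inv q * inv q * residue (q * q) n
      derivative q (a≤q , q≤b) = trans (modulo qq⁻¹ (lemma q (inv q) (M′ (q * q) n) (M (q * q) n)))
        (cong (inv q * inv q *_) (M′-formula (q * q) (*-inv⁺ 0<qq) 0<1-q⁴ n))
        where
          0<q : 0ℚ < q
          0<q = ℚₚ.<-≤-trans 0<a a≤q
          0<qq : 0ℚ < q * q
          0<qq = *-pos 0<q 0<q
          qq⁻¹ : q * inv q ≡ 1ℚ
          qq⁻¹ = *-inv⁺ 0<q
          0<1-q⁴ : 0ℚ < 1ℚ - q * q * (q * q)
          0<1-q⁴ = difference>0 (square<1 (<⇒≤ 0<qq) (square<1 (<⇒≤ 0<q) (ℚₚ.≤-<-trans q≤b b<1)))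
          lemma : ∀ q w m′ m → m′ * (ι 2 * q) * w + m * - (w * w) ≡ w * w * (ι 2 * (q * q) * m′ - m) + (q * w - 1ℚ) * (- ι 2 * q * w * m′)
          lemma = solve-∀ ringℚ

  -- Bounds for Legendre polynomials

  infixr 8 _^_
  _^_ : ℚ → ℕ → ℚ
  x ^ zero = 1ℚ
  x ^ suc n = x * x ^ n

  ^-nonNeg : ∀ {x} n → 0ℚ ≤ x → 0ℚ ≤ x ^ n
  ^-nonNeg zero h = 0≤1
  ^-nonNeg (suc n) h = *-nonNeg h (^-nonNeg n h)

  mutual
    leg-scale : ∀ c τ s n → leg (c * τ) (c * c * s) n ≡ c ^ n * leg τ s n
    leg-scale c τ s zero = refl
    leg-scale c τ s (suc n) = trans
      (cong (_* inv (ι (suc n))) (trans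
        (lemma₁ (ι n) c τ s (leg (c * τ) (c * c * s) n) (leg⁻ (c * τ) (c * c * s) n))
        (cong₂ (λ x y → (ι 2 * ι n + 1ℚ) * (c * τ * x) - ι n * (c * s * y)) (leg-scale c τ s n) (leg⁻-scale c τ s n))))
      (lemma₂ (ι n) c τ s (c ^ n) (leg τ s n) (leg⁻ τ s n) (inv (ι (suc n))))
      where
        lemma₁ : ∀ n c τ s x y → (ι 2 * n + 1ℚ) * (c * τ * x) - n * (c * c * s * y) ≡ (ι 2 * n + 1ℚ) * (c * τ * x) - n * (c * s * (c * y))
        lemma₁ = solve-∀ ringℚ
        lemma₂ : ∀ n c τ s e x y i → ((ι 2 * n + 1ℚ) * (c * τ * (e * x)) - n * (c * s * (e * y))) * i ≡
          c * e * (((ι 2 * n + 1ℚ) * (τ * x) - n * (s * y)) * i)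
        lemma₂ = solve-∀ ringℚ

    -- `leg⁻` is homogeneous of degree n - 1; the extra `c` on the left avoids that exponent at n =
    -- 0.
    leg⁻-scale : ∀ c τ s n → c * leg⁻ (c * τ) (c * c * s) n ≡ c ^ n * leg⁻ τ s n
    leg⁻-scale c τ s zero = ℚₚ.*-zeroʳ c
    leg⁻-scale c τ s (suc n) = trans (cong (c *_) (leg-scale c τ s n)) (sym (ℚₚ.*-assoc c (c ^ n) (leg τ s n)))

  ≤-from-squares : ∀ {x y} → 0ℚ ≤ x → 0ℚ ≤ y → x * x ≤ y * y → x ≤ y
  ≤-from-squares {x} {y} 0≤x 0≤y h = ℚₚ.≮⇒≥ λ y<x → ℚₚ.<-irrefl refl
    (ℚₚ.<-≤-trans (*-mono-< y x y x 0≤y (ℚₚ.≤-<-trans 0≤y y<x) (<⇒≤ y<x) y<x) h)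

  ∣x∣²≡x² : ∀ x → ∣ x ∣ * ∣ x ∣ ≡ x * x
  ∣x∣²≡x² x = trans (sym (ℚₚ.∣p*q∣≡∣p∣*∣q∣ x x)) (ℚₚ.0≤p⇒∣p∣≡p (square-nonNeg x))

  module _ (y : ℚ) (y²<1 : 0ℚ < 1ℚ - y * y) where

    private
      P P⁻ : ℕ → ℚ
      P = leg y 1ℚ
      P⁻ = leg⁻ y 1ℚ

    -- The left side equals (y Pₙ₊₁ - Pₙ)² + (1 - y²) Pₙ₊₁², and Pₙ₊₂ - y Pₙ₊₁ is
    -- (n+1)/(n+2) times y Pₙ₊₁ - Pₙ; so it decreases in n.
    leg-ellipse : ∀ n → (P (suc n) - y * P n) * (P (suc n) - y * P n) + (1ℚ - y * y) * (P n * P n) ≤ 1ℚ - y * y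
    leg-ellipse zero = ≤-reflexive (trans (cong (λ t → (t - y * 1ℚ) * (t - y * 1ℚ) + (1ℚ - y * y) * (1ℚ * 1ℚ)) P₁≡y) (lemma y))
      where
        P₁≡y : P 1 ≡ y
        P₁≡y = trans (sym (ℚₚ.*-identityˡ (P 1))) (trans (leg-rec y 1ℚ 0) (lemma₀ y))
          where
            lemma₀ : ∀ y → (ι 2 * 0ℚ + 1ℚ) * (y * 1ℚ) - 0ℚ * (1ℚ * 0ℚ) ≡ y
            lemma₀ = solve-∀ ringℚ
        lemma : ∀ y → (y - y * 1ℚ) * (y - y * 1ℚ) + (1ℚ - y * y) * (1ℚ * 1ℚ) ≡ 1ℚ - y * y
        lemma = solve-∀ ringℚ
    leg-ellipse (suc n) = ≤-trans (≤-trans (ℚₚ.+-monoˡ-≤ _ contraction) (≤-reflexive (lemma y (P (suc n)) (P n)))) (leg-ellipse n)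
      where
        a b : ℚ
        a = P (suc (suc n)) - y * P (suc n)
        b = y * P (suc n) - P n
        ν : ℚ
        ν = 1ℚ + ι n
        0≤ν : 0ℚ ≤ ν
        0≤ν = +-nonNeg 0≤1 (0≤ι n)
        scaled : (1ℚ + ν) * a ≡ ν * b
        scaled = trans (lemma₁ ν y (P (suc (suc n))) (P (suc n)))
          (trans (cong (_- (1ℚ + ν) * (y * P (suc n))) (subst
              (λ ν → (1ℚ + ν) * P (suc (suc n)) ≡ (ι 2 * ν + 1ℚ) * (y * P (suc n)) - ν * (1ℚ * P n)) (ι-suc n) (leg-rec y 1ℚ (suc n))))
            (lemma₂ ν y (P (suc n)) (P n)))
          where
            lemma₁ : ∀ ν y p′ p → (1ℚ + ν) * (p′ - y * p) ≡ (1ℚ + ν) * p′ - (1ℚ + ν) * (y * p)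
            lemma₁ = solve-∀ ringℚ
            lemma₂ : ∀ ν y p p⁻ → (ι 2 * ν + 1ℚ) * (y * p) - ν * (1ℚ * p⁻) - (1ℚ + ν) * (y * p) ≡ ν * (y * p - p⁻)
            lemma₂ = solve-∀ ringℚ
        contraction : a * a ≤ b * b
        contraction = cancel-≤ (*-pos 0<1+ν 0<1+ν) (≤-by ((1ℚ + ι 2 * ν) * (b * b))
            (*-nonNeg (+-nonNeg 0≤1 (*-nonNeg (0≤ι 2) 0≤ν)) (square-nonNeg b))
            (trans (cong (_+ (1ℚ + ι 2 * ν) * (b * b)) (trans (lemma₁ (1ℚ + ν) a) (cong (λ t → t * t) scaled))) (lemma₂ ν b)))
          where
            0<1+ν : 0ℚ < 1ℚ + ν
            0<1+ν = +-pos 0<1 0≤ν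
            lemma₁ : ∀ c a → c * c * (a * a) ≡ c * a * (c * a)
            lemma₁ = solve-∀ ringℚ
            lemma₂ : ∀ ν b → ν * b * (ν * b) + (1ℚ + ι 2 * ν) * (b * b) ≡ (1ℚ + ν) * (1ℚ + ν) * (b * b)
            lemma₂ = solve-∀ ringℚ
        lemma : ∀ y p p⁻ → (y * p - p⁻) * (y * p - p⁻) + (1ℚ - y * y) * (p * p) ≡ (p - y * p⁻) * (p - y * p⁻) + (1ℚ - y * y) * (p⁻ * p⁻)
        lemma = solve-∀ ringℚ

    ∣leg∣≤1 : ∀ n → ∣ P n ∣ ≤ 1ℚ
    ∣leg∣≤1 n = ≤-from-squares (ℚₚ.0≤∣p∣ (P n)) 0≤1 (subst (_≤ 1ℚ * 1ℚ) (sym (∣x∣²≡x² (P n)))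
      (cancel-≤ y²<1 (≤-trans (≤-by ((P (suc n) - y * P n) * (P (suc n) - y * P n)) (square-nonNeg (P (suc n) - y * P n)) (ℚₚ.+-comm ((1ℚ - y * y) * (P n * P n)) _))
        (≤-trans (leg-ellipse n) (≤-reflexive (sym (ℚₚ.*-identityʳ (1ℚ - y * y))))))))

    module _ (y≤1 : 0ℚ ≤ 1ℚ - y) where

      private
        δ : ℚ
        δ = 1ℚ - y

      increment-suc : ∀ n → ι (suc n) * (P (suc n) - P n) ≡ ι n * (P n - P⁻ n) - δ * ((ι 2 * ι n + 1ℚ) * P n)
      increment-suc n = trans (cong (_* (P (suc n) - P n)) (ι-suc n)) (trans (lemma₁ (ι n) (P (suc n)) (P n))
        (trans (cong (_- (1ℚ + ι n) * P n) (leg-rec y 1ℚ n)) (lemma₂ (ι n) y (P n) (P⁻ n))))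
        where
          lemma₁ : ∀ n p′ p → (1ℚ + n) * (p′ - p) ≡ (1ℚ + n) * p′ - (1ℚ + n) * p
          lemma₁ = solve-∀ ringℚ
          lemma₂ : ∀ n y p p⁻ → (ι 2 * n + 1ℚ) * (y * p) - n * (1ℚ * p⁻) - (1ℚ + n) * p ≡ n * (p - p⁻) - (1ℚ - y) * ((ι 2 * n + 1ℚ) * p)
          lemma₂ = solve-∀ ringℚ

      -- Iterating `increment-suc` with |Pᵢ| ≤ 1 leaves δ times the sum of the first n odd numbers.
      ∣increment∣ : ∀ n → ∣ ι n * (P n - P⁻ n) ∣ ≤ δ * (ι n * ι n)
      ∣increment∣ zero = ≤-reflexive (trans (cong ∣_∣ (lemma₁ (P 0 - P⁻ 0))) (sym (lemma₂ δ)))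
        where
          lemma₁ : ∀ x → 0ℚ * x ≡ 0ℚ
          lemma₁ = solve-∀ ringℚ
          lemma₂ : ∀ x → x * (0ℚ * 0ℚ) ≡ 0ℚ
          lemma₂ = solve-∀ ringℚ
      ∣increment∣ (suc n) = subst₂ _≤_ (cong ∣_∣ (sym (increment-suc n)))
        (trans (lemma δ (ι n)) (cong (λ ν → δ * (ν * ν)) (sym (ι-suc n))))
        (∣+∣≤ (∣increment∣ n) (∣-∣≤ (∣*∣≤ (∣≥0∣ y≤1) (∣*∣≤ (∣≥0∣ (+-nonNeg (*-nonNeg (0≤ι 2) (0≤ι n)) 0≤1)) (∣leg∣≤1 n)))))
        where
          lemma : ∀ δ n → δ * (n * n) + δ * ((ι 2 * n + 1ℚ) * 1ℚ) ≡ δ * ((1ℚ + n) * (1ℚ + n))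
          lemma = solve-∀ ringℚ

      ∣leg-1∣ : ∀ n → ∣ P n - 1ℚ ∣ ≤ δ * (ι n * ι n)
      ∣leg-1∣ zero = ≤-reflexive (sym (lemma δ))
        where
          lemma : ∀ x → x * (0ℚ * 0ℚ) ≡ 0ℚ
          lemma = solve-∀ ringℚ
      ∣leg-1∣ (suc n) = ≤-trans (subst (λ t → ∣ t ∣ ≤ δ * (ι n * ι n) + δ * ι (suc n)) (lemma₁ (P n) (P (suc n))) (∣+∣≤ (∣leg-1∣ n) increment≤))
        (≤-by (δ * ι n) (*-nonNeg y≤1 (0≤ι n)) (trans (cong (λ ν → δ * (ι n * ι n) + δ * ν + δ * ι n) (ι-suc n))
          (trans (lemma₂ δ (ι n)) (cong (λ ν → δ * (ν * ν)) (sym (ι-suc n))))))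
        where
          lemma₁ : ∀ p p′ → p - 1ℚ + (p′ - p) ≡ p′ - 1ℚ
          lemma₁ = solve-∀ ringℚ
          lemma₂ : ∀ δ n → δ * (n * n) + δ * (1ℚ + n) + δ * n ≡ δ * ((1ℚ + n) * (1ℚ + n))
          lemma₂ = solve-∀ ringℚ
          increment≤ : ∣ P (suc n) - P n ∣ ≤ δ * ι (suc n)
          increment≤ = cancel-≤ (0<ι n) (subst₂ _≤_
            (trans (ℚₚ.∣p*q∣≡∣p∣*∣q∣ (ι (suc n)) (P (suc n) - P n)) (cong (_* ∣ P (suc n) - P n ∣) (ℚₚ.0≤p⇒∣p∣≡p (0≤ι (suc n)))))
            (lemma₃ δ (ι (suc n))) (∣increment∣ (suc n)))
            where
              lemma₃ : ∀ δ n → δ * (n * n) ≡ n * (δ * n)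
              lemma₃ = solve-∀ ringℚ

  0<Q : ∀ {k} → 0ℚ < k → 0ℚ < Q k
  0<Q {k} 0<k = subst (0ℚ <_) (lemma k) (ℚₚ.<-≤-trans 0<k (≤-by _ (square-nonNeg (ι 2 * k - 1ℚ)) refl))
    where
      lemma : ∀ k → k + (ι 2 * k - 1ℚ) * (ι 2 * k - 1ℚ) ≡ ι 4 * k * k - ι 3 * k + 1ℚ
      lemma = solve-∀ ringℚ

  -- The argument -x of the Legendre polynomials, so that p k n = ζⁿ Pₙ(y).
  y : ℚ → ℚ
  y k = - (1ℚ - ι 3 * k + ι 2 * k * k - ι 2 * k * k * k) * inv (Q k)

  module _ (k : ℚ) (0<k : 0ℚ < k) (k<1 : k < 1ℚ) where

    private
      QQ⁻¹ : Q k * inv (Q k) ≡ 1ℚ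
      QQ⁻¹ = *-inv⁺ (0<Q 0<k)
      0<1-k : 0ℚ < 1ℚ - k
      0<1-k = difference>0 k<1
      0<1+k : 0ℚ < 1ℚ + k
      0<1+k = +-pos 0<1 (<⇒≤ 0<k)

    ζ>0 : 0ℚ < ζ k
    ζ>0 = ℚₚ.≰⇒> λ ζ≤0 → ℚₚ.<-irrefl refl (ℚₚ.<-≤-trans (*-pos 0<1+k (0<Q 0<k))
      (≤-trans (≤-reflexive (sym (4kζ k (*-inv⁺ 0<k)))) (≤-trans (*-monoˡ (0≤ι 4) (*-monoˡ (<⇒≤ 0<k) ζ≤0)) (≤-reflexive (lemma k)))))
      where
        lemma : ∀ k → ι 4 * (k * 0ℚ) ≡ 0ℚ
        lemma = solve-∀ ringℚ

    τ≡ζy : τ k ≡ ζ k * y k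
    τ≡ζy = cancel (*-pos {ι 4} {k} (0<ι 3) 0<k) (trans (lemma₁ k (τ k)) (trans (4kτ k kk⁻¹)
      (trans (modulo QQ⁻¹ (lemma₂ k (inv (Q k)))) (trans (cong (_* y k) (sym (4kζ k kk⁻¹))) (lemma₃ k (ζ k) (y k))))))
      where
        kk⁻¹ : k * inv k ≡ 1ℚ
        kk⁻¹ = *-inv⁺ 0<k
        lemma₁ : ∀ k t → ι 4 * k * t ≡ ι 4 * (k * t)
        lemma₁ = solve-∀ ringℚ
        lemma₂ : ∀ k q → - (1ℚ + k) * (1ℚ - ι 3 * k + ι 2 * k * k - ι 2 * k * k * k) ≡
          (1ℚ + k) * (ι 4 * k * k - ι 3 * k + 1ℚ) * (- (1ℚ - ι 3 * k + ι 2 * k * k - ι 2 * k * k * k) * q)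
          + ((ι 4 * k * k - ι 3 * k + 1ℚ) * q - 1ℚ) * ((1ℚ + k) * (1ℚ - ι 3 * k + ι 2 * k * k - ι 2 * k * k * k))
        lemma₂ = solve-∀ ringℚ
        lemma₃ : ∀ k z y → ι 4 * (k * z) * y ≡ ι 4 * k * (z * y)
        lemma₃ = solve-∀ ringℚ

    -- The third power of 1 - k is essential: by `∣leg-1∣` the error Pₙ(y) - 1 is of order (1 - k)³
    -- n², while the sum of n² ζⁿ is of order (1 - k)⁻³. The prefactor 1 - ζ then makes the total
    -- small.
    1-y : 1ℚ - y k ≡ ι 2 * ((1ℚ - k) * (1ℚ - k) * (1ℚ - k)) * inv (Q k)
    1-y = modulo QQ⁻¹ (lemma k (inv (Q k)))
      where
        lemma : ∀ k q → 1ℚ - - (1ℚ - ι 3 * k + ι 2 * k * k - ι 2 * k * k * k) * q ≡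
          ι 2 * ((1ℚ - k) * (1ℚ - k) * (1ℚ - k)) * q + ((ι 4 * k * k - ι 3 * k + 1ℚ) * q - 1ℚ) * - 1ℚ
        lemma = solve-∀ ringℚ

    1+y : 1ℚ + y k ≡ ι 2 * (k * k * (1ℚ + k)) * inv (Q k)
    1+y = modulo QQ⁻¹ (lemma k (inv (Q k)))
      where
        lemma : ∀ k q → 1ℚ + - (1ℚ - ι 3 * k + ι 2 * k * k - ι 2 * k * k * k) * q ≡
          ι 2 * (k * k * (1ℚ + k)) * q + ((ι 4 * k * k - ι 3 * k + 1ℚ) * q - 1ℚ) * - 1ℚ
        lemma = solve-∀ ringℚ

    0<1-y : 0ℚ < 1ℚ - y k
    0<1-y = subst (0ℚ <_) (sym 1-y) (*-pos (*-pos {ι 2} (0<ι 1) (*-pos (*-pos 0<1-k 0<1-k) 0<1-k)) (inv-pos (0<Q 0<k)))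

    0<1-y² : 0ℚ < 1ℚ - y k * y k
    0<1-y² = subst (0ℚ <_) (lemma (y k)) (*-pos 0<1-y (subst (0ℚ <_) (sym 1+y)
        (*-pos (*-pos {ι 2} (0<ι 1) (*-pos (*-pos 0<k 0<k) 0<1+k)) (inv-pos (0<Q 0<k)))))
      where
        lemma : ∀ y → (1ℚ - y) * (1ℚ + y) ≡ 1ℚ - y * y
        lemma = solve-∀ ringℚ

    p≡ζⁿP : ∀ n → p k n ≡ ζ k ^ n * leg (y k) 1ℚ n
    p≡ζⁿP n = trans (cong₂ (λ t s → leg t s n) τ≡ζy (sym (ℚₚ.*-identityʳ (ζ k * ζ k)))) (leg-scale (ζ k) (y k) 1ℚ n)

    ζp⁻≡ζⁿP⁻ : ∀ n → ζ k * p⁻ k n ≡ ζ k ^ n * leg⁻ (y k) 1ℚ n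
    ζp⁻≡ζⁿP⁻ n = trans (cong₂ (λ t s → ζ k * leg⁻ t s n) τ≡ζy (sym (ℚₚ.*-identityʳ (ζ k * ζ k)))) (leg⁻-scale (ζ k) (y k) 1ℚ n)

    ∣p∣≤ζⁿ : ∀ n → ∣ p k n ∣ ≤ ζ k ^ n
    ∣p∣≤ζⁿ n = subst₂ _≤_ (cong ∣_∣ (sym (p≡ζⁿP n))) (ℚₚ.*-identityʳ (ζ k ^ n))
      (∣*∣≤ (∣≥0∣ (^-nonNeg n (<⇒≤ ζ>0))) (∣leg∣≤1 (y k) 0<1-y² n))

  -- The limit k → 1

  ^-≤1 : ∀ {x} n → 0ℚ ≤ x → x ≤ 1ℚ → x ^ n ≤ 1ℚ
  ^-≤1 zero _ _ = ≤-refl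
  ^-≤1 (suc n) 0≤x x≤1 = *-mono 0≤x 0≤1 x≤1 (^-≤1 n 0≤x x≤1)

  module Geometric (z ε : ℚ) (0≤z : 0ℚ ≤ z) (0≤ε : 0ℚ ≤ ε) (ε≤1-z : ε ≤ 1ℚ - z) where

    S₀ S₁ S₂ : ℕ → ℚ
    S₀ = sum (z ^_)
    S₁ = sum (λ n → ι n * z ^ n)
    S₂ = sum (λ n → ι n * ι n * z ^ n)

    private
      z≤1 : z ≤ 1ℚ
      z≤1 = ≤-by (1ℚ - z) (≤-trans 0≤ε ε≤1-z) (lemma z)
        where
          lemma : ∀ z → z + (1ℚ - z) ≡ 1ℚ
          lemma = solve-∀ ringℚ

      0≤z^ : ∀ n → 0ℚ ≤ z ^ n
      0≤z^ n = ^-nonNeg n 0≤z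

      0≤S₀ : ∀ n → 0ℚ ≤ S₀ n
      0≤S₀ = sum-nonNeg 0≤z^

      0≤S₁ : ∀ n → 0ℚ ≤ S₁ n
      0≤S₁ = sum-nonNeg λ n → *-nonNeg (0≤ι n) (0≤z^ n)

      0≤S₂ : ∀ n → 0ℚ ≤ S₂ n
      0≤S₂ = sum-nonNeg λ n → *-nonNeg (*-nonNeg (0≤ι n) (0≤ι n)) (0≤z^ n)

      shrink : ∀ {x} → 0ℚ ≤ x → ε * x ≤ (1ℚ - z) * x
      shrink {x} 0≤x = ℚₚ.*-monoʳ-≤-nonNeg x {{nonNegative 0≤x}} ε≤1-z

      dropʳ : ∀ {a b c} → 0ℚ ≤ b → a + b ≡ c → a ≤ c
      dropʳ 0≤b e = ≤-by _ 0≤b e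

      z*≤ : ∀ {x} → 0ℚ ≤ x → z * x ≤ x
      z*≤ {x} 0≤x = ≤-trans (ℚₚ.*-monoʳ-≤-nonNeg x {{nonNegative 0≤x}} z≤1) (≤-reflexive (ℚₚ.*-identityˡ x))

    S₀-closed : ∀ n → (1ℚ - z) * S₀ n + z ^ n ≡ 1ℚ
    S₀-closed zero = lemma z
      where
        lemma : ∀ z → (1ℚ - z) * 0ℚ + 1ℚ ≡ 1ℚ
        lemma = solve-∀ ringℚ
    S₀-closed (suc n) = trans (lemma z (S₀ n) (z ^ n)) (S₀-closed n)
      where
        lemma : ∀ z s x → (1ℚ - z) * (s + x) + z * x ≡ (1ℚ - z) * s + x
        lemma = solve-∀ ringℚ

    S₁-closed : ∀ n → (1ℚ - z) * S₁ n + ι n * z ^ n ≡ z * S₀ n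
    S₁-closed zero = lemma z
      where
        lemma : ∀ z → (1ℚ - z) * 0ℚ + 0ℚ * 1ℚ ≡ z * 0ℚ
        lemma = solve-∀ ringℚ
    S₁-closed (suc n) = trans (cong (λ ν → (1ℚ - z) * S₁ (suc n) + ν * (z * z ^ n)) (ι-suc n))
      (trans (lemma₁ z (S₁ n) (ι n) (z ^ n)) (trans (cong (_+ z * z ^ n) (S₁-closed n)) (lemma₂ z (S₀ n) (z ^ n))))
      where
        lemma₁ : ∀ z s n x → (1ℚ - z) * (s + n * x) + (1ℚ + n) * (z * x) ≡ (1ℚ - z) * s + n * x + z * x
        lemma₁ = solve-∀ ringℚ
        lemma₂ : ∀ z s x → z * s + z * x ≡ z * (s + x)
        lemma₂ = solve-∀ ringℚ

    S₂-closed : ∀ n → (1ℚ - z) * S₂ n + ι n * ι n * z ^ n ≡ z * (ι 2 * S₁ n + S₀ n)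
    S₂-closed zero = lemma z
      where
        lemma : ∀ z → (1ℚ - z) * 0ℚ + 0ℚ * 0ℚ * 1ℚ ≡ z * (ι 2 * 0ℚ + 0ℚ)
        lemma = solve-∀ ringℚ
    S₂-closed (suc n) = trans (cong (λ ν → (1ℚ - z) * S₂ (suc n) + ν * ν * (z * z ^ n)) (ι-suc n))
      (trans (lemma₁ z (S₂ n) (ι n) (z ^ n)) (trans (cong (_+ z * ((ι 2 * ι n + 1ℚ) * z ^ n)) (S₂-closed n)) (lemma₂ z (S₁ n) (S₀ n) (ι n) (z ^ n))))
      where
        lemma₁ : ∀ z s n x → (1ℚ - z) * (s + n * n * x) + (1ℚ + n) * (1ℚ + n) * (z * x) ≡ (1ℚ - z) * s + n * n * x + z * ((ι 2 * n + 1ℚ) * x)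
        lemma₁ = solve-∀ ringℚ
        lemma₂ : ∀ z s t n x → z * (ι 2 * s + t) + z * ((ι 2 * n + 1ℚ) * x) ≡ z * (ι 2 * (s + n * x) + (t + x))
        lemma₂ = solve-∀ ringℚ

    S₀-bound : ∀ n → ε * S₀ n ≤ 1ℚ
    S₀-bound n = ≤-trans (shrink (0≤S₀ n)) (dropʳ (0≤z^ n) (S₀-closed n))

    S₁-bound : ∀ n → ε * (ε * S₁ n) ≤ 1ℚ
    S₁-bound n = ≤-trans (*-monoˡ 0≤ε (≤-trans (shrink (0≤S₁ n))
      (≤-trans (dropʳ (*-nonNeg (0≤ι n) (0≤z^ n)) (S₁-closed n)) (z*≤ (0≤S₀ n))))) (S₀-bound n)

    S₂-bound : ∀ n → ε * (ε * (ε * S₂ n)) ≤ ι 2 + ε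
    S₂-bound n = ≤-trans (*-monoˡ 0≤ε (*-monoˡ 0≤ε (≤-trans (shrink (0≤S₂ n))
        (≤-trans (dropʳ (*-nonNeg (*-nonNeg (0≤ι n) (0≤ι n)) (0≤z^ n)) (S₂-closed n)) (z*≤ (+-nonNeg (*-nonNeg (0≤ι 2) (0≤S₁ n)) (0≤S₀ n)))))))
      (≤-trans (≤-reflexive (lemma₁ ε (S₁ n) (S₀ n)))
        (≤-trans (ℚₚ.+-mono-≤ (*-monoˡ (0≤ι 2) (S₁-bound n)) (*-monoˡ 0≤ε (S₀-bound n))) (≤-reflexive (lemma₂ ε))))
      where
        lemma₁ : ∀ e s t → e * (e * (ι 2 * s + t)) ≡ ι 2 * (e * (e * s)) + e * (e * t)
        lemma₁ = solve-∀ ringℚ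
        lemma₂ : ∀ e → ι 2 * 1ℚ + e * 1ℚ ≡ ι 2 + e
        lemma₂ = solve-∀ ringℚ

    coeff-sum : ℕ → ℚ
    coeff-sum = sum (λ n → coeff n * z ^ n)

    coeff-small : ∀ r {n} → suc r ℕ.≤ n → coeff n ≤ inv (ι (suc r))
    coeff-small r {n} r<n = cancel-≤ (0<ι r) (≤-trans (ℚₚ.*-monoʳ-≤-nonNeg (coeff n) {{nonNegative (<⇒≤ (coeff>0 n))}} (ι-mono r<n))
      (≤-trans (ι*coeff≤1 n) (≤-reflexive (sym (*-inv⁺ (0<ι r))))))

    -- The first r + 1 coefficients are at most 1, all others at most 1/(r + 1). After
    -- multiplication by ε the sum becomes small by choosing r large and then ε small.
    coeff-sum≤ : ∀ r n → coeff-sum n ≤ ι (suc r) + inv (ι (suc r)) * S₀ n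
    coeff-sum≤ r = go
      where
        R i : ℚ
        R = ι (suc r)
        i = inv R
        0≤i : 0ℚ ≤ i
        0≤i = <⇒≤ (inv-pos (0<ι r))
        early : ∀ n → coeff-sum n ≤ ι n
        early zero = ≤-refl
        early (suc n) = ≤-trans (ℚₚ.+-mono-≤ (early n) (*-mono (<⇒≤ (coeff>0 n)) 0≤1 (coeff≤1 n) (^-≤1 n 0≤z z≤1)))
          (≤-reflexive (trans (ℚₚ.+-comm (ι n) 1ℚ) (sym (ι-suc n))))
        go : ∀ n → coeff-sum n ≤ R + i * S₀ n
        go zero = ≤-trans (0≤ι (suc r)) (≤-reflexive (lemma R i))
          where
            lemma : ∀ R i → R ≡ R + i * 0ℚ
            lemma = solve-∀ ringℚ
        go (suc n) with ℕₚ.≤-total (suc n) (suc r)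
        ... | inj₁ n<r = ≤-trans (early (suc n)) (≤-trans (ι-mono n<r) (≤-by (i * S₀ (suc n)) (*-nonNeg 0≤i (0≤S₀ (suc n))) refl))
        ... | inj₂ r≤n with ℕₚ.m≤n⇒m<n∨m≡n r≤n
        ...   | inj₁ (ℕ.s≤s r<n) = ≤-trans (ℚₚ.+-mono-≤ (go n) (ℚₚ.*-monoʳ-≤-nonNeg (z ^ n) {{nonNegative (0≤z^ n)}} (coeff-small r r<n)))
                    (≤-reflexive (lemma R i (S₀ n) (z ^ n)))
          where
            lemma : ∀ R i s x → R + i * s + i * x ≡ R + i * (s + x)
            lemma = solve-∀ ringℚ
        ...   | inj₂ refl = ≤-trans (early (suc n)) (≤-by (i * S₀ (suc n)) (*-nonNeg 0≤i (0≤S₀ (suc n))) refl)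

  module _ (k : ℚ) (¾≤k : ℤ.+ 3 / 4 ≤ k) (k<1 : k < 1ℚ) where

    private
      ε w δ : ℚ
      ε = 1ℚ - k
      w = inv k
      δ = 1ℚ - y k
      0≤ε : 0ℚ ≤ ε
      0≤ε = difference≥0 (<⇒≤ k<1)
      0<k : 0ℚ < k
      0<k = ℚₚ.<-≤-trans (ℚₚ.positive⁻¹ (ℤ.+ 3 / 4)) ¾≤k
      0≤4k-3 : 0ℚ ≤ ι 4 * k - ι 3
      0≤4k-3 = subst (0ℚ ≤_) (lemma k) (*-nonNeg (0≤ι 4) (difference≥0 ¾≤k))
        where
          lemma : ∀ k → ι 4 * (k - ℤ.+ 3 / 4) ≡ ι 4 * k - ι 3
          lemma = solve-∀ ringℚ
      kw : k * w ≡ 1ℚ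
      kw = *-inv⁺ 0<k
      0≤w : 0ℚ ≤ w
      0≤w = <⇒≤ (inv-pos 0<k)
      0<4k : 0ℚ < ι 4 * k
      0<4k = *-pos {ι 4} (0<ι 3) 0<k

      w≤2 : w ≤ ι 2
      w≤2 = cancel-≤ 0<4k (≤-by (ι 2 * (ι 4 * k - ι 3) + ι 2) (+-nonNeg (*-nonNeg (0≤ι 2) 0≤4k-3) (0≤ι 2)) (modulo kw (lemma k w)))
        where
          lemma : ∀ k w → ι 4 * k * w + (ι 2 * (ι 4 * k - ι 3) + ι 2) ≡ ι 4 * k * ι 2 + (k * w - 1ℚ) * ι 4
          lemma = solve-∀ ringℚ

      ε≤1-ζ : ε ≤ 1ℚ - ζ k
      ε≤1-ζ = cancel-≤ 0<4k (≤-by ((1ℚ - k) * (k * (ι 4 * k - ι 3) + ι 4 * k - 1ℚ))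
        (*-nonNeg 0≤ε (subst (0ℚ ≤_) (lemma₀ k) (+-nonNeg (*-nonNeg (<⇒≤ 0<k) 0≤4k-3) (+-nonNeg 0≤4k-3 (0≤ι 2))))
        ) (sym (modulo (4kζ k kw) (lemma k (ζ k)))))
        where
          lemma₀ : ∀ k → k * (ι 4 * k - ι 3) + (ι 4 * k - ι 3 + ι 2) ≡ k * (ι 4 * k - ι 3) + ι 4 * k - 1ℚ
          lemma₀ = solve-∀ ringℚ
          lemma : ∀ k z → ι 4 * k * (1ℚ - z) ≡ ι 4 * k * (1ℚ - k) + (1ℚ - k) * (k * (ι 4 * k - ι 3) + ι 4 * k - 1ℚ)
            + (ι 4 * (k * z) - (1ℚ + k) * (ι 4 * k * k - ι 3 * k + 1ℚ)) * - 1ℚ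
          lemma = solve-∀ ringℚ

      1-ζ≤2ε : 1ℚ - ζ k ≤ ι 2 * ε
      1-ζ≤2ε = cancel-≤ 0<4k (≤-by ((1ℚ - k) * ((1ℚ - k) * (ι 4 * k + 1ℚ)))
        (*-nonNeg 0≤ε (*-nonNeg 0≤ε (+-nonNeg (<⇒≤ 0<4k) 0≤1))) (modulo (4kζ k kw) (lemma k (ζ k))))
        where
          lemma : ∀ k z → ι 4 * k * (1ℚ - z) + (1ℚ - k) * ((1ℚ - k) * (ι 4 * k + 1ℚ)) ≡ ι 4 * k * (ι 2 * (1ℚ - k))
            + (ι 4 * (k * z) - (1ℚ + k) * (ι 4 * k * k - ι 3 * k + 1ℚ)) * - 1ℚ
          lemma = solve-∀ ringℚ

      δ≤2ε³ : δ ≤ ι 2 * (ε * ε * ε)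
      δ≤2ε³ = ≤-trans (≤-reflexive (1-y k 0<k k<1)) (≤-trans
        (*-monoˡ (*-nonNeg (0≤ι 2) (*-nonNeg (*-nonNeg 0≤ε 0≤ε) 0≤ε)) inv≤1) (≤-reflexive (ℚₚ.*-identityʳ (ι 2 * (ε * ε * ε)))))
        where
          1≤Q : 1ℚ ≤ Q k
          1≤Q = ≤-by (k * (ι 4 * k - ι 3)) (*-nonNeg (<⇒≤ 0<k) 0≤4k-3) (lemma k)
            where
              lemma : ∀ k → 1ℚ + k * (ι 4 * k - ι 3) ≡ ι 4 * k * k - ι 3 * k + 1ℚ
              lemma = solve-∀ ringℚ
          inv≤1 : inv (Q k) ≤ 1ℚ
          inv≤1 = cancel-≤ (0<Q 0<k) (≤-trans (≤-reflexive (*-inv⁺ (0<Q 0<k))) (≤-trans 1≤Q (≤-reflexive (sym (ℚₚ.*-identityʳ (Q k))))))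

      0≤δ : 0ℚ ≤ δ
      0≤δ = <⇒≤ (0<1-y k 0<k k<1)

      P P⁻ : ℕ → ℚ
      P = leg (y k) 1ℚ
      P⁻ = leg⁻ (y k) 1ℚ

    open Geometric (ζ k) ε (<⇒≤ (ζ>0 k 0<k k<1)) 0≤ε ε≤1-ζ

    module _ (l : ℕ) where

      private
        v : ℚ
        v = V l

        -- Three errors, in order: n aₙ v Pₙ replaced by 1; the excess of the linear coefficient 2(2
        -- - k²) - 2(2k - 1) over 4(1 - ζ), which equals ε²(1 + 2k)/k; and the constant part of the
        -- summand together with the replacement of Pₙ₋₁ by Pₙ.
        deviation : ℕ → ℚ
        deviation n = ι 4 * (1ℚ - ζ k) * (ι n * coeff n * v * (P n - 1ℚ) + (ι n * coeff n * v - 1ℚ))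
          + ε * ε * ((1ℚ + ι 2 * k) * w) * (ι n * coeff n * v * P n)
          + v * (coeff n * ((1ℚ - k * k) * P n + ι 2 * (ι 2 * k - 1ℚ) * (ι n * (P n - P⁻ n))))

        term-deviation : ∀ n → term k n * v - ι 4 * (1ℚ - ζ k) * ζ k ^ n ≡ ζ k ^ n * deviation n
        term-deviation n = trans
          (cong₂ (λ s t → coeff n * ((ι 2 * (ι 2 - k * k) * ι n + (1ℚ - k * k)) * s - ι 2 * (ι 2 * k - 1ℚ) * (ι n * t)) * v - ι 4 * (1ℚ - ζ k) * ζ k ^ n)
            (p≡ζⁿP k 0<k k<1 n) (ζp⁻≡ζⁿP⁻ k 0<k k<1 n))
          (modulo kw (lemma k w (ι n) (coeff n) v (ζ k ^ n) (P n) (P⁻ n)))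
          where
            lemma : ∀ k w n a v x p q → let z = ¼ * (ι 4 * k * k + k - ι 2 + w) in
              a * ((ι 2 * (ι 2 - k * k) * n + (1ℚ - k * k)) * (x * p) - ι 2 * (ι 2 * k - 1ℚ) * (n * (x * q))) * v - ι 4 * (1ℚ - z) * x ≡
              x * (ι 4 * (1ℚ - z) * (n * a * v * (p - 1ℚ) + (n * a * v - 1ℚ))
                + (1ℚ - k) * (1ℚ - k) * ((1ℚ + ι 2 * k) * w) * (n * a * v * p)
                + v * (a * ((1ℚ - k * k) * p + ι 2 * (ι 2 * k - 1ℚ) * (n * (p - q)))))
              + (k * w - 1ℚ) * (x * n * a * v * p * (ι 3 * k - ι 2 * k * k))
            lemma = solve-∀ ringℚ

        -- The bound `deviation≤` multiplied by ζⁿ and sorted by the power of n. The constant 24 is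
        -- 4·2·2 from `∣c-1∣≤2a` plus 4·2 from the term with 1 - k².
        majorant : ℕ → ℚ
        majorant n = ι 24 * ε * (coeff n * ζ k ^ n) + ι 16 * (ε * (ε * (ε * ε))) * (ι n * ι n * ζ k ^ n)
          + ι 16 * (ε * (ε * ε)) * (ι n * ζ k ^ n) + ι 4 * (ε * ε) * ζ k ^ n

        0≤v : 0ℚ ≤ v
        0≤v = <⇒≤ (V>0 l)

        ε³ : ℚ
        -- Twice the cube, so that it bounds δ by `δ≤2ε³`.
        ε³ = ι 2 * (ε * ε * ε)

        module _ (n : ℕ) (n≤l : n ℕ.≤ l) where

          a c E : ℚ
          a = coeff n
          c = ι n * a * v
          E = ι n * (P n - P⁻ n)

          0≤a : 0ℚ ≤ a
          0≤a = <⇒≤ (coeff>0 n)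

          ∣P∣≤1 : ∣ P n ∣ ≤ 1ℚ
          ∣P∣≤1 = ∣leg∣≤1 (y k) (0<1-y² k 0<k k<1) n

          δn²≤ : δ * (ι n * ι n) ≤ ε³ * (ι n * ι n)
          δn²≤ = ℚₚ.*-monoʳ-≤-nonNeg (ι n * ι n) {{nonNegative (square-nonNeg (ι n))}} δ≤2ε³

          ∣c∣≤1 : ∣ c ∣ ≤ 1ℚ
          ∣c∣≤1 = ≤-trans (∣≥0∣ (*-nonNeg (*-nonNeg (0≤ι n) 0≤a) 0≤v)) (ι*coeff*V≤1 n≤l)

          -- The lower Wallis bound gives 1 - n aₙ v ≤ ½ aₙ v, and v ≤ 4.
          ∣c-1∣≤2a : ∣ c - 1ℚ ∣ ≤ ι 2 * a
          ∣c-1∣≤2a = ≤-trans (≤-reflexive (∣p-q∣≡∣q-p∣ c 1ℚ)) (≤-trans (∣≥0∣ (difference≥0 (ι*coeff*V≤1 n≤l)))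
            (≤-by (½ * ((ι 2 * ι n + 1ℚ) * a * v - ι 2) + ½ * (a * (ι 4 - v)))
              (+-nonNeg (*-nonNeg (<⇒≤ (ℚₚ.positive⁻¹ ½)) (difference≥0 (2≤[2ι+1]*coeff*V n≤l)))
                (*-nonNeg (<⇒≤ (ℚₚ.positive⁻¹ ½)) (*-nonNeg 0≤a (difference≥0 (V≤4 l))))) (lemma (ι n) a v)))
            where
              lemma : ∀ n a v → 1ℚ - n * a * v + (½ * ((ι 2 * n + 1ℚ) * a * v - ι 2) + ½ * (a * (ι 4 - v))) ≡ ι 2 * a
              lemma = solve-∀ ringℚ

          ∣aE∣≤ : ∣ a * E ∣ ≤ ε³ * ι n
          ∣aE∣≤ = ≤-trans (∣*∣≤ (∣≥0∣ 0≤a) (≤-trans (∣increment∣ (y k) (0<1-y² k 0<k k<1) 0≤δ n) δn²≤))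
            (≤-trans (≤-reflexive (lemma a ε³ (ι n))) (≤-trans (*-monoˡ (*-nonNeg 0≤ε³ (0≤ι n)) (ι*coeff≤1 n)) (≤-reflexive (ℚₚ.*-identityʳ (ε³ * ι n)))))
            where
              0≤ε³ : 0ℚ ≤ ε³
              0≤ε³ = *-nonNeg (0≤ι 2) (*-nonNeg (*-nonNeg 0≤ε 0≤ε) 0≤ε)
              lemma : ∀ a e n → a * (e * (n * n)) ≡ e * n * (n * a)
              lemma = solve-∀ ringℚ

          ∣4[1-ζ]∣≤ : ∣ ι 4 * (1ℚ - ζ k) ∣ ≤ ι 4 * (ι 2 * ε)
          ∣4[1-ζ]∣≤ = ≤-trans (∣≥0∣ (*-nonNeg (0≤ι 4) (≤-trans 0≤ε ε≤1-ζ))) (*-monoˡ (0≤ι 4) 1-ζ≤2ε)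

          ∣[1+2k]w∣≤4 : ∣ (1ℚ + ι 2 * k) * w ∣ ≤ ι 4
          ∣[1+2k]w∣≤4 = ≤-trans (∣≥0∣ (*-nonNeg (+-nonNeg 0≤1 (*-nonNeg (0≤ι 2) (<⇒≤ 0<k))) 0≤w))
            (≤-by (ι 2 - w) (difference≥0 w≤2) (modulo kw (lemma k w)))
            where
              lemma : ∀ k w → (1ℚ + ι 2 * k) * w + (ι 2 - w) ≡ ι 4 + (k * w - 1ℚ) * ι 2
              lemma = solve-∀ ringℚ

          ∣1-k²∣≤ : ∣ 1ℚ - k * k ∣ ≤ ι 2 * ε
          ∣1-k²∣≤ = subst (λ t → ∣ t ∣ ≤ ι 2 * ε) (lemma k)
            (∣*∣≤ (≤-trans (∣≥0∣ (+-nonNeg 0≤1 (<⇒≤ 0<k))) (ℚₚ.+-monoʳ-≤ 1ℚ (<⇒≤ k<1))) (∣≥0∣ 0≤ε))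
            where
              lemma : ∀ k → (1ℚ + k) * (1ℚ - k) ≡ 1ℚ - k * k
              lemma = solve-∀ ringℚ

          ∣2[2k-1]∣≤2 : ∣ ι 2 * (ι 2 * k - 1ℚ) ∣ ≤ ι 2
          ∣2[2k-1]∣≤2 = ≤-trans (∣≥0∣ (subst (0ℚ ≤_) (lemma₁ k) (+-nonNeg 0≤4k-3 0≤1)))
            (≤-by (ι 4 * (1ℚ - k)) (*-nonNeg (0≤ι 4) 0≤ε) (lemma₂ k))
            where
              lemma₁ : ∀ k → ι 4 * k - ι 3 + 1ℚ ≡ ι 2 * (ι 2 * k - 1ℚ)
              lemma₁ = solve-∀ ringℚ
              lemma₂ : ∀ k → ι 2 * (ι 2 * k - 1ℚ) + ι 4 * (1ℚ - k) ≡ ι 2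
              lemma₂ = solve-∀ ringℚ

          ∣v∣≤4 : ∣ v ∣ ≤ ι 4
          ∣v∣≤4 = ≤-trans (∣≥0∣ 0≤v) (V≤4 l)

          deviation≤ : ∣ deviation n ∣ ≤ ι 4 * (ι 2 * ε) * (1ℚ * (ε³ * (ι n * ι n)) + ι 2 * a)
            + ε * ε * ι 4 * (1ℚ * 1ℚ) + (ι 4 * (a * (ι 2 * ε * 1ℚ)) + ι 4 * (ι 2 * (ε³ * ι n)))
          deviation≤ = ∣+∣≤ (∣+∣≤
              (∣*∣≤ ∣4[1-ζ]∣≤ (∣+∣≤ (∣*∣≤ ∣c∣≤1 (≤-trans (∣leg-1∣ (y k) (0<1-y² k 0<k k<1) 0≤δ n) δn²≤)) ∣c-1∣≤2a))
              (∣*∣≤ (∣*∣≤ (∣≥0∣ (square-nonNeg ε)) ∣[1+2k]w∣≤4) (∣*∣≤ ∣c∣≤1 ∣P∣≤1)))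
            (subst (λ t → ∣ t ∣ ≤ ι 4 * (a * (ι 2 * ε * 1ℚ)) + ι 4 * (ι 2 * (ε³ * ι n))) (lemma v a ((1ℚ - k * k) * P n) (ι 2 * (ι 2 * k - 1ℚ)) E)
              (∣+∣≤ (∣*∣≤ ∣v∣≤4 (∣*∣≤ (∣≥0∣ 0≤a) (∣*∣≤ ∣1-k²∣≤ ∣P∣≤1))) (∣*∣≤ ∣v∣≤4 (∣*∣≤ ∣2[2k-1]∣≤2 ∣aE∣≤))))
            where
              lemma : ∀ v a x b e → v * (a * x) + v * (b * (a * e)) ≡ v * (a * (x + b * e))
              lemma = solve-∀ ringℚ

          term-deviation≤ : ∣ term k n * v - ι 4 * (1ℚ - ζ k) * ζ k ^ n ∣ ≤ majorant n
          term-deviation≤ = subst₂ _≤_ (cong ∣_∣ (sym (term-deviation n))) (lemma ε (ι n) a (ζ k ^ n))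
            (∣*∣≤ (∣≥0∣ (^-nonNeg n (<⇒≤ (ζ>0 k 0<k k<1)))) deviation≤)
            where
              lemma : ∀ e n a x → x * (ι 4 * (ι 2 * e) * (1ℚ * (ι 2 * (e * e * e) * (n * n)) + ι 2 * a)
                + e * e * ι 4 * (1ℚ * 1ℚ) + (ι 4 * (a * (ι 2 * e * 1ℚ)) + ι 4 * (ι 2 * (ι 2 * (e * e * e) * n)))) ≡
                ι 24 * e * (a * x) + ι 16 * (e * (e * (e * e))) * (n * n * x) + ι 16 * (e * (e * e)) * (n * x) + ι 4 * (e * e) * x
              lemma = solve-∀ ringℚ

        sum-majorant : ∀ n → sum majorant n ≡ ι 24 * ε * coeff-sum n + ι 16 * (ε * (ε * (ε * ε))) * S₂ n + ι 16 * (ε * (ε * ε)) * S₁ n + ι 4 * (ε * ε) * S₀ n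
        sum-majorant zero = lemma (ι 24 * ε) (ι 16 * (ε * (ε * (ε * ε)))) (ι 16 * (ε * (ε * ε))) (ι 4 * (ε * ε))
          where
            lemma : ∀ a b c d → 0ℚ ≡ a * 0ℚ + b * 0ℚ + c * 0ℚ + d * 0ℚ
            lemma = solve-∀ ringℚ
        sum-majorant (suc n) = trans (cong (_+ majorant n) (sum-majorant n))
          (lemma (ι 24 * ε) (ι 16 * (ε * (ε * (ε * ε)))) (ι 16 * (ε * (ε * ε))) (ι 4 * (ε * ε))
            (coeff-sum n) (S₂ n) (S₁ n) (S₀ n) (coeff n * ζ k ^ n) (ι n * ι n * ζ k ^ n) (ι n * ζ k ^ n) (ζ k ^ n))
          where
            lemma : ∀ a b c d s t u v s′ t′ u′ v′ → a * s + b * t + c * u + d * v + (a * s′ + b * t′ + c * u′ + d * v′) ≡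
              a * (s + s′) + b * (t + t′) + c * (u + u′) + d * (v + v′)
            lemma = solve-∀ ringℚ

      -- Sums the majorant: 68 = 16·3 + 16 + 4 from the bounds for `S₂`, `S₁` and `S₀`, and the part
      -- with 24 from `coeff-sum≤`. The term 4ζⁿ is the missing tail in 4(1 - ζ) `S₀ n` = 4 - 4ζⁿ.
      -- Only indices below n occur, so n ≤ l + 1 keeps them within reach of `V l`.
      near-one : ∀ r n → n ℕ.≤ suc l →
        ∣ M k n * v - ι 4 ∣ ≤ ι 68 * ε + ι 24 * (ε * ι (suc r) + inv (ι (suc r))) + ι 4 * ζ k ^ n
      near-one r n n≤1+l = subst (λ t → ∣ t ∣ ≤ ι 68 * ε + ι 24 * (ε * ι (suc r) + inv (ι (suc r))) + ι 4 * ζ k ^ n)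
          (trans (cong (_+ - (ι 4 * ζ k ^ n)) sum-deviation) (modulo (S₀-closed n) (lemma (M k n * v) (ζ k) (S₀ n) (ζ k ^ n))))
          (∣+∣≤ (≤-trans (sum-abs n λ i i<n → term-deviation≤ i (ℕₚ.≤-pred (ℕₚ.≤-trans i<n n≤1+l))) majorised)
            (∣-∣≤ (∣≥0∣ (*-nonNeg (0≤ι 4) (^-nonNeg n (<⇒≤ (ζ>0 k 0<k k<1)))))))
        where
          sum-deviation : sum (λ n → term k n * v - ι 4 * (1ℚ - ζ k) * ζ k ^ n) n ≡ M k n * v - ι 4 * (1ℚ - ζ k) * S₀ n
          sum-deviation = go n
            where
              go : ∀ n → sum (λ n → term k n * v - ι 4 * (1ℚ - ζ k) * ζ k ^ n) n ≡ M k n * v - ι 4 * (1ℚ - ζ k) * S₀ n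
              go zero = lemma₀ v (ι 4 * (1ℚ - ζ k))
                where
                  lemma₀ : ∀ v c → 0ℚ ≡ 0ℚ * v - c * 0ℚ
                  lemma₀ = solve-∀ ringℚ
              go (suc n) = trans (cong (_+ (term k n * v - ι 4 * (1ℚ - ζ k) * ζ k ^ n)) (go n)) (lemma₁ (M k n) v (ι 4 * (1ℚ - ζ k)) (S₀ n) (term k n) (ζ k ^ n))
                where
                  lemma₁ : ∀ m v c s t x → m * v - c * s + (t * v - c * x) ≡ (m + t) * v - c * (s + x)
                  lemma₁ = solve-∀ ringℚ
          lemma : ∀ m z s x → m - ι 4 * (1ℚ - z) * s + - (ι 4 * x) ≡ m - ι 4 + ((1ℚ - z) * s + x - 1ℚ) * - ι 4
          lemma = solve-∀ ringℚ
          R i : ℚ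
          R = ι (suc r)
          i = inv R
          majorised : sum majorant n ≤ ι 68 * ε + ι 24 * (ε * R + i)
          majorised = ≤-trans (≤-reflexive (trans (sum-majorant n) (lemma₁ ε (coeff-sum n) (S₂ n) (S₁ n) (S₀ n))))
            (≤-trans (ℚₚ.+-mono-≤ (*-monoˡ (0≤ι 24) coeff-part) (ℚₚ.+-mono-≤ (ℚₚ.+-mono-≤
                (*-monoˡ 0≤16ε (≤-trans (S₂-bound n) (ℚₚ.+-monoʳ-≤ (ι 2) ε≤1))) (*-monoˡ 0≤16ε (S₁-bound n))) (*-monoˡ 0≤4ε (S₀-bound n))))
              (≤-reflexive (lemma₂ ε (ε * R + i))))
            where
              0≤16ε : 0ℚ ≤ ι 16 * ε
              0≤16ε = *-nonNeg (0≤ι 16) 0≤ε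
              0≤4ε : 0ℚ ≤ ι 4 * ε
              0≤4ε = *-nonNeg (0≤ι 4) 0≤ε
              ε≤1 : ε ≤ 1ℚ
              ε≤1 = ≤-by k (<⇒≤ 0<k) (lemma₃ k)
                where
                  lemma₃ : ∀ k → 1ℚ - k + k ≡ 1ℚ
                  lemma₃ = solve-∀ ringℚ
              coeff-part : ε * coeff-sum n ≤ ε * R + i
              coeff-part = ≤-trans (*-monoˡ 0≤ε (coeff-sum≤ r n)) (≤-trans (≤-reflexive (lemma₄ ε R i (S₀ n)))
                (≤-trans (ℚₚ.+-monoʳ-≤ (ε * R) (*-monoˡ (<⇒≤ (inv-pos (0<ι r))) (S₀-bound n))) (≤-reflexive (cong (ε * R +_) (ℚₚ.*-identityʳ i)))))
                where
                  lemma₄ : ∀ e R i s → e * (R + i * s) ≡ e * R + i * (e * s)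
                  lemma₄ = solve-∀ ringℚ
              lemma₁ : ∀ e a s t u → ι 24 * e * a + ι 16 * (e * (e * (e * e))) * s + ι 16 * (e * (e * e)) * t + ι 4 * (e * e) * u ≡
                ι 24 * (e * a) + (ι 16 * e * (e * (e * (e * s))) + ι 16 * e * (e * (e * t)) + ι 4 * e * (e * u))
              lemma₁ = solve-∀ ringℚ
              lemma₂ : ∀ e x → ι 24 * x + (ι 16 * e * (ι 2 + 1ℚ) + ι 16 * e * 1ℚ + ι 4 * e * 1ℚ) ≡ ι 68 * e + ι 24 * x
              lemma₂ = solve-∀ ringℚ

  -- Exponential decay, and the limit of the reduced series

  ^-mono : ∀ {x y} n → 0ℚ ≤ x → x ≤ y → x ^ n ≤ y ^ n
  ^-mono zero _ _ = ≤-refl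
  ^-mono (suc n) 0≤x x≤y = *-mono 0≤x (^-nonNeg n (≤-trans 0≤x x≤y)) x≤y (^-mono n 0≤x x≤y)

  ^-square : ∀ x n → (x * x) ^ n ≡ x ^ n * x ^ n
  ^-square x zero = refl
  ^-square x (suc n) = trans (cong (x * x *_) (^-square x n)) (lemma x (x ^ n))
    where
      lemma : ∀ x y → x * x * (y * y) ≡ x * y * (x * y)
      lemma = solve-∀ ringℚ

  0≤½ : 0ℚ ≤ ½
  0≤½ = <⇒≤ (ℚₚ.positive⁻¹ ½)

  0≤¼ : 0ℚ ≤ ¼
  0≤¼ = <⇒≤ (ℚₚ.positive⁻¹ ¼)

  inv-small : ∀ ρ → 0ℚ < ρ → ∃[ N ] ∀ n → N ℕ.≤ n → inv (ι (suc n)) ≤ ρ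
  inv-small ρ 0<ρ = proj₁ big , λ n N≤n → cancel-≤ (0<ι n) (≤-trans (≤-reflexive (*-inv⁺ (0<ι n)))
      (≤-trans (≤-reflexive (sym (trans (ℚₚ.*-comm (inv ρ) ρ) (*-inv⁺ 0<ρ))))
        (ℚₚ.*-monoʳ-≤-nonNeg ρ {{nonNegative (<⇒≤ 0<ρ)}} (≤-trans (proj₂ big) (ι-mono (ℕₚ.m≤n⇒m≤1+n N≤n))))))
    where
      big : ∃[ N ] inv ρ ≤ ι N
      big = archimedean (inv ρ)

  module Decay (θ : ℚ) (0≤θ : 0ℚ ≤ θ) (θ<1 : θ < 1ℚ) where

    midpoint : ℚ → ℚ
    midpoint x = ½ * (1ℚ + x)

    private
      module _ {x : ℚ} (0≤x : 0ℚ ≤ x) (x<1 : x < 1ℚ) where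

        0≤midpoint : 0ℚ ≤ midpoint x
        0≤midpoint = *-nonNeg 0≤½ (+-nonNeg 0≤1 0≤x)

        midpoint<1 : midpoint x < 1ℚ
        midpoint<1 = ℚₚ.*-monoʳ-<-pos ½ (ℚₚ.+-monoʳ-< 1ℚ x<1)

        -- AM-GM for 1 and x
        x^n≤ : ∀ n → x ^ n ≤ midpoint x ^ n * midpoint x ^ n
        x^n≤ n = ≤-trans (^-mono n 0≤x (≤-by _ (square-nonNeg (½ * (1ℚ - x))) (lemma x))) (≤-reflexive (^-square (midpoint x) n))
          where
            lemma : ∀ x → x + ½ * (1ℚ - x) * (½ * (1ℚ - x)) ≡ ½ * (1ℚ + x) * (½ * (1ℚ + x))
            lemma = solve-∀ ringℚ

      φ ψ c : ℚ
      φ = midpoint θ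
      ψ = midpoint φ
      c = 1ℚ - ψ

      0≤φ : 0ℚ ≤ φ
      0≤φ = 0≤midpoint 0≤θ θ<1
      φ<1 : φ < 1ℚ
      φ<1 = midpoint<1 0≤θ θ<1
      0≤ψ : 0ℚ ≤ ψ
      0≤ψ = 0≤midpoint 0≤φ φ<1
      0<c : 0ℚ < c
      0<c = difference>0 (midpoint<1 0≤φ φ<1)

      open Geometric ψ c 0≤ψ (<⇒≤ 0<c) ≤-refl

      linear : ∀ n → ι n * ψ ^ n ≤ inv c
      linear n = cancel-≤ 0<c (≤-trans (*-monoˡ (<⇒≤ 0<c) (≤-by (c * S₁ n) (*-nonNeg (<⇒≤ 0<c) 0≤S₁)
          (trans (ℚₚ.+-comm (ι n * ψ ^ n) (c * S₁ n)) (S₁-closed n))))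
        (≤-trans (*-monoˡ (<⇒≤ 0<c) ψS₀≤S₀) (≤-trans (S₀-bound n) (≤-reflexive (sym (*-inv⁺ 0<c))))))
        where
          0≤S₁ : 0ℚ ≤ S₁ n
          0≤S₁ = sum-nonNeg (λ n → *-nonNeg (0≤ι n) (^-nonNeg n 0≤ψ)) n
          ψS₀≤S₀ : ψ * S₀ n ≤ S₀ n
          ψS₀≤S₀ = ≤-by (c * S₀ n) (*-nonNeg (<⇒≤ 0<c) (sum-nonNeg (λ n → ^-nonNeg n 0≤ψ) n)) (lemma ψ (S₀ n))
            where
              lemma : ∀ z s → z * s + (1ℚ - z) * s ≡ s
              lemma = solve-∀ ringℚ

      B : ℚ
      B = (inv c * inv c) * (inv c * inv c)

      -- Two uses of AM-GM give θ ≤ ψ⁴ with ψ < 1, so n⁴ θⁿ ≤ (n ψⁿ)⁴, and `linear` bounds n ψⁿ. The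
      -- fourth factor n is the one that `cubic-decay` divides by.
      quartic : ∀ n → ι n * (ι n * ι n * ι n * θ ^ n) ≤ B
      quartic n = ≤-trans (*-monoˡ (0≤ι n) (*-monoˡ (*-nonNeg (*-nonNeg (0≤ι n) (0≤ι n)) (0≤ι n))
          (≤-trans (x^n≤ 0≤θ θ<1 n) (*-mono (^-nonNeg n 0≤φ) (*-nonNeg (^-nonNeg n 0≤ψ) (^-nonNeg n 0≤ψ)) (x^n≤ 0≤φ φ<1 n) (x^n≤ 0≤φ φ<1 n)))))
        (≤-trans (≤-reflexive (lemma (ι n) (ψ ^ n))) (*-mono 0≤ll 0≤ii ll≤ii ll≤ii))
        where
          lemma : ∀ n x → n * (n * n * n * (x * x * (x * x))) ≡ n * x * (n * x) * (n * x * (n * x))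
          lemma = solve-∀ ringℚ
          0≤l : 0ℚ ≤ ι n * ψ ^ n
          0≤l = *-nonNeg (0≤ι n) (^-nonNeg n 0≤ψ)
          0≤ll : 0ℚ ≤ ι n * ψ ^ n * (ι n * ψ ^ n)
          0≤ll = *-nonNeg 0≤l 0≤l
          0≤ii : 0ℚ ≤ inv c * inv c
          0≤ii = square-nonNeg (inv c)
          ll≤ii : ι n * ψ ^ n * (ι n * ψ ^ n) ≤ inv c * inv c
          ll≤ii = *-mono 0≤l (<⇒≤ (inv-pos 0<c)) (linear n) (linear n)

    cubic-decay : ∀ ε → 0ℚ < ε → ∃[ N ] ∀ n → N ℕ.≤ n → ι n * ι n * ι n * θ ^ n ≤ ε
    cubic-decay ε 0<ε = suc (proj₁ big) , λ n N≤n → cancel-≤ (0<ι (proj₁ big))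
        (≤-trans (ℚₚ.*-monoʳ-≤-nonNeg (ι n * ι n * ι n * θ ^ n) {{nonNegative (*-nonNeg (*-nonNeg (*-nonNeg (0≤ι n) (0≤ι n)) (0≤ι n)) (^-nonNeg n 0≤θ))}} (ι-mono N≤n))
          (≤-trans (quartic n) (≤-trans (≤-reflexive (sym B/ε*ε)) (ℚₚ.*-monoʳ-≤-nonNeg ε {{nonNegative (<⇒≤ 0<ε)}}
            (≤-trans (proj₂ big) (ι-mono (ℕₚ.n≤1+n (proj₁ big))))))))
      where
        big : ∃[ N ] B * inv ε ≤ ι N
        big = archimedean (B * inv ε)
        B/ε*ε : B * inv ε * ε ≡ B
        B/ε*ε = modulo (*-inv⁺ 0<ε) (lemma B ε (inv ε))
          where
            lemma : ∀ b e i → b * i * e ≡ b + (e * i - 1ℚ) * b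
            lemma = solve-∀ ringℚ

  -- For 0 < k < 1, positive exactly when |ζ k| < 1; its positive root is (√41 - 5)/8.
  ω : ℚ → ℚ
  ω k = ι 4 * k * k + ι 5 * k - 1ℚ

  ω-mono : ∀ {k k′} → 0ℚ ≤ k → k ≤ k′ → ω k ≤ ω k′
  ω-mono {k} {k′} 0≤k k≤k′ = ≤-by ((k′ - k) * (ι 4 * (k + k′) + ι 5))
    (*-nonNeg (difference≥0 k≤k′) (+-nonNeg (*-nonNeg (0≤ι 4) (+-nonNeg 0≤k (≤-trans 0≤k k≤k′))) (0≤ι 5))) (lemma k k′)
    where
      lemma : ∀ k k′ → ι 4 * k * k + ι 5 * k - 1ℚ + (k′ - k) * (ι 4 * (k + k′) + ι 5) ≡ ι 4 * k′ * k′ + ι 5 * k′ - 1ℚ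
      lemma = solve-∀ ringℚ

  module _ {k : ℚ} (0<k : 0ℚ < k) (k≤1 : k ≤ 1ℚ) where

    -- Rests on 4k(1 - ζ) = (1 - k) ω and k ≤ 1.
    ζ≤ : ∀ {η u} → 0ℚ ≤ η → η ≤ ω k → 0ℚ ≤ u → u ≤ 1ℚ - k → ζ k ≤ 1ℚ - ¼ * (η * u)
    ζ≤ {η} {u} 0≤η η≤ω 0≤u u≤1-k = cancel-≤ (*-pos {ι 4} {k} (0<ι 3) 0<k) (≤-by ((1ℚ - k) * ω k - k * (η * u))
        (difference≥0 (≤-trans (≤-trans (ℚₚ.*-monoʳ-≤-nonNeg (η * u) {{nonNegative 0≤ηu}} k≤1) (≤-reflexive (lemma₁ η u)))
          (*-mono 0≤u (≤-trans 0≤η η≤ω) u≤1-k η≤ω)))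
        (modulo (4kζ k (*-inv⁺ 0<k)) (lemma₂ k (ζ k) (η * u))))
      where
        0≤ηu : 0ℚ ≤ η * u
        0≤ηu = *-nonNeg 0≤η 0≤u
        lemma₁ : ∀ η u → 1ℚ * (η * u) ≡ u * η
        lemma₁ = solve-∀ ringℚ
        lemma₂ : ∀ k z x → ι 4 * k * z + ((1ℚ - k) * (ι 4 * k * k + ι 5 * k - 1ℚ) - k * x) ≡
          ι 4 * k * (1ℚ - ¼ * x) + (ι 4 * (k * z) - (1ℚ + k) * (ι 4 * k * k - ι 3 * k + 1ℚ)) * 1ℚ
        lemma₂ = solve-∀ ringℚ

    -- Keeps k away from 0, so that reciprocals of k and the Lipschitz constants of `M` are
    -- controlled on the region.
    1≤9k : 0ℚ ≤ ω k → 1ℚ ≤ ι 9 * k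
    1≤9k 0≤ω = ≤-by (ω k + ι 4 * (k * (1ℚ - k))) (+-nonNeg 0≤ω (*-nonNeg (0≤ι 4) (*-nonNeg (<⇒≤ 0<k) (difference≥0 k≤1)))) (lemma k)
      where
        lemma : ∀ k → 1ℚ + (ι 4 * k * k + ι 5 * k - 1ℚ + ι 4 * (k * (1ℚ - k))) ≡ ι 9 * k
        lemma = solve-∀ ringℚ

  ⊓-pos : ∀ {p} → 0ℚ < p → 0ℚ < p ⊓ 1ℚ
  ⊓-pos {p} 0<p with ℚₚ.⊓-sel p 1ℚ
  ... | inj₁ e = subst (0ℚ <_) (sym e) 0<p
  ... | inj₂ e = subst (0ℚ <_) (sym e) 0<1

  -- One θ for the whole region, read off from `ζ≤`. Truncating η and u at 1 keeps θ ≥ ½, so that a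
  -- power θⁿ⁻¹ can later be traded for 2θⁿ.
  ζ-contracts : ∀ {η u} → 0ℚ < η → 0ℚ < u →
    ∃[ θ ] ½ ≤ θ × θ < 1ℚ × (∀ {k} → 0ℚ < k → k ≤ 1ℚ → η ≤ ω k → u ≤ 1ℚ - k → ζ k ≤ θ)
  ζ-contracts {η} {u} 0<η 0<u = θ , ½≤θ , θ<1 , λ 0<k k≤1 η≤ω u≤1-k →
      ζ≤ 0<k k≤1 (<⇒≤ (⊓-pos 0<η)) (≤-trans (ℚₚ.p⊓q≤p η 1ℚ) η≤ω) (<⇒≤ (⊓-pos 0<u)) (≤-trans (ℚₚ.p⊓q≤p u 1ℚ) u≤1-k)
    where
      x θ : ℚ
      x = (η ⊓ 1ℚ) * (u ⊓ 1ℚ)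
      θ = 1ℚ - ¼ * x
      x≤1 : x ≤ 1ℚ
      x≤1 = *-mono (<⇒≤ (⊓-pos 0<η)) 0≤1 (ℚₚ.p⊓q≤q η 1ℚ) (ℚₚ.p⊓q≤q u 1ℚ)
      ½≤θ : ½ ≤ θ
      ½≤θ = ≤-by (¼ * (1ℚ - x) + ¼) (+-nonNeg (*-nonNeg 0≤¼ (difference≥0 x≤1)) 0≤¼) (lemma x)
        where
          lemma : ∀ x → ½ + (¼ * (1ℚ - x) + ¼) ≡ 1ℚ - ¼ * x
          lemma = solve-∀ ringℚ
      θ<1 : θ < 1ℚ
      θ<1 = subst (θ <_) (lemma (¼ * x)) (subst (_< θ + ¼ * x) (ℚₚ.+-identityʳ θ) (ℚₚ.+-monoʳ-< θ (*-pos {¼} (ℚₚ.positive⁻¹ ¼) (*-pos (⊓-pos 0<η) (⊓-pos 0<u)))))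
        where
          lemma : ∀ t → 1ℚ - t + t ≡ 1ℚ
          lemma = solve-∀ ringℚ

  -- The front factor is at most 4(3 + 1) = 16. The residue contains `p⁻`, of size ζⁿ⁻¹, and raising
  -- the exponent to n costs the factor 2 permitted by θ ≥ ½.
  ∣residue∣≤ : ∀ {k θ} → 0ℚ < k → k < 1ℚ → ½ ≤ θ → ζ k ≤ θ → ∀ n → ∣ residue k n ∣ ≤ ι 32 * (ι n * ι n * θ ^ n)
  ∣residue∣≤ {k} {θ} 0<k k<1 ½≤θ ζ≤θ zero = ≤-reflexive (trans (cong ∣_∣ (lemma₁ k)) (sym (lemma₂ 1ℚ)))
    where
      lemma₁ : ∀ k → - ι 4 * (ι 3 * k * k + 1ℚ) * (1ℚ * (0ℚ * 0ℚ * 0ℚ)) ≡ 0ℚ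
      lemma₁ = solve-∀ ringℚ
      lemma₂ : ∀ x → ι 32 * (0ℚ * 0ℚ * x) ≡ 0ℚ
      lemma₂ = solve-∀ ringℚ
  ∣residue∣≤ {k} {θ} 0<k k<1 ½≤θ ζ≤θ (suc n) = ≤-trans
    (∣*∣≤ ∣front∣≤ (∣*∣≤ (≤-trans (∣≥0∣ (<⇒≤ (coeff>0 (suc n)))) (coeff≤1 (suc n))) (∣*∣≤ (∣≥0∣ 0≤N²)
      (≤-trans (∣p∣≤ζⁿ k 0<k k<1 n) (^-mono n (<⇒≤ (ζ>0 k 0<k k<1)) ζ≤θ)))))
    (≤-by (ι 16 * (ι (suc n) * ι (suc n) * ((ι 2 * θ - 1ℚ) * θ ^ n)))
      (*-nonNeg (0≤ι 16) (*-nonNeg 0≤N² (*-nonNeg (subst (0ℚ ≤_) (lemma₀ θ) (*-nonNeg (0≤ι 2) (difference≥0 ½≤θ))) (^-nonNeg n (≤-trans 0≤½ ½≤θ)))))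
      (lemma (ι (suc n)) θ (θ ^ n)))
    where
      0≤N² : 0ℚ ≤ ι (suc n) * ι (suc n)
      0≤N² = square-nonNeg (ι (suc n))
      ∣front∣≤ : ∣ - ι 4 * (ι 3 * k * k + 1ℚ) ∣ ≤ ι 4 * (ι 3 * 1ℚ + 1ℚ)
      ∣front∣≤ = ∣*∣≤ (≤-refl {ι 4}) (≤-trans (∣≥0∣ (+-nonNeg (*-nonNeg (*-nonNeg (0≤ι 3) (<⇒≤ 0<k)) (<⇒≤ 0<k)) 0≤1))
        (ℚₚ.+-monoˡ-≤ 1ℚ (≤-trans (≤-reflexive (ℚₚ.*-assoc (ι 3) k k)) (*-monoˡ (0≤ι 3) (<⇒≤ (square<1 (<⇒≤ 0<k) k<1))))))
      lemma₀ : ∀ θ → ι 2 * (θ - ½) ≡ ι 2 * θ - 1ℚ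
      lemma₀ = solve-∀ ringℚ
      lemma : ∀ N θ x → ι 4 * (ι 3 * 1ℚ + 1ℚ) * (1ℚ * (N * N * x)) + ι 16 * (N * N * ((ι 2 * θ - 1ℚ) * x)) ≡ ι 32 * (N * N * (θ * x))
      lemma = solve-∀ ringℚ

  -- The slope of the ratio is exponentially small in n, so by `mean-value` it hardly changes
  -- between q and a base point `q₁` < 1, where `near-one` applies. The base point depends only on ε
  -- and κ; the contraction factor θ and then N are chosen after it, uniformly in q.
  ratio-limit : ∀ η κ → 0ℚ < η → κ < 1ℚ → ∀ ε → 0ℚ < ε →
    ∃[ N ] ∀ n l q → N ℕ.≤ n → n ℕ.≤ suc l → 0ℚ < q → η ≤ ω (q * q) → q * q ≤ κ → ∣ ratio n q * V l - ι 4 ∣ ≤ ε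
  ratio-limit η κ 0<η κ<1 ε 0<ε = suc (proj₁ decay) , estimate
    where
      ρ₁ ρ₂ : ℚ
      -- 424 = 2(68·2 + 24·3 + 4) is the coefficient of `i` in `base`; this half of ε pays for it.
      ρ₁ = ½ * inv (ι 424) * ε
      ρ₂ = ½ * (1ℚ - κ)
      0<1-κ : 0ℚ < 1ℚ - κ
      0<1-κ = difference>0 κ<1
      0<ρ₁ : 0ℚ < ρ₁
      0<ρ₁ = *-pos {½ * inv (ι 424)} (ℚₚ.positive⁻¹ (½ * inv (ι 424))) 0<ε
      0<ρ₂ : 0ℚ < ρ₂
      0<ρ₂ = *-pos {½} (ℚₚ.positive⁻¹ ½) 0<1-κ
      r₁ r₂ r : ℕ
      r₁ = proj₁ (inv-small ρ₁ 0<ρ₁)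
      r₂ = proj₁ (inv-small ρ₂ 0<ρ₂)
      -- The summand 2 ensures `R` ≥ 3, hence 9t ≤ 1 and k₁ ≥ ¾; r₂ ensures κ ≤ k₁.
      r = r₁ ℕ.+ (r₂ ℕ.+ 2)
      R i : ℚ
      R = ι (suc r)
      i = inv R
      i≤ρ₁ : i ≤ ρ₁
      i≤ρ₁ = proj₂ (inv-small ρ₁ 0<ρ₁) r (ℕₚ.m≤m+n r₁ (r₂ ℕ.+ 2))
      i≤ρ₂ : i ≤ ρ₂
      i≤ρ₂ = proj₂ (inv-small ρ₂ 0<ρ₂) r (ℕₚ.≤-trans (ℕₚ.m≤m+n r₂ 2) (ℕₚ.m≤n+m (r₂ ℕ.+ 2) r₁))
      0<i : 0ℚ < i
      0<i = inv-pos (0<ι r)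
      3i≤1 : ι 3 * i ≤ 1ℚ
      3i≤1 = ≤-trans (ℚₚ.*-monoʳ-≤-nonNeg i {{nonNegative (<⇒≤ 0<i)}} (ι-mono (ℕ.s≤s (ℕₚ.≤-trans (ℕₚ.m≤n+m 2 r₂) (ℕₚ.m≤n+m (r₂ ℕ.+ 2) r₁)))))
        (≤-reflexive (*-inv⁺ (0<ι r)))
      0≤1-3i : 0ℚ ≤ 1ℚ - ι 3 * i
      0≤1-3i = difference≥0 3i≤1

      -- The base point, where the sum is compared with a geometric series.
      t q₁ k₁ u : ℚ
      t = i * i
      q₁ = 1ℚ - t
      k₁ = q₁ * q₁
      u = 1ℚ - k₁
      0<t : 0ℚ < t
      0<t = *-pos 0<i 0<i
      3t≤i : 0ℚ ≤ i - ι 3 * t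
      3t≤i = subst (0ℚ ≤_) (lemma i) (*-nonNeg (<⇒≤ 0<i) 0≤1-3i)
        where
          lemma : ∀ i → i * (1ℚ - ι 3 * i) ≡ i - ι 3 * (i * i)
          lemma = solve-∀ ringℚ
      9t≤1 : 0ℚ ≤ 1ℚ - ι 9 * t
      9t≤1 = subst (0ℚ ≤_) (lemma i) (+-nonNeg 0≤1-3i (*-nonNeg (0≤ι 3) 3t≤i))
        where
          lemma : ∀ i → 1ℚ - ι 3 * i + ι 3 * (i - ι 3 * (i * i)) ≡ 1ℚ - ι 9 * (i * i)
          lemma = solve-∀ ringℚ
      t≤i : t ≤ i
      t≤i = ≤-by (i - ι 3 * t + ι 2 * t) (+-nonNeg 3t≤i (*-nonNeg (0≤ι 2) (<⇒≤ 0<t))) (lemma t i)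
        where
          lemma : ∀ t i → t + (i - ι 3 * t + ι 2 * t) ≡ i
          lemma = solve-∀ ringℚ
      ½≤q₁ : ½ ≤ q₁
      ½≤q₁ = ≤-by (½ * (1ℚ - ι 9 * t) + ½ * (ι 7 * t)) (+-nonNeg (*-nonNeg 0≤½ 9t≤1) (*-nonNeg 0≤½ (*-nonNeg (0≤ι 7) (<⇒≤ 0<t)))) (lemma t)
        where
          lemma : ∀ t → ½ + (½ * (1ℚ - ι 9 * t) + ½ * (ι 7 * t)) ≡ 1ℚ - t
          lemma = solve-∀ ringℚ
      0<q₁ : 0ℚ < q₁
      0<q₁ = ℚₚ.<-≤-trans (ℚₚ.positive⁻¹ ½) ½≤q₁
      q₁<1 : q₁ < 1ℚ
      q₁<1 = subst (q₁ <_) (lemma t) (subst (_< q₁ + t) (ℚₚ.+-identityʳ q₁) (ℚₚ.+-monoʳ-< q₁ 0<t))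
        where
          lemma : ∀ t → 1ℚ - t + t ≡ 1ℚ
          lemma = solve-∀ ringℚ
      k₁<1 : k₁ < 1ℚ
      k₁<1 = square<1 (<⇒≤ 0<q₁) q₁<1
      0<u : 0ℚ < u
      0<u = difference>0 k₁<1
      u≤2t : u ≤ ι 2 * t
      u≤2t = ≤-by (t * t) (square-nonNeg t) (lemma t)
        where
          lemma : ∀ t → 1ℚ - (1ℚ - t) * (1ℚ - t) + t * t ≡ ι 2 * t
          lemma = solve-∀ ringℚ
      ¾≤k₁ : ℤ.+ 3 / 4 ≤ k₁
      ¾≤k₁ = ≤-by (¼ * (1ℚ - ι 9 * t) + ¼ * t + t * t) (+-nonNeg (+-nonNeg (*-nonNeg 0≤¼ 9t≤1) (*-nonNeg 0≤¼ (<⇒≤ 0<t))) (square-nonNeg t)) (lemma t)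
        where
          lemma : ∀ t → ℤ.+ 3 / 4 + (¼ * (1ℚ - ι 9 * t) + ¼ * t + t * t) ≡ (1ℚ - t) * (1ℚ - t)
          lemma = solve-∀ ringℚ
      κ≤k₁ : κ ≤ k₁
      κ≤k₁ = ≤-by ((1ℚ - κ - ι 2 * i) + ι 2 * (i - t) + t * t)
        (+-nonNeg (+-nonNeg (subst (0ℚ ≤_) (lemma₀ κ i) (*-nonNeg (0≤ι 2) (difference≥0 i≤ρ₂))) (*-nonNeg (0≤ι 2) (difference≥0 t≤i))) (square-nonNeg t)) (lemma κ i t)
        where
          lemma₀ : ∀ κ i → ι 2 * (½ * (1ℚ - κ) - i) ≡ 1ℚ - κ - ι 2 * i
          lemma₀ = solve-∀ ringℚ
          lemma : ∀ κ i t → κ + ((1ℚ - κ - ι 2 * i) + ι 2 * (i - t) + t * t) ≡ (1ℚ - t) * (1ℚ - t)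
          lemma = solve-∀ ringℚ

      contraction : ∃[ θ ] ½ ≤ θ × θ < 1ℚ × (∀ {k} → 0ℚ < k → k ≤ 1ℚ → η ≤ ω k → u ≤ 1ℚ - k → ζ k ≤ θ)
      contraction = ζ-contracts 0<η 0<u
      θ : ℚ
      θ = proj₁ contraction
      ½≤θ : ½ ≤ θ
      ½≤θ = proj₁ (proj₂ contraction)
      0≤θ : 0ℚ ≤ θ
      0≤θ = ≤-trans 0≤½ ½≤θ
      θ<1 : θ < 1ℚ
      θ<1 = proj₁ (proj₂ (proj₂ contraction))

      ρ₃ : ℚ
      -- 1160 = 8 + 9·32·4: the geometric tail in `base`, and the drift multiplied by `V l` ≤ 4.
      ρ₃ = ½ * inv (ι 1160) * ε
      decay : ∃[ N ] ∀ n → N ℕ.≤ n → ι n * ι n * ι n * θ ^ n ≤ ρ₃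
      decay = Decay.cubic-decay θ 0≤θ θ<1 ρ₃ (*-pos {½ * inv (ι 1160)} (ℚₚ.positive⁻¹ (½ * inv (ι 1160))) 0<ε)

      module _ (n l : ℕ) (q : ℚ) (N≤n : suc (proj₁ decay) ℕ.≤ n) (n≤1+l : n ℕ.≤ suc l)
        (0<q : 0ℚ < q) (η≤ω : η ≤ ω (q * q)) (q²≤κ : q * q ≤ κ) where

        v x : ℚ
        v = V l
        x = θ ^ n
        0≤x : 0ℚ ≤ x
        0≤x = ^-nonNeg n 0≤θ
        1≤ιn : 1ℚ ≤ ι n
        1≤ιn = ι-mono (ℕₚ.≤-trans (ℕ.s≤s ℕ.z≤n) N≤n)
        n²≤n³ : ι n * ι n * x ≤ ι n * ι n * ι n * x
        n²≤n³ = ≤-by (ι n * ι n * x * (ι n - 1ℚ)) (*-nonNeg (*-nonNeg (square-nonNeg (ι n)) 0≤x) (difference≥0 1≤ιn)) (lemma (ι n) x)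
          where
            lemma : ∀ n x → n * n * x + n * n * x * (n - 1ℚ) ≡ n * n * n * x
            lemma = solve-∀ ringℚ
        1≤n² : x ≤ ι n * ι n * x
        1≤n² = ≤-trans (≤-reflexive (sym (ℚₚ.*-identityˡ x))) (ℚₚ.*-monoʳ-≤-nonNeg x {{nonNegative 0≤x}} (*-mono {1ℚ} {ι n} {1ℚ} {ι n} 0≤1 (0≤ι n) 1≤ιn 1≤ιn))

        q≤q₁ : q ≤ q₁
        q≤q₁ = ≤-from-squares (<⇒≤ 0<q) (<⇒≤ 0<q₁) (≤-trans q²≤κ κ≤k₁)

        module _ (z : ℚ) (z∈ : z ∈[ q , q₁ ]) where

          0<z : 0ℚ < z
          0<z = ℚₚ.<-≤-trans 0<q (proj₁ z∈)
          0<z² : 0ℚ < z * z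
          0<z² = *-pos 0<z 0<z
          z²≤k₁ : z * z ≤ k₁
          z²≤k₁ = *-mono (<⇒≤ 0<z) (<⇒≤ 0<q₁) (proj₂ z∈) (proj₂ z∈)
          z²<1 : z * z < 1ℚ
          z²<1 = ℚₚ.≤-<-trans z²≤k₁ k₁<1
          η≤ωz² : η ≤ ω (z * z)
          η≤ωz² = ≤-trans η≤ω (ω-mono (square-nonNeg q) (*-mono (<⇒≤ 0<q) (<⇒≤ 0<z) (proj₁ z∈) (proj₁ z∈)))

          ζ≤θ : ζ (z * z) ≤ θ
          ζ≤θ = proj₂ (proj₂ (proj₂ contraction)) 0<z² (<⇒≤ z²<1) η≤ωz² (ℚₚ.+-monoʳ-≤ 1ℚ (ℚₚ.neg-antimono-≤ z²≤k₁))

          inv²≤9 : inv z * inv z ≤ ι 9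
          inv²≤9 = cancel-≤ 0<z² (≤-trans (≤-reflexive (trans (lemma z (inv z)) (cong₂ _*_ (*-inv⁺ 0<z) (*-inv⁺ 0<z))))
            (≤-trans (1≤9k 0<z² (<⇒≤ z²<1) (≤-trans (<⇒≤ 0<η) η≤ωz²)) (≤-reflexive (ℚₚ.*-comm (ι 9) (z * z)))))
            where
              lemma : ∀ z w → z * z * (w * w) ≡ z * w * (z * w)
              lemma = solve-∀ ringℚ

          slope≤ : ∣ inv z * inv z * residue (z * z) n ∣ ≤ ι 9 * (ι 32 * (ι n * ι n * x))
          slope≤ = ∣*∣≤ (≤-trans (∣≥0∣ (square-nonNeg (inv z))) inv²≤9) (∣residue∣≤ 0<z² z²<1 ½≤θ ζ≤θ n)

        drift : ∣ ratio n q₁ - ratio n q ∣ ≤ ι 9 * (ι 32 * (ι n * ι n * x)) * (q₁ - q)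
        drift = mean-value q≤q₁ (diff-ratio 0<q q≤q₁ q₁<1 n) slope≤

        q₁∈ : q₁ ∈[ q , q₁ ]
        q₁∈ = q≤q₁ , ≤-refl

        inv-q₁≤2 : inv q₁ ≤ ι 2
        inv-q₁≤2 = cancel-≤ 0<q₁ (≤-trans (≤-reflexive (*-inv⁺ 0<q₁)) (≤-trans (*-monoˡ (0≤ι 2) ½≤q₁) (≤-reflexive (ℚₚ.*-comm (ι 2) q₁))))

        base : ∣ ratio n q₁ * v - ι 4 ∣ ≤ ι 2 * (ι 68 * (ι 2 * i) + ι 24 * (ι 2 * i + i) + ι 4 * x + ι 4 * i)
        base = subst (λ s → ∣ s ∣ ≤ ι 2 * (ι 68 * (ι 2 * i) + ι 24 * (ι 2 * i + i) + ι 4 * x + ι 4 * i)) (sym split)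
            (∣*∣≤ (≤-trans (∣≥0∣ (<⇒≤ (inv-pos 0<q₁))) inv-q₁≤2)
              (∣+∣≤ (≤-trans (near-one k₁ ¾≤k₁ k₁<1 l r n n≤1+l)
                  (ℚₚ.+-mono-≤ (ℚₚ.+-mono-≤ (*-monoˡ (0≤ι 68) (≤-trans u≤2t (*-monoˡ (0≤ι 2) t≤i))) (*-monoˡ (0≤ι 24) (ℚₚ.+-monoˡ-≤ i uR≤2i)))
                    (*-monoˡ (0≤ι 4) (^-mono n (<⇒≤ (ζ>0 k₁ (*-pos 0<q₁ 0<q₁) k₁<1)) (ζ≤θ q₁ q₁∈)))))
                (≤-trans (∣≥0∣ (*-nonNeg (0≤ι 4) (<⇒≤ 0<t))) (*-monoˡ (0≤ι 4) t≤i))))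
          where
            split : ratio n q₁ * v - ι 4 ≡ inv q₁ * (M k₁ n * v - ι 4 + ι 4 * t)
            split = modulo (*-inv⁺ 0<q₁) (lemma (M k₁ n) v (inv q₁) t)
              where
                lemma : ∀ m v w t → m * w * v - ι 4 ≡ w * (m * v - ι 4 + ι 4 * t) + ((1ℚ - t) * w - 1ℚ) * ι 4
                lemma = solve-∀ ringℚ
            -- The reason for t = i²: the distance from 1 to the base point must beat the factor `R`
            -- in `near-one`, and 2i² R = 2i does.
            uR≤2i : u * R ≤ ι 2 * i
            uR≤2i = ≤-trans (ℚₚ.*-monoʳ-≤-nonNeg R {{nonNegative (<⇒≤ (0<ι r))}} u≤2t)
              (≤-reflexive (modulo (*-inv⁺ (0<ι r)) (lemma R i)))
              where
                lemma : ∀ R i → ι 2 * (i * i) * R ≡ ι 2 * i + (R * i - 1ℚ) * (ι 2 * i)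
                lemma = solve-∀ ringℚ

        estimate : ∣ ratio n q * v - ι 4 ∣ ≤ ε
        estimate = subst (λ s → ∣ s ∣ ≤ ε) (lemma₁ (ratio n q₁) (ratio n q) v) (≤-trans
          (∣+∣≤ base (∣-∣≤ (∣*∣≤ (≤-trans drift drift′) (≤-trans (∣≥0∣ (<⇒≤ (V>0 l))) (V≤4 l)))))
          (≤-trans (≤-reflexive (lemma₂ i x (ι n * ι n * x)))
          (≤-trans (ℚₚ.+-mono-≤ (*-monoˡ (0≤ι 424) i≤ρ₁) (≤-trans (ℚₚ.+-mono-≤ (*-monoˡ (0≤ι 8) (≤-trans 1≤n² n²≤n³)) (*-monoˡ (0≤ι 1152) n²≤n³))
              (≤-trans (≤-reflexive (lemma₃ (ι n * ι n * ι n * x))) (*-monoˡ (0≤ι 1160) (proj₂ decay n (ℕₚ.≤-trans (ℕₚ.n≤1+n _) N≤n))))))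
            (≤-reflexive (lemma₄ ε)))))
          where
            lemma₁ : ∀ a b v → a * v - ι 4 + - ((a - b) * v) ≡ b * v - ι 4
            lemma₁ = solve-∀ ringℚ
            lemma₂ : ∀ i x y → ι 2 * (ι 68 * (ι 2 * i) + ι 24 * (ι 2 * i + i) + ι 4 * x + ι 4 * i) + ι 9 * (ι 32 * y) * ι 4 ≡
              ι 424 * i + (ι 8 * x + ι 1152 * y)
            lemma₂ = solve-∀ ringℚ
            lemma₃ : ∀ y → ι 8 * y + ι 1152 * y ≡ ι 1160 * y
            lemma₃ = solve-∀ ringℚ
            lemma₄ : ∀ e → ι 424 * (½ * inv (ι 424) * e) + ι 1160 * (½ * inv (ι 1160) * e) ≡ e
            lemma₄ = solve-∀ ringℚ
            drift′ : ι 9 * (ι 32 * (ι n * ι n * x)) * (q₁ - q) ≤ ι 9 * (ι 32 * (ι n * ι n * x))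
            drift′ = ≤-by (ι 9 * (ι 32 * (ι n * ι n * x)) * (t + q))
              (*-nonNeg (*-nonNeg (0≤ι 9) (*-nonNeg (0≤ι 32) (*-nonNeg (square-nonNeg (ι n)) 0≤x))) (+-nonNeg (<⇒≤ 0<t) (<⇒≤ 0<q))) (lemma (ι 9 * (ι 32 * (ι n * ι n * x))) t q)
              where
                lemma : ∀ c t q → c * (1ℚ - t - q) + c * (t + q) ≡ c
                lemma = solve-∀ ringℚ

  ∣leg⁻∣≤1 : ∀ y → 0ℚ < 1ℚ - y * y → ∀ n → ∣ leg⁻ y 1ℚ n ∣ ≤ 1ℚ
  ∣leg⁻∣≤1 y h zero = 0≤1
  ∣leg⁻∣≤1 y h (suc n) = ∣leg∣≤1 y h n

  module _ (k : ℚ) (0<k : 0ℚ < k) (k<1 : k < 1ℚ) (v : ℚ) (k+1≢0 : (1ℚ + k) * v ≡ 1ℚ) where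

    private
      kk⁻¹ : k * inv k ≡ 1ℚ
      kk⁻¹ = *-inv⁺ 0<k

    open Original k kk⁻¹ v k+1≢0 using (r; boundary)

    -- 192 = 64(1 + 2): 64 bounds `r`, and n²(n + 1) ≤ 2n³ for n ≥ 1. In ζ² `p⁻` one factor ζ is
    -- bounded by 1 and the other raises `p⁻` to size ζⁿ.
    ∣boundary∣≤ : ∀ {θ} → ζ k ≤ θ → θ < 1ℚ → ∀ n → 1 ℕ.≤ n → ∣ boundary n ∣ ≤ ι 192 * (ι n * ι n * ι n * θ ^ n)
    ∣boundary∣≤ {θ} ζ≤θ θ<1 n 1≤n = ≤-trans
        (∣*∣≤ ∣r∣≤64 (∣*∣≤ (≤-trans (∣≥0∣ (<⇒≤ (coeff>0 n))) (coeff≤1 n)) (∣+∣≤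
          (∣*∣≤ (∣≥0∣ 0≤n³) (≤-trans (∣p∣≤ζⁿ k 0<k k<1 n) ζⁿ≤θⁿ)) (∣-∣≤ second))))
        (≤-reflexive (lemma (ι n) (θ ^ n)))
      where
        0≤ζ : 0ℚ ≤ ζ k
        0≤ζ = <⇒≤ (ζ>0 k 0<k k<1)
        0≤n³ : 0ℚ ≤ ι n * ι n * ι n
        0≤n³ = *-nonNeg (*-nonNeg (0≤ι n) (0≤ι n)) (0≤ι n)
        ζⁿ≤θⁿ : ζ k ^ n ≤ θ ^ n
        ζⁿ≤θⁿ = ^-mono n 0≤ζ ζ≤θ
        0≤v : 0ℚ ≤ v
        0≤v = ℚₚ.≮⇒≥ λ v<0 → ℚₚ.<-irrefl refl (ℚₚ.<-≤-trans 0<1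
          (≤-trans (≤-reflexive (sym k+1≢0)) (≤-trans (*-monoˡ (+-nonNeg 0≤1 (<⇒≤ 0<k)) (<⇒≤ v<0)) (≤-reflexive (ℚₚ.*-zeroʳ (1ℚ + k))))))
        v≤1 : v ≤ 1ℚ
        v≤1 = ≤-by (k * v) (*-nonNeg (<⇒≤ 0<k) 0≤v) (trans (lemma₀ k v) k+1≢0)
          where
            lemma₀ : ∀ k v → v + k * v ≡ (1ℚ + k) * v
            lemma₀ = solve-∀ ringℚ
        ∣k∣≤1 : ∣ k ∣ ≤ 1ℚ
        ∣k∣≤1 = ≤-trans (∣≥0∣ (<⇒≤ 0<k)) (<⇒≤ k<1)
        ∣2k-1∣≤1 : ∣ ι 2 * k - 1ℚ ∣ ≤ 1ℚ
        ∣2k-1∣≤1 = abs-≤ (≤-by (ι 2 * (1ℚ - k)) (*-nonNeg (0≤ι 2) (difference≥0 (<⇒≤ k<1))) (lemma₁ k)) (≤-by (ι 2 * k) (*-nonNeg (0≤ι 2) (<⇒≤ 0<k)) (lemma₂ k))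
          where
            lemma₁ : ∀ k → ι 2 * k - 1ℚ + ι 2 * (1ℚ - k) ≡ 1ℚ
            lemma₁ = solve-∀ ringℚ
            lemma₂ : ∀ k → - (ι 2 * k - 1ℚ) + ι 2 * k ≡ 1ℚ
            lemma₂ = solve-∀ ringℚ
        ∣r∣≤64 : ∣ r ∣ ≤ ι 64 * 1ℚ * 1ℚ * 1ℚ * 1ℚ
        ∣r∣≤64 = ∣*∣≤ (∣*∣≤ (∣*∣≤ (∣*∣≤ (≤-refl {ι 64}) ∣k∣≤1) ∣k∣≤1) ∣2k-1∣≤1) (≤-trans (∣≥0∣ 0≤v) v≤1)
        1+n≤2n : 1ℚ + ι n ≤ ι 2 * ι n
        1+n≤2n = ≤-by (ι n - 1ℚ) (difference≥0 (ι-mono 1≤n)) (lemma₀ (ι n))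
          where
            lemma₀ : ∀ n → 1ℚ + n + (n - 1ℚ) ≡ ι 2 * n
            lemma₀ = solve-∀ ringℚ
        second : ∣ ζ k * ζ k * (ι n * ι n * (1ℚ + ι n) * p⁻ k n) ∣ ≤ 1ℚ * (ι n * ι n * (ι 2 * ι n) * (θ ^ n * 1ℚ))
        second = subst (λ t → ∣ t ∣ ≤ 1ℚ * (ι n * ι n * (ι 2 * ι n) * (θ ^ n * 1ℚ)))
          (trans (cong (λ t → ζ k * (ι n * ι n * (1ℚ + ι n) * t)) (sym (ζp⁻≡ζⁿP⁻ k 0<k k<1 n))) (lemma₀ (ζ k) (ι n * ι n * (1ℚ + ι n)) (p⁻ k n)))
          (∣*∣≤ (≤-trans (∣≥0∣ 0≤ζ) (≤-trans ζ≤θ (<⇒≤ θ<1))) (∣*∣≤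
            (≤-trans (∣≥0∣ (*-nonNeg (*-nonNeg (0≤ι n) (0≤ι n)) (+-nonNeg 0≤1 (0≤ι n)))) (*-monoˡ (*-nonNeg (0≤ι n) (0≤ι n)) 1+n≤2n))
            (∣*∣≤ (≤-trans (∣≥0∣ (^-nonNeg n 0≤ζ)) ζⁿ≤θⁿ) (∣leg⁻∣≤1 (y k) (0<1-y² k 0<k k<1) n))))
          where
            lemma₀ : ∀ z c q → z * (c * (z * q)) ≡ z * z * (c * q)
            lemma₀ = solve-∀ ringℚ
        lemma : ∀ n x → ι 64 * 1ℚ * 1ℚ * 1ℚ * 1ℚ * (1ℚ * (n * n * n * x + 1ℚ * (n * n * (ι 2 * n) * (x * 1ℚ)))) ≡ ι 192 * (n * n * n * x)
        lemma = solve-∀ ringℚ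

  module Bisection (κ : ℚ) (0≤κ : 0ℚ ≤ κ) (κ≤1 : κ ≤ 1ℚ) (m : ℕ) where

    root : ℚ
    root = bisect κ m

    private
      w : ℚ
      w = (1ℚ + κ) * 2^- m
      0≤2⁻ᵐ : 0ℚ ≤ 2^- m
      0≤2⁻ᵐ = <⇒≤ (2^-pos m)
      w≤ : w ≤ ι 2 * 2^- m
      w≤ = ℚₚ.*-monoʳ-≤-nonNeg (2^- m) {{nonNegative 0≤2⁻ᵐ}} (ℚₚ.+-monoʳ-≤ 1ℚ κ≤1)
      0≤w : 0ℚ ≤ w
      0≤w = *-nonNeg (+-nonNeg 0≤1 0≤κ) 0≤2⁻ᵐ

    0≤root : 0ℚ ≤ root
    0≤root = proj₁ (bisect-spec κ 0≤κ m)

    root²≤ : root * root ≤ κ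
    root²≤ = proj₁ (proj₂ (bisect-spec κ 0≤κ m))

    root≤1 : root ≤ 1ℚ
    root≤1 = ≤-from-squares 0≤root 0≤1 (≤-trans root²≤ κ≤1)

    -- The error is at most (r + w)² - r² = w(2r + w), with w ≤ 2·2⁻ᵐ and 2r + w ≤ 4.
    root-error : κ - root * root ≤ ι 8 * 2^- m
    root-error = ≤-trans (≤-trans (ℚₚ.+-monoˡ-≤ (- (root * root)) (<⇒≤ (proj₂ (proj₂ (bisect-spec κ 0≤κ m))))) (≤-reflexive (lemma₁ root w)))
      (≤-trans (*-mono 0≤w (0≤ι 4) w≤ 2r+w≤4) (≤-reflexive (lemma₂ (2^- m))))
      where
        2r+w≤4 : ι 2 * root + w ≤ ι 4
        2r+w≤4 = ℚₚ.+-mono-≤ (*-monoˡ (0≤ι 2) root≤1) (≤-trans w≤ (*-monoˡ (0≤ι 2) (2^-≤1 m)))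
        lemma₁ : ∀ r w → (r + w) * (r + w) - r * r ≡ w * (ι 2 * r + w)
        lemma₁ = solve-∀ ringℚ
        lemma₂ : ∀ x → ι 2 * x * ι 4 ≡ ι 8 * x
        lemma₂ = solve-∀ ringℚ

  module _ (η κ̄ : ℚ) (0<η : 0ℚ < η) (κ̄<1 : κ̄ < 1ℚ) where

    -- Write h for the ratio, v for `V l` and π for `leibniz m`. Then h - 4/π = ((h v - 4) - h (v -
    -- π))/π, of size at most ε + 3ε; the bound |h| ≤ 3 follows from |h| v ≤ 5 and v ≥ 2.
    ratio-π : ∀ ε → 0ℚ < ε → ε ≤ 1ℚ → ∃[ N ] ∀ n m q → N ℕ.≤ n → N ℕ.≤ m → 0ℚ < q → η ≤ ω (q * q) → q * q ≤ κ̄ →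
      ∣ ratio n q - ι 4 * inv (leibniz m) ∣ ≤ ι 4 * ε × ∣ ratio n q ∣ ≤ ι 3
    ratio-π ε 0<ε ε≤1 = suc (N₁ ℕ.+ N₂) , λ n m q N≤n N≤m 0<q η≤ω q²≤κ̄ →
        -- Large enough for both limits: at least n for `ratio-limit`, at least N₂ for `V-limit`.
        let l = n ℕ.+ N₂
            near = proj₂ limit₁ n l q (ℕₚ.m+n≤o⇒m≤o N₁ (ℕₚ.≤-trans (ℕₚ.n≤1+n _) N≤n)) (ℕₚ.m≤n⇒m≤1+n (ℕₚ.m≤m+n n N₂)) 0<q η≤ω q²≤κ̄
            near-π = proj₂ limit₂ l m (ℕₚ.m≤n+m N₂ n) (ℕₚ.m+n≤o⇒n≤o N₁ (ℕₚ.≤-trans (ℕₚ.n≤1+n _) N≤m))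
        in conclude (ratio n q) (V l) (leibniz m) near near-π (2≤V l) (1≤leibniz m (ℕₚ.≤-trans (ℕ.s≤s ℕ.z≤n) N≤m))
      where
        limit₁ = ratio-limit η κ̄ 0<η κ̄<1 ε 0<ε
        limit₂ = V-limit ε 0<ε
        N₁ N₂ : ℕ
        N₁ = proj₁ limit₁
        N₂ = proj₁ limit₂
        conclude : ∀ h v π → ∣ h * v - ι 4 ∣ ≤ ε → ∣ v - π ∣ ≤ ε → ι 2 ≤ v → 1ℚ ≤ π → ∣ h - ι 4 * inv π ∣ ≤ ι 4 * ε × ∣ h ∣ ≤ ι 3
        conclude h v π hv vπ 2≤v 1≤π = subst₂ _≤_ (cong ∣_∣ (sym split)) (lemma₁ ε)
            (∣*∣≤ (≤-trans (∣≥0∣ (<⇒≤ (inv-pos 0<π))) inv≤1) (∣+∣≤ hv (∣-∣≤ (∣*∣≤ ∣h∣≤3 vπ)))) , ∣h∣≤3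
          where
            0<π : 0ℚ < π
            0<π = ℚₚ.<-≤-trans 0<1 1≤π
            inv≤1 : inv π ≤ 1ℚ
            inv≤1 = cancel-≤ 0<π (≤-trans (≤-reflexive (*-inv⁺ 0<π)) (≤-trans 1≤π (≤-reflexive (sym (ℚₚ.*-identityʳ π)))))
            lemma₁ : ∀ e → 1ℚ * (e + ι 3 * e) ≡ ι 4 * e
            lemma₁ = solve-∀ ringℚ
            split : h - ι 4 * inv π ≡ inv π * (h * v - ι 4 + - (h * (v - π)))
            split = modulo (*-inv⁺ 0<π) (lemma₂ h v π (inv π))
              where
                lemma₂ : ∀ h v π i → h - ι 4 * i ≡ i * (h * v - ι 4 + - (h * (v - π))) + (π * i - 1ℚ) * - h
                lemma₂ = solve-∀ ringℚ
            ∣h∣≤3 : ∣ h ∣ ≤ ι 3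
            ∣h∣≤3 = cancel-≤ {ι 2} (0<ι 1) (≤-trans
              (≤-trans (ℚₚ.*-monoʳ-≤-nonNeg ∣ h ∣ {{nonNegative (ℚₚ.0≤∣p∣ h)}} 2≤v)
                (≤-reflexive (trans (ℚₚ.*-comm v ∣ h ∣) (trans (cong (∣ h ∣ *_) (sym (ℚₚ.0≤p⇒∣p∣≡p (≤-trans (0≤ι 2) 2≤v)))) (sym (ℚₚ.∣p*q∣≡∣p∣*∣q∣ h v))))))
              (≤-trans (subst (λ t → ∣ t ∣ ≤ 1ℚ + ι 4) (lemma₃ (h * v)) (∣+∣≤ (≤-trans hv ε≤1) (≤-refl {ι 4}))) (ι-mono {5} {6} (ℕₚ.n≤1+n 5))))
              where
                lemma₃ : ∀ x → x - ι 4 + ι 4 ≡ x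
                lemma₃ = solve-∀ ringℚ

  -- Hypergeometric form and central binomial coefficients

  fromℤ-+ : ∀ i j → fromℤ (i ℤ.+ j) ≡ fromℤ i + fromℤ j
  fromℤ-+ i j = ℚₚ.toℚᵘ-injective (ℚᵘₚ.≃-sym (ℚᵘₚ.≃-trans (ℚₚ.toℚᵘ-homo-+ (fromℤ i) (fromℤ j))
    (ℚᵘ.*≡* (cong (ℤ._* ℤ.+ 1) (cong₂ ℤ._+_ (ℤₚ.*-identityʳ i) (ℤₚ.*-identityʳ j))))))

  fromℤ-* : ∀ i j → fromℤ (i ℤ.* j) ≡ fromℤ i * fromℤ j
  fromℤ-* i j = ℚₚ.toℚᵘ-injective (ℚᵘₚ.≃-sym (ℚᵘₚ.≃-trans (ℚₚ.toℚᵘ-homo-* (fromℤ i) (fromℤ j)) (ℚᵘ.*≡* refl)))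

  fromℤ-neg : ∀ n → fromℤ (ℤ.- (ℤ.+ n)) ≡ - ι n
  fromℤ-neg zero = refl
  fromℤ-neg (suc n) = refl

  rising : ℚ → ℕ → ℚ
  rising a zero = 1ℚ
  rising a (suc j) = rising a j * (a + ι j)

  rising-shift : ∀ a j → rising a (suc j) ≡ a * rising (1ℚ + a) j
  rising-shift a zero = lemma a
    where
      lemma : ∀ a → 1ℚ * (a + 0ℚ) ≡ a * 1ℚ
      lemma = solve-∀ ringℚ
  rising-shift a (suc j) = trans (cong₂ _*_ (rising-shift a j) (cong (a +_) (ι-suc j))) (lemma a (rising (1ℚ + a) j) (ι j))
    where
      lemma : ∀ a r j → a * r * (a + (1ℚ + j)) ≡ a * (r * (1ℚ + a + j))
      lemma = solve-∀ ringℚ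

  rising-cong : ∀ {a b} → a ≡ b → ∀ j → rising a j ≡ rising b j
  rising-cong e j = cong (λ a → rising a j) e

  fromℤ-pochhammer : ∀ i j → fromℤ (pochhammer i j) ≡ rising (fromℤ i) j
  fromℤ-pochhammer i zero = refl
  fromℤ-pochhammer i (suc j) = trans (fromℤ-* (pochhammer i j) (i ℤ.+ ℤ.+ j)) (cong₂ _*_ (fromℤ-pochhammer i j) (fromℤ-+ i (ℤ.+ j)))

  numerator₂ : ℚ → ℕ → ℚ
  numerator₂ ν j = rising (- ν) j * rising (1ℚ + ν) j

  1/[j!]² : ℕ → ℚ
  1/[j!]² zero = 1ℚ
  1/[j!]² (suc j) = 1/[j!]² j * inv (ι (suc j)) * inv (ι (suc j))

  1/[j!]²-rec : ∀ j → (1ℚ + ι j) * ((1ℚ + ι j) * 1/[j!]² (suc j)) ≡ 1/[j!]² j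
  1/[j!]²-rec j = trans (cong ((1ℚ + ι j) *_) (*-inv-cancel j _ _ refl)) (*-inv-cancel j _ _ refl)

  -- The degree ν is rational rather than natural, so that ν - 1 always makes sense and the
  -- recurrence becomes a polynomial identity in ν.
  legendreCoeff : ℚ → ℕ → ℚ
  legendreCoeff ν j = numerator₂ ν j * 1/[j!]² j

  -- The three-term recurrence, coefficientwise in w = (1 - x)/2.
  numerator₂-rec : ∀ ν j → (1ℚ + ν) * numerator₂ (1ℚ + ν) (suc j) - (ι 2 * ν + 1ℚ) * numerator₂ ν (suc j) + ν * numerator₂ (ν - 1ℚ) (suc j) ≡
    - ι 2 * (ι 2 * ν + 1ℚ) * ((1ℚ + ι j) * (1ℚ + ι j)) * numerator₂ ν j
  numerator₂-rec ν zero = lemma ν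
    where
      lemma : ∀ ν → (1ℚ + ν) * (1ℚ * (- (1ℚ + ν) + 0ℚ) * (1ℚ * (1ℚ + (1ℚ + ν) + 0ℚ))) - (ι 2 * ν + 1ℚ) * (1ℚ * (- ν + 0ℚ) * (1ℚ * (1ℚ + ν + 0ℚ)))
        + ν * (1ℚ * (- (ν - 1ℚ) + 0ℚ) * (1ℚ * (1ℚ + (ν - 1ℚ) + 0ℚ))) ≡
        - ι 2 * (ι 2 * ν + 1ℚ) * ((1ℚ + 0ℚ) * (1ℚ + 0ℚ)) * (1ℚ * 1ℚ)
      lemma = solve-∀ ringℚ
  numerator₂-rec ν (suc i) = trans
    (cong₂ _+_ (cong₂ _-_ (cong ((1ℚ + ν) *_) upper) (cong ((ι 2 * ν + 1ℚ) *_) middle)) (cong (ν *_) lower))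
    (trans (lemma ν (ι i) a b) (cong₂ (λ j t → - ι 2 * (ι 2 * ν + 1ℚ) * ((1ℚ + j) * (1ℚ + j)) * t) (sym (ι-suc i)) (sym shorter)))
    where
      a b : ℚ
      a = rising (1ℚ - ν) i
      b = rising (1ℚ + (1ℚ + ν)) i
      upper : numerator₂ (1ℚ + ν) (suc (suc i)) ≡ - (1ℚ + ν) * (- ν * a) * (b * (ι 2 + ν + ι i) * (ι 3 + ν + ι i))
      upper = cong₂ _*_ (trans (rising-shift (- (1ℚ + ν)) (suc i)) (cong (- (1ℚ + ν) *_) (trans (rising-cong (lemma₁ ν) (suc i)) (rising-shift (- ν) i))))
          (trans (cong (rising (1ℚ + (1ℚ + ν)) (suc i) *_) (cong (1ℚ + (1ℚ + ν) +_) (ι-suc i))) (lemma₂ b ν (ι i)))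
        where
          lemma₁ : ∀ ν → 1ℚ + - (1ℚ + ν) ≡ - ν
          lemma₁ = solve-∀ ringℚ
          lemma₂ : ∀ b ν i → b * (1ℚ + (1ℚ + ν) + i) * (1ℚ + (1ℚ + ν) + (1ℚ + i)) ≡ b * (ι 2 + ν + i) * (ι 3 + ν + i)
          lemma₂ = solve-∀ ringℚ
      middle : numerator₂ ν (suc (suc i)) ≡ - ν * (a * (1ℚ - ν + ι i)) * ((1ℚ + ν) * (b * (ι 2 + ν + ι i)))
      middle = cong₂ _*_ (rising-shift (- ν) (suc i)) (trans (rising-shift (1ℚ + ν) (suc i)) (lemma₁ b ν (ι i)))
        where
          lemma₁ : ∀ b ν i → (1ℚ + ν) * (b * (1ℚ + (1ℚ + ν) + i)) ≡ (1ℚ + ν) * (b * (ι 2 + ν + i))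
          lemma₁ = solve-∀ ringℚ
      lower : numerator₂ (ν - 1ℚ) (suc (suc i)) ≡ a * (1ℚ - ν + ι i) * (ι 2 - ν + ι i) * (ν * ((1ℚ + ν) * b))
      lower = cong₂ _*_ (trans (rising-cong (lemma₁ ν) (suc (suc i))) (trans (cong (λ t → a * (1ℚ - ν + ι i) * (1ℚ - ν + t)) (ι-suc i)) (lemma₂ (a * (1ℚ - ν + ι i)) ν (ι i))))
          (trans (rising-cong (lemma₃ ν) (suc (suc i))) (trans (rising-shift ν (suc i)) (cong (ν *_) (rising-shift (1ℚ + ν) i))))
        where
          lemma₁ : ∀ ν → - (ν - 1ℚ) ≡ 1ℚ - ν
          lemma₁ = solve-∀ ringℚ
          lemma₂ : ∀ a ν i → a * (1ℚ - ν + (1ℚ + i)) ≡ a * (ι 2 - ν + i)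
          lemma₂ = solve-∀ ringℚ
          lemma₃ : ∀ ν → 1ℚ + (ν - 1ℚ) ≡ ν
          lemma₃ = solve-∀ ringℚ
      shorter : numerator₂ ν (suc i) ≡ - ν * a * ((1ℚ + ν) * b)
      shorter = cong₂ _*_ (rising-shift (- ν) i) (rising-shift (1ℚ + ν) i)
      lemma : ∀ ν i a b → (1ℚ + ν) * (- (1ℚ + ν) * (- ν * a) * (b * (ι 2 + ν + i) * (ι 3 + ν + i)))
        - (ι 2 * ν + 1ℚ) * (- ν * (a * (1ℚ - ν + i)) * ((1ℚ + ν) * (b * (ι 2 + ν + i))))
        + ν * (a * (1ℚ - ν + i) * (ι 2 - ν + i) * (ν * ((1ℚ + ν) * b))) ≡
        - ι 2 * (ι 2 * ν + 1ℚ) * ((1ℚ + (1ℚ + i)) * (1ℚ + (1ℚ + i))) * (- ν * a * ((1ℚ + ν) * b))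
      lemma = solve-∀ ringℚ

  module Hypergeometric (w : ℚ) where

    partial : ℚ → ℕ → ℚ
    partial ν = sum (λ j → legendreCoeff ν j * w ^ j)

    -- Multiplication by x = 1 - 2w shifts the coefficients, so truncated sums satisfy the Legendre
    -- recurrence up to the single term pushed past the cut. For ν = n and a cut beyond the degree
    -- this term is zero.
    partial-rec : ∀ ν n → (1ℚ + ν) * partial (1ℚ + ν) (suc n) ≡ (ι 2 * ν + 1ℚ) * ((1ℚ - ι 2 * w) * partial ν (suc n)) - ν * partial (ν - 1ℚ) (suc n)
      + ι 2 * (ι 2 * ν + 1ℚ) * (legendreCoeff ν n * (w * w ^ n))
    partial-rec ν zero = lemma ν w
      where
        lemma : ∀ ν w → (1ℚ + ν) * (0ℚ + 1ℚ * 1ℚ * 1ℚ * 1ℚ) ≡ (ι 2 * ν + 1ℚ) * ((1ℚ - ι 2 * w) * (0ℚ + 1ℚ * 1ℚ * 1ℚ * 1ℚ)) - ν * (0ℚ + 1ℚ * 1ℚ * 1ℚ * 1ℚ)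
          + ι 2 * (ι 2 * ν + 1ℚ) * (1ℚ * 1ℚ * 1ℚ * (w * 1ℚ))
        lemma = solve-∀ ringℚ
    partial-rec ν (suc n) = modulo (partial-rec ν n) (modulo (numerator₂-rec ν n) (modulo (1/[j!]²-rec n)
        (lemma ν w (ι n) (w ^ n) (partial (1ℚ + ν) (suc n)) (partial ν (suc n)) (partial (ν - 1ℚ) (suc n))
          (numerator₂ (1ℚ + ν) (suc n)) (numerator₂ ν (suc n)) (numerator₂ (ν - 1ℚ) (suc n)) (numerator₂ ν n) (1/[j!]² n) (1/[j!]² (suc n)))))
      where
        lemma : ∀ ν w n x s⁺ s s⁻ c⁺ c c⁻ d f f′ →
          (1ℚ + ν) * (s⁺ + c⁺ * f′ * (w * x)) ≡
          ((((ι 2 * ν + 1ℚ) * ((1ℚ - ι 2 * w) * (s + c * f′ * (w * x))) - ν * (s⁻ + c⁻ * f′ * (w * x))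
          + ι 2 * (ι 2 * ν + 1ℚ) * (c * f′ * (w * (w * x))))
          + ((1ℚ + ν) * s⁺ - ((ι 2 * ν + 1ℚ) * ((1ℚ - ι 2 * w) * s) - ν * s⁻ + ι 2 * (ι 2 * ν + 1ℚ) * (d * f * (w * x)))) * 1ℚ)
          + ((1ℚ + ν) * c⁺ - (ι 2 * ν + 1ℚ) * c + ν * c⁻ - - ι 2 * (ι 2 * ν + 1ℚ) * ((1ℚ + n) * (1ℚ + n)) * d) * (f′ * (w * x)))
          + ((1ℚ + n) * ((1ℚ + n) * f′) - f) * (- ι 2 * (ι 2 * ν + 1ℚ) * d * (w * x))
        lemma = solve-∀ ringℚ

    legendreCoeff-vanishes : ∀ n d → legendreCoeff (ι n) (suc (d ℕ.+ n)) ≡ 0ℚ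
    legendreCoeff-vanishes n d = trans (cong (λ t → t * rising (1ℚ + ι n) (suc (d ℕ.+ n)) * 1/[j!]² (suc (d ℕ.+ n))) (rising-vanishes d)) (lemma (rising (1ℚ + ι n) (suc (d ℕ.+ n))) (1/[j!]² (suc (d ℕ.+ n))))
      where
        lemma : ∀ a b → 0ℚ * a * b ≡ 0ℚ
        lemma = solve-∀ ringℚ
        rising-vanishes : ∀ d → rising (- ι n) (suc (d ℕ.+ n)) ≡ 0ℚ
        rising-vanishes zero = trans (cong (rising (- ι n) n *_) (ℚₚ.+-inverseˡ (ι n))) (ℚₚ.*-zeroʳ (rising (- ι n) n))
        rising-vanishes (suc d) = trans (cong (_* (- ι n + ι (suc (d ℕ.+ n)))) (rising-vanishes d)) (ℚₚ.*-zeroˡ (- ι n + ι (suc (d ℕ.+ n))))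

    partial-stable : ∀ n d → partial (ι n) (suc (d ℕ.+ n)) ≡ partial (ι n) (suc n)
    partial-stable n zero = refl
    partial-stable n (suc d) = trans (cong₂ _+_ (partial-stable n d) (trans (cong (_* w ^ suc (d ℕ.+ n)) (legendreCoeff-vanishes n d)) (ℚₚ.*-zeroˡ (w ^ suc (d ℕ.+ n)))))
      (ℚₚ.+-identityʳ (partial (ι n) (suc n)))

    mutual
      leg-hypergeometric : ∀ n → leg (1ℚ - ι 2 * w) 1ℚ n ≡ partial (ι n) (suc n)
      leg-hypergeometric zero = refl
      leg-hypergeometric (suc n) = cancel (0<ι n) (subst (λ ν → ν * leg (1ℚ - ι 2 * w) 1ℚ (suc n) ≡ ν * partial ν (suc (suc n))) (sym (ι-suc n))
        (trans (leg-rec (1ℚ - ι 2 * w) 1ℚ n)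
          (trans (cong₂ (λ s t → (ι 2 * ι n + 1ℚ) * ((1ℚ - ι 2 * w) * s) - t)
            (trans (leg-hypergeometric n) (sym (partial-stable n 1))) (trans (lemma₁ (ι n) (leg⁻ (1ℚ - ι 2 * w) 1ℚ n)) (leg⁻-hypergeometric n)))
            (sym (trans (partial-rec (ι n) (suc n)) (modulo (legendreCoeff-vanishes n 0)
              (lemma₂ ((ι 2 * ι n + 1ℚ) * ((1ℚ - ι 2 * w) * partial (ι n) (suc (suc n))) - ι n * partial (ι n - 1ℚ) (suc (suc n)))
                (ι n) (legendreCoeff (ι n) (suc n)) (w * w ^ suc n))))))))
        where
          lemma₁ : ∀ n x → n * (1ℚ * x) ≡ n * x
          lemma₁ = solve-∀ ringℚ
          lemma₂ : ∀ a ν c x → a + ι 2 * (ι 2 * ν + 1ℚ) * (c * x) ≡ a + (c - 0ℚ) * (ι 2 * (ι 2 * ν + 1ℚ) * x)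
          lemma₂ = solve-∀ ringℚ

      -- The factor `ι n` is needed on both sides: at n = 0 `leg⁻` is 0, while the series at ν = -1
      -- is 1.
      leg⁻-hypergeometric : ∀ n → ι n * leg⁻ (1ℚ - ι 2 * w) 1ℚ n ≡ ι n * partial (ι n - 1ℚ) (suc (suc n))
      leg⁻-hypergeometric zero = sym (ℚₚ.*-zeroˡ (partial (0ℚ - 1ℚ) 2))
      leg⁻-hypergeometric (suc n) = cong (ι (suc n) *_) (trans (leg-hypergeometric n) (trans (sym (partial-stable n 2))
        (cong (λ ν → partial ν (suc (suc (suc n)))) (trans (lemma (ι n)) (cong (_- 1ℚ) (sym (ι-suc n)))))))
        where
          lemma : ∀ n → n ≡ 1ℚ + n - 1ℚ
          lemma = solve-∀ ringℚ

  0<ι! : ∀ j → 0ℚ < ι (j !)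
  0<ι! j = ℚₚ.<-≤-trans 0<1 (ι-mono (ℕₚ.1≤n! j))

  [j!]²-inverse : ∀ j → ι (j !) * ι (j !) * 1/[j!]² j ≡ 1ℚ
  [j!]²-inverse zero = refl
  [j!]²-inverse (suc j) = trans (cong (λ t → t * t * 1/[j!]² (suc j)) (trans (ι-* (suc j) (j !)) (cong (_* ι (j !)) (ι-suc j))))
    (trans (lemma (ι j) (ι (j !)) (1/[j!]² (suc j))) (trans (cong (ι (j !) * ι (j !) *_) (1/[j!]²-rec j)) ([j!]²-inverse j)))
    where
      lemma : ∀ j f i → (1ℚ + j) * f * ((1ℚ + j) * f) * i ≡ f * f * ((1ℚ + j) * ((1ℚ + j) * i))
      lemma = solve-∀ ringℚ

  ι*/′ : ∀ i d .{{_ : ℕ.NonZero d}} → ι d * (i / d) ≡ fromℤ i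
  ι*/′ i (suc d) = ι*/ i d

  hypergeometric-coeff : ∀ n j .{{_ : ℕ.NonZero (j ! ℕ.* j !)}} →
    (pochhammer (ℤ.- (ℤ.+ n)) j ℤ.* pochhammer (ℤ.+ suc n) j) / (j ! ℕ.* j !) ≡ legendreCoeff (ι n) j
  hypergeometric-coeff n j = cancel (*-pos (0<ι! j) (0<ι! j)) (trans (cong (_* q) (sym (ι-* (j !) (j !))))
      (trans (ι*/′ _ (j ! ℕ.* j !)) (trans (fromℤ-* (pochhammer (ℤ.- (ℤ.+ n)) j) (pochhammer (ℤ.+ suc n) j))
        (trans (cong₂ _*_ (trans (fromℤ-pochhammer (ℤ.- (ℤ.+ n)) j) (rising-cong (fromℤ-neg n) j)) (trans (fromℤ-pochhammer (ℤ.+ suc n) j) (rising-cong (ι-suc n) j)))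
          (sym (modulo ([j!]²-inverse j) (lemma (ι (j !)) (numerator₂ (ι n) j) (1/[j!]² j))))))))
    where
      q : ℚ
      q = (pochhammer (ℤ.- (ℤ.+ n)) j ℤ.* pochhammer (ℤ.+ suc n) j) / (j ! ℕ.* j !)
      lemma : ∀ f c i → f * f * (c * i) ≡ c + (f * f * i - 1ℚ) * c
      lemma = solve-∀ ringℚ

  central : ℕ → ℚ
  central n = ι ((2 ℕ.* n) C n)

  central-! : ∀ n → central n * (ι (n !) * ι (n !)) ≡ ι ((2 ℕ.* n) !)
  central-! n = trans (cong (central n *_) (sym (ι-* (n !) (n !)))) (trans (sym (ι-* ((2 ℕ.* n) C n) (n ! ℕ.* n !))) (cong ι natural))
    where
      n≤2n : n ℕ.≤ 2 ℕ.* n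
      n≤2n = ℕₚ.m≤m+n n (n ℕ.+ 0)
      2n∸n : 2 ℕ.* n ℕ.∸ n ≡ n
      2n∸n = trans (ℕₚ.m+n∸m≡n n (n ℕ.+ 0)) (ℕₚ.+-identityʳ n)
      natural : ((2 ℕ.* n) C n) ℕ.* (n ! ℕ.* n !) ≡ (2 ℕ.* n) !
      natural = trans (cong (λ m → ((2 ℕ.* n) C n) ℕ.* (n ! ℕ.* m !)) (sym 2n∸n))
        (trans (cong (ℕ._* (n ! ℕ.* (2 ℕ.* n ℕ.∸ n) !)) (nCk≡n!/k![n-k]! n≤2n))
          (m/n*n≡m {{n ℕₚ.!* (2 ℕ.* n ℕ.∸ n) !≢0}} (k![n∸k]!∣n! n≤2n)))

  central-rec : ∀ n → (1ℚ + ι n) * central (suc n) ≡ ι 2 * (ι 2 * ι n + 1ℚ) * central n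
  central-rec n = cancel (*-pos (0<ι n) (*-pos (0<ι! n) (0<ι! n)))
    (trans (cong (λ ν → ν * (ι (n !) * ι (n !)) * ((1ℚ + ι n) * central (suc n))) (ι-suc n))
    (trans (lemma₁ (ι n) (ι (n !)) (central (suc n)))
    (trans (cong (λ t → central (suc n) * (t * t)) (sym (trans (ι-* (suc n) (n !)) (cong (_* ι (n !)) (ι-suc n)))))
    (trans (central-! (suc n)) (trans (trans (cong (λ m → ι (m !)) (ℕₚ.*-suc 2 n)) (trans (ι-* (2 ℕ.+ 2 ℕ.* n) ((1 ℕ.+ 2 ℕ.* n) !)) (cong₂ _*_ ι[2n+2]
        (trans (ι-* (1 ℕ.+ 2 ℕ.* n) ((2 ℕ.* n) !)) (cong₂ _*_ ι[2n+1] (sym (central-! n)))))))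
      (trans (lemma₂ (ι n) (ι (n !)) (central n)) (cong (λ ν → ν * (ι (n !) * ι (n !)) * (ι 2 * (ι 2 * ι n + 1ℚ) * central n)) (sym (ι-suc n)))))))))
    where
      ι[2n+1] : ι (1 ℕ.+ 2 ℕ.* n) ≡ 1ℚ + ι 2 * ι n
      ι[2n+1] = trans (ι-suc (2 ℕ.* n)) (cong (1ℚ +_) (ι-* 2 n))
      ι[2n+2] : ι (2 ℕ.+ 2 ℕ.* n) ≡ 1ℚ + (1ℚ + ι 2 * ι n)
      ι[2n+2] = trans (ι-suc (1 ℕ.+ 2 ℕ.* n)) (cong (1ℚ +_) ι[2n+1])
      lemma₁ : ∀ n f c → (1ℚ + n) * (f * f) * ((1ℚ + n) * c) ≡ c * ((1ℚ + n) * f * ((1ℚ + n) * f))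
      lemma₁ = solve-∀ ringℚ
      lemma₂ : ∀ n f c → (1ℚ + (1ℚ + ι 2 * n)) * ((1ℚ + ι 2 * n) * (c * (f * f))) ≡ (1ℚ + n) * (f * f) * (ι 2 * (ι 2 * n + 1ℚ) * c)
      lemma₂ = solve-∀ ringℚ

  central²≡ : ∀ n → central n * central n ≡ coeff n * ι 16 ^ n
  central²≡ zero = refl
  central²≡ (suc n) = cancel (*-pos (0<ι n) (0<ι n)) (subst (λ ν → ν * ν * (central (suc n) * central (suc n)) ≡ ν * ν * (coeff (suc n) * (ι 16 * ι 16 ^ n))) (sym (ι-suc n))
    (trans (lemma₁ (1ℚ + ι n) (central (suc n))) (trans (cong (λ t → t * t) (central-rec n))
      (trans (lemma₂ (ι 2 * ι n + 1ℚ) (central n)) (trans (cong (ι 4 * ((ι 2 * ι n + 1ℚ) * (ι 2 * ι n + 1ℚ)) *_) (central²≡ n))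
        (trans (lemma₃ (ι 2 * ι n + 1ℚ) (coeff n) (ι 16 ^ n)) (trans (cong (_* (ι 16 * ι 16 ^ n)) (sym (coeff-rec n))) (lemma₄ (1ℚ + ι n) (coeff (suc n)) (ι 16 * ι 16 ^ n)))))))))
    where
      lemma₁ : ∀ n c → n * n * (c * c) ≡ n * c * (n * c)
      lemma₁ = solve-∀ ringℚ
      lemma₂ : ∀ o c → ι 2 * o * c * (ι 2 * o * c) ≡ ι 4 * (o * o) * (c * c)
      lemma₂ = solve-∀ ringℚ
      lemma₃ : ∀ o a e → ι 4 * (o * o) * (a * e) ≡ ¼ * (o * o) * a * (ι 16 * e)
      lemma₃ = solve-∀ ringℚ
      lemma₄ : ∀ n a e → n * (n * a) * e ≡ n * n * (a * e)
      lemma₄ = solve-∀ ringℚ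

  -- The uniform estimate at rational points

  Approximates : ℚ → ℚ → ℚ → ℕ → ℕ → Set
  Approximates η κ̄ ε n m = ∀ k (k≢0 : k * inv k ≡ 1ℚ) v (k+1≢0 : (1ℚ + k) * v ≡ 1ℚ) → 0ℚ < k → η ≤ ω k → k ≤ κ̄ →
    ∣ sum (Original.original k k≢0 v k+1≢0) n - ι 8 * (bisect k m * bisect k m * bisect k m) * Q k * inv (leibniz m) ∣ ≤ ε

  module _ (η κ̄ : ℚ) (0<η : 0ℚ < η) (κ̄<1 : κ̄ < 1ℚ) where

    private
      module Bounds (k : ℚ) (0<k : 0ℚ < k) (k<1 : k < 1ℚ) (0≤ω : 0ℚ ≤ ω k) where

        1/9≤k : inv (ι 9) ≤ k
        1/9≤k = cancel-≤ {ι 9} (0<ι 8) (1≤9k 0<k (<⇒≤ k<1) 0≤ω)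

        k∈ : k ∈[ inv (ι 9) , 1ℚ ]
        k∈ = 1/9≤k , <⇒≤ k<1

        ∣2Q∣≤10 : ∣ ι 2 * Q k ∣ ≤ ι 10
        ∣2Q∣≤10 = ≤-trans (∣≥0∣ (*-nonNeg (0≤ι 2) (<⇒≤ (0<Q 0<k)))) (*-monoˡ {ι 2} {Q k} {ι 5} (0≤ι 2)
          (≤-by (ι 4 * (1ℚ - k * k) + ι 3 * k) (+-nonNeg (*-nonNeg (0≤ι 4) (difference≥0 (<⇒≤ (square<1 (<⇒≤ 0<k) k<1)))) (*-nonNeg (0≤ι 3) (<⇒≤ 0<k))) (lemma k)))
          where
            lemma : ∀ k → ι 4 * k * k - ι 3 * k + 1ℚ + (ι 4 * (1ℚ - k * k) + ι 3 * k) ≡ ι 5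
            lemma = solve-∀ ringℚ

    -- The error has three parts, each at most ¼ε: the boundary term, the passage from k to the
    -- square of the bisection root, and the error of `ratio-π`. For the second, m must be large
    -- compared with the Lipschitz constant of `M` at n, so N′ comes after n.
    sum-original-limit : ∀ ε → 0ℚ < ε → ∃[ N ] ∀ n → N ℕ.≤ n → ∃[ N′ ] ∀ m → N′ ℕ.≤ m → Approximates η κ̄ ε n m
    sum-original-limit ε 0<ε = suc (N₁ ℕ.+ N₂) , λ n N≤n → N₁ ℕ.+ (suc N₂ ℕ.+ (N₃ ℕ.+ proj₁ (close n))) , λ m N′≤m k k≢0 v k+1≢0 0<k η≤ω k≤κ̄ →
        estimate n m N≤n (ℕₚ.m+n≤o⇒m≤o N₁ N′≤m) (ℕₚ.m+n≤o⇒m≤o (suc N₂) (ℕₚ.m+n≤o⇒n≤o N₁ N′≤m))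
          (ℕₚ.m+n≤o⇒m≤o N₃ (ℕₚ.m+n≤o⇒n≤o (suc N₂) (ℕₚ.m+n≤o⇒n≤o N₁ N′≤m)))
          (ℕₚ.m+n≤o⇒n≤o N₃ (ℕₚ.m+n≤o⇒n≤o (suc N₂) (ℕₚ.m+n≤o⇒n≤o N₁ N′≤m))) k k≢0 v k+1≢0 0<k η≤ω k≤κ̄
      where
        ε₁ : ℚ
        -- 160 = 10·4·4: the bound for 2Q, the 4ε₁ of `ratio-π`, and a quarter of ε. The minimum
        -- with 1 meets the requirement ε₁ ≤ 1.
        ε₁ = inv (ι 160) * (ε ⊓ 1ℚ)
        0<1/160 : 0ℚ < inv (ι 160)
        0<1/160 = ℚₚ.positive⁻¹ (inv (ι 160))
        0<ε₁ : 0ℚ < ε₁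
        0<ε₁ = *-pos {inv (ι 160)} 0<1/160 (⊓-pos 0<ε)
        ε₁≤1 : ε₁ ≤ 1ℚ
        ε₁≤1 = *-mono {inv (ι 160)} {1ℚ} {ε ⊓ 1ℚ} {1ℚ} (<⇒≤ 0<1/160) 0≤1 (ℚₚ.≤ᵇ⇒≤ _) (ℚₚ.p⊓q≤q ε 1ℚ)
        40ε₁≤ : ι 10 * (ι 4 * ε₁) ≤ ¼ * ε
        40ε₁≤ = ≤-trans (≤-reflexive (lemma (ε ⊓ 1ℚ))) (*-monoˡ 0≤¼ (ℚₚ.p⊓q≤p ε 1ℚ))
          where
            lemma : ∀ x → ι 10 * (ι 4 * (inv (ι 160) * x)) ≡ ¼ * x
            lemma = solve-∀ ringℚ
        ½η>0 : 0ℚ < ½ * η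
        ½η>0 = ½-pos 0<η
        limit = ratio-π (½ * η) κ̄ ½η>0 κ̄<1 ε₁ 0<ε₁ ε₁≤1
        contraction = ζ-contracts 0<η (difference>0 κ̄<1)
        θ : ℚ
        θ = proj₁ contraction
        0≤θ : 0ℚ ≤ θ
        0≤θ = ≤-trans 0≤½ (proj₁ (proj₂ contraction))
        θ<1 : θ < 1ℚ
        θ<1 = proj₁ (proj₂ (proj₂ contraction))
        ρ : ℚ
        ρ = ¼ * inv (ι 192) * ε
        decay = Decay.cubic-decay θ 0≤θ θ<1 ρ (*-pos {¼ * inv (ι 192)} (ℚₚ.positive⁻¹ (¼ * inv (ι 192))) 0<ε)
        N₁ N₂ N₃ : ℕ
        N₁ = proj₁ limit
        N₂ = proj₁ decay
        -- 104 = 13·8: between points of [0, 1] ω changes by at most 13 times their distance, and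
        -- `root-error` is 8·2⁻ᵐ. So ω remains at least ½η at the approximate square.
        N₃ = proj₁ (2^-small (ι 104) (½ * η) ½η>0)
        lipschitz-M : ∀ n → Diff (inv (ι 9)) 1ℚ (λ x → M x n) (λ x → M′ x n)
        lipschitz-M = diff-M (ℚₚ.positive⁻¹ (inv (ι 9))) (ℚₚ.≤ᵇ⇒≤ _)
        constant : ℕ → ℚ
        constant n = (ι 10 * bound (lipschitz-M n) + ι 30) * ι 8
        close : ∀ n → ∃[ N ] ∀ m → N ℕ.≤ m → constant n * 2^- m < ¼ * ε
        close n = 2^-small (constant n) (¼ * ε) (*-pos {¼} (ℚₚ.positive⁻¹ ¼) 0<ε)

        module _ (n m : ℕ) (N≤n : suc (N₁ ℕ.+ N₂) ℕ.≤ n) (N₁≤m : N₁ ℕ.≤ m) (N₂<m : N₂ ℕ.< m) (N₃≤m : N₃ ℕ.≤ m) (close≤m : proj₁ (close n) ℕ.≤ m)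
          (k : ℚ) (k≢0 : k * inv k ≡ 1ℚ) (v : ℚ) (k+1≢0 : (1ℚ + k) * v ≡ 1ℚ) (0<k : 0ℚ < k) (η≤ω : η ≤ ω k) (k≤κ̄ : k ≤ κ̄) where

          k<1 : k < 1ℚ
          k<1 = ℚₚ.≤-<-trans k≤κ̄ κ̄<1
          open Bisection k (<⇒≤ 0<k) (<⇒≤ k<1) m

          k₂ d B : ℚ
          k₂ = root * root
          d = k - k₂
          B = bound (lipschitz-M n)
          0≤d : 0ℚ ≤ d
          0≤d = difference≥0 root²≤
          k₂<1 : k₂ < 1ℚ
          k₂<1 = ℚₚ.≤-<-trans root²≤ k<1

          ½η≤ω : ½ * η ≤ ω k₂
          ½η≤ω = ≤-trans (≤-by (½ * η - ι 13 * d) (difference≥0 13d≤) refl) (≤-by ((ω k - η) + d * (ι 4 * ((1ℚ - k) + (1ℚ - k₂))))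
              (+-nonNeg (difference≥0 η≤ω) (*-nonNeg 0≤d (*-nonNeg (0≤ι 4) (+-nonNeg (difference≥0 (<⇒≤ k<1)) (difference≥0 (<⇒≤ k₂<1)))))) (lemma k k₂ η))
            where
              13d≤ : ι 13 * d ≤ ½ * η
              13d≤ = ≤-trans (*-monoˡ (0≤ι 13) root-error) (≤-trans (≤-reflexive (lemma₁ (2^- m))) (<⇒≤ (proj₂ (2^-small (ι 104) (½ * η) ½η>0) m N₃≤m)))
                where
                  lemma₁ : ∀ x → ι 13 * (ι 8 * x) ≡ ι 104 * x
                  lemma₁ = solve-∀ ringℚ
              lemma : ∀ k k₂ η → ½ * η + (½ * η - ι 13 * (k - k₂)) + ((ι 4 * k * k + ι 5 * k - 1ℚ - η) + (k - k₂) * (ι 4 * ((1ℚ - k) + (1ℚ - k₂)))) ≡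
                ι 4 * k₂ * k₂ + ι 5 * k₂ - 1ℚ
              lemma = solve-∀ ringℚ

          0<root : 0ℚ < root
          -- A zero root would give ω = -1, below ½η.
          0<root = ℚₚ.≰⇒> λ root≤0 → ℚₚ.<-irrefl refl (ℚₚ.<-≤-trans ½η>0 (≤-trans ½η≤ω
            (≤-trans (≤-reflexive (cong (λ t → ω (t * t)) (ℚₚ.≤-antisym root≤0 0≤root))) (ℚₚ.≤ᵇ⇒≤ _))))

          0≤ω : 0ℚ ≤ ω k
          0≤ω = ≤-trans (<⇒≤ 0<η) η≤ω
          module O = Original k k≢0 v k+1≢0
          module Bₖ = Bounds k 0<k k<1 0≤ω
          module B₂ = Bounds k₂ (*-pos 0<root 0<root) k₂<1 (≤-trans (<⇒≤ ½η>0) ½η≤ω)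

          h i : ℚ
          h = ratio n root
          i = inv (leibniz m)
          close-h : ∣ h - ι 4 * i ∣ ≤ ι 4 * ε₁ × ∣ h ∣ ≤ ι 3
          close-h = proj₂ limit n m root (ℕₚ.m+n≤o⇒m≤o N₁ (ℕₚ.≤-trans (ℕₚ.n≤1+n _) N≤n)) N₁≤m 0<root ½η≤ω (≤-trans root²≤ k≤κ̄)

          ∣root∣≤1 : ∣ root ∣ ≤ 1ℚ
          ∣root∣≤1 = ≤-trans (∣≥0∣ 0≤root) root≤1

          ∣ΔM∣≤ : ∣ M k n - M k₂ n ∣ ≤ B * d
          ∣ΔM∣≤ = ≤-trans (lipschitz (lipschitz-M n) k₂ k B₂.k∈ Bₖ.k∈) (*-monoˡ (0≤bound (lipschitz-M n)) (∣≥0∣ 0≤d))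

          boundary≤ : ∣ O.boundary n ∣ ≤ ¼ * ε
          boundary≤ = ≤-trans (∣boundary∣≤ k 0<k k<1 v k+1≢0 (proj₂ (proj₂ (proj₂ contraction)) 0<k (<⇒≤ k<1) η≤ω (ℚₚ.+-monoʳ-≤ 1ℚ (ℚₚ.neg-antimono-≤ k≤κ̄))) θ<1 n (ℕₚ.≤-trans (ℕ.s≤s ℕ.z≤n) N≤n))
            (≤-trans (*-monoˡ (0≤ι 192) (proj₂ decay n (ℕₚ.m+n≤o⇒n≤o N₁ (ℕₚ.≤-trans (ℕₚ.n≤1+n _) N≤n)))) (≤-reflexive (lemma ε)))
            where
              lemma : ∀ e → ι 192 * (¼ * inv (ι 192) * e) ≡ ¼ * e
              lemma = solve-∀ ringℚ

          estimate : ∣ sum O.original n - ι 8 * (root * root * root) * Q k * i ∣ ≤ ε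
          estimate = subst (λ t → ∣ t ∣ ≤ ε) (sym split) (≤-trans
              (∣+∣≤ boundary≤ (∣*∣≤ Bₖ.∣2Q∣≤10 (∣+∣≤ (∣+∣≤
                (∣*∣≤ (≤-trans (∣≥0∣ (<⇒≤ 0<k)) (<⇒≤ k<1)) ∣ΔM∣≤)
                (∣*∣≤ (∣≥0∣ 0≤d) (∣*∣≤ (proj₂ close-h) ∣root∣≤1)))
                (∣*∣≤ (∣*∣≤ (∣*∣≤ ∣root∣≤1 ∣root∣≤1) ∣root∣≤1) (proj₁ close-h)))))
              (≤-trans (≤-reflexive (lemma₁ ε B d ε₁)) (≤-trans
                (ℚₚ.+-mono-≤ (ℚₚ.+-monoʳ-≤ (¼ * ε) (≤-trans (*-monoˡ 0≤c root-error) (≤-trans (≤-reflexive (lemma₂ B (2^- m))) (<⇒≤ (proj₂ (close n) m close≤m))))) 40ε₁≤)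
                (≤-by (¼ * ε) (*-nonNeg 0≤¼ (<⇒≤ 0<ε)) (lemma₃ ε)))))
            where
              0≤c : 0ℚ ≤ ι 10 * B + ι 30
              0≤c = +-nonNeg (*-nonNeg (0≤ι 10) (0≤bound (lipschitz-M n))) (0≤ι 30)
              lemma₁ : ∀ e B d e₁ → ¼ * e + ι 10 * (1ℚ * (B * d) + d * (ι 3 * 1ℚ) + 1ℚ * 1ℚ * 1ℚ * (ι 4 * e₁)) ≡ ¼ * e + (ι 10 * B + ι 30) * d + ι 10 * (ι 4 * e₁)
              lemma₁ = solve-∀ ringℚ
              lemma₂ : ∀ B x → (ι 10 * B + ι 30) * (ι 8 * x) ≡ (ι 10 * B + ι 30) * ι 8 * x
              lemma₂ = solve-∀ ringℚ
              lemma₃ : ∀ e → ¼ * e + ¼ * e + ¼ * e + ¼ * e ≡ e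
              lemma₃ = solve-∀ ringℚ
              -- Inside 2Q, k M(k) passes to r² M(r²) by changing first the argument of `M` and then
              -- the factor k. Since M(r²) = h r, the result is h r³, to be compared with 4r³/π.
              split : sum O.original n - ι 8 * (root * root * root) * Q k * i ≡
                O.boundary n + ι 2 * Q k * (k * (M k n - M k₂ n) + d * (h * root) + root * root * root * (h - ι 4 * i))
              split = trans (cong (_- ι 8 * (root * root * root) * Q k * i) (O.sum-original n))
                (modulo (*-inv⁺ 0<root) (lemma k (Q k) (M k n) (M k₂ n) root (inv root) (O.boundary n) i))
                where
                  lemma : ∀ k q s s₂ r r⁻ b i → ι 2 * k * q * s + b - ι 8 * (r * r * r) * q * i ≡
                    b + ι 2 * q * (k * (s - s₂) + (k - r * r) * (s₂ * r⁻ * r) + r * r * r * (s₂ * r⁻ - ι 4 * i))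
                    + (r * r⁻ - 1ℚ) * (- ι 2 * q * k * s₂)
                  lemma = solve-∀ ringℚ

  -- The expressions of the theorem at a rational point

  *-^ : ∀ x y n → (x * y) ^ n ≡ x ^ n * y ^ n
  *-^ x y zero = refl
  *-^ x y (suc n) = trans (cong (x * y *_) (*-^ x y n)) (lemma x y (x ^ n) (y ^ n))
    where
      lemma : ∀ x y a b → x * y * (a * b) ≡ x * a * (y * b)
      lemma = solve-∀ ringℚ

  -- The quantities of the theorem at a rational point, with powers associated to
  -- the right as they are for reals.
  module AtRational (k : ℚ) (0<k : 0ℚ < k) where

    k² k³ k⁴ k⁵ k⁶ quadratic x z C₃ C₂ C₁ C₀ : ℚ
    k² = k * (k * 1ℚ)
    k³ = k * k²
    k⁴ = k * k³
    k⁵ = k * k⁴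
    k⁶ = k * k⁵
    quadratic = ι 4 * k² - ι 3 * k + 1ℚ
    x = (1ℚ - ι 3 * k + ι 2 * k² - ι 2 * k³) * inv quadratic
    z = - (1ℚ + k) * quadratic * inv (ι 64 * k)
    C₃ = ι 4 * ((k - 1ℚ) * ((k - 1ℚ) * 1ℚ)) * inv (k + 1ℚ) * (ι 2 * k - 1ℚ) * ((ι 4 * k² + ι 3 * k + 1ℚ) * ((ι 4 * k² + ι 3 * k + 1ℚ) * 1ℚ))
    C₂ = ι 12 * (k - 1ℚ) * (ι 2 * k - 1ℚ) * (ι 16 * k⁴ + k² - 1ℚ)
    C₁ = ι 288 * k⁶ - ι 400 * k⁵ + ι 102 * k⁴ + ι 97 * k³ - ι 93 * k² + ι 47 * k - ι 9
    C₀ = ι 2 * (ι 32 * k⁶ - ι 44 * k⁵ + ι 9 * k⁴ + ι 16 * k³ - ι 14 * k² + ι 6 * k - 1ℚ)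

    k≢0 : k * inv k ≡ 1ℚ
    k≢0 = *-inv⁺ 0<k

    k+1≢0 : (1ℚ + k) * inv (k + 1ℚ) ≡ 1ℚ
    k+1≢0 = trans (cong (_* inv (k + 1ℚ)) (ℚₚ.+-comm 1ℚ k)) (*-inv⁺ (subst (0ℚ <_) (ℚₚ.+-comm 1ℚ k) (+-pos 0<1 (<⇒≤ 0<k))))

    module O = Original k k≢0 (inv (k + 1ℚ)) k+1≢0

    quadratic≡Q : quadratic ≡ Q k
    quadratic≡Q = lemma k
      where
        lemma : ∀ k → ι 4 * (k * (k * 1ℚ)) - ι 3 * k + 1ℚ ≡ ι 4 * k * k - ι 3 * k + 1ℚ
        lemma = solve-∀ ringℚ

    x≡-y : x ≡ - y k
    x≡-y = trans (cong (λ q → (1ℚ - ι 3 * k + ι 2 * k² - ι 2 * k³) * inv q) quadratic≡Q) (lemma k (inv (Q k)))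
      where
        lemma : ∀ k q → (1ℚ - ι 3 * k + ι 2 * (k * (k * 1ℚ)) - ι 2 * (k * (k * (k * 1ℚ)))) * q ≡ - (- (1ℚ - ι 3 * k + ι 2 * k * k - ι 2 * k * k * k) * q)
        lemma = solve-∀ ringℚ

    16z≡-ζ : ι 16 * z ≡ - ζ k
    16z≡-ζ = cancel (*-pos {ι 4} (0<ι 3) 0<k) (trans (cong (λ q → ι 4 * k * (ι 16 * (- (1ℚ + k) * q * inv (ι 64 * k)))) quadratic≡Q)
        (trans (modulo (*-inv⁺ (*-pos {ι 64} (0<ι 63) 0<k)) (lemma₁ k (Q k) (inv (ι 64 * k)))) (trans (cong -_ (sym (4kζ k k≢0))) (lemma₂ k (ζ k)))))
      where
        lemma₁ : ∀ k q i → ι 4 * k * (ι 16 * (- (1ℚ + k) * q * i)) ≡ - ((1ℚ + k) * q) + (ι 64 * k * i - 1ℚ) * (- (1ℚ + k) * q)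
        lemma₁ = solve-∀ ringℚ
        lemma₂ : ∀ k z → - (ι 4 * (k * z)) ≡ ι 4 * k * - z
        lemma₂ = solve-∀ ringℚ

    p≡[16z]ⁿP : k < 1ℚ → ∀ n → p k n ≡ (ι 16 * z) ^ n * leg x 1ℚ n
    p≡[16z]ⁿP k<1 n = trans (cong₂ (λ t s → leg t s n) τ≡ ζζ≡) (leg-scale (ι 16 * z) x 1ℚ n)
      where
        τ≡ : τ k ≡ ι 16 * z * x
        τ≡ = trans (τ≡ζy k 0<k k<1) (sym (trans (cong₂ _*_ 16z≡-ζ x≡-y) (lemma (ζ k) (y k))))
          where
            lemma : ∀ z y → - z * - y ≡ z * y
            lemma = solve-∀ ringℚ
        ζζ≡ : ζ k * ζ k ≡ ι 16 * z * (ι 16 * z) * 1ℚ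
        ζζ≡ = sym (trans (cong (λ t → t * t * 1ℚ) 16z≡-ζ) (lemma (ζ k)))
          where
            lemma : ∀ z → - z * - z * 1ℚ ≡ z * z
            lemma = solve-∀ ringℚ

    summand≡original : k < 1ℚ → ∀ n →
      central n * (central n * 1ℚ) * leg x 1ℚ n * z ^ n * (C₃ * (ι n * (ι n * (ι n * 1ℚ))) + C₂ * (ι n * (ι n * 1ℚ)) + C₁ * ι n + C₀) ≡ O.original n
    summand≡original k<1 n =
        cong₂ _*_ factor (cong₂ _+_ (cong₂ _+_ (cong₂ _+_ (cong₂ _*_ (lemma₃ k (inv (k + 1ℚ))) (cube (ι n))) (cong₂ _*_ (lemma₂ k) (square (ι n)))) (cong (_* ι n) (lemma₁ k))) (lemma₀ k))
      where
        factor : central n * (central n * 1ℚ) * leg x 1ℚ n * z ^ n ≡ coeff n * p k n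
        factor = trans (lemma (central n) (leg x 1ℚ n) (z ^ n)) (trans (cong (λ t → t * (z ^ n * leg x 1ℚ n)) (central²≡ n))
          (trans (lemma′ (coeff n) (ι 16 ^ n) (z ^ n) (leg x 1ℚ n)) (cong (coeff n *_) (trans (cong (_* leg x 1ℚ n) (sym (*-^ (ι 16) z n))) (sym (p≡[16z]ⁿP k<1 n))))))
          where
            lemma : ∀ c l x → c * (c * 1ℚ) * l * x ≡ c * c * (x * l)
            lemma = solve-∀ ringℚ
            lemma′ : ∀ a e x l → a * e * (x * l) ≡ a * (e * x * l)
            lemma′ = solve-∀ ringℚ
        cube : ∀ n → n * (n * (n * 1ℚ)) ≡ n * n * n
        cube = solve-∀ ringℚ
        square : ∀ n → n * (n * 1ℚ) ≡ n * n
        square = solve-∀ ringℚ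
        lemma₃ : ∀ k v → ι 4 * ((k - 1ℚ) * ((k - 1ℚ) * 1ℚ)) * v * (ι 2 * k - 1ℚ) * ((ι 4 * (k * (k * 1ℚ)) + ι 3 * k + 1ℚ) * ((ι 4 * (k * (k * 1ℚ)) + ι 3 * k + 1ℚ) * 1ℚ)) ≡
          ι 4 * ((k - 1ℚ) * (k - 1ℚ)) * v * (ι 2 * k - 1ℚ) * ((ι 4 * k * k + ι 3 * k + 1ℚ) * (ι 4 * k * k + ι 3 * k + 1ℚ))
        lemma₃ = solve-∀ ringℚ
        lemma₂ : ∀ k → ι 12 * (k - 1ℚ) * (ι 2 * k - 1ℚ) * (ι 16 * (k * (k * (k * (k * 1ℚ)))) + k * (k * 1ℚ) - 1ℚ) ≡
          ι 12 * (k - 1ℚ) * (ι 2 * k - 1ℚ) * (ι 16 * (k * k * k * k) + k * k - 1ℚ)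
        lemma₂ = solve-∀ ringℚ
        lemma₁ : ∀ k → ι 288 * (k * (k * (k * (k * (k * (k * 1ℚ)))))) - ι 400 * (k * (k * (k * (k * (k * 1ℚ))))) + ι 102 * (k * (k * (k * (k * 1ℚ))))
            + ι 97 * (k * (k * (k * 1ℚ))) - ι 93 * (k * (k * 1ℚ)) + ι 47 * k - ι 9 ≡
          ι 288 * (k * k * k * k * k * k) - ι 400 * (k * k * k * k * k) + ι 102 * (k * k * k * k) + ι 97 * (k * k * k) - ι 93 * (k * k) + ι 47 * k - ι 9
        lemma₁ = solve-∀ ringℚ
        lemma₀ : ∀ k → ι 2 * (ι 32 * (k * (k * (k * (k * (k * (k * 1ℚ)))))) - ι 44 * (k * (k * (k * (k * (k * 1ℚ))))) + ι 9 * (k * (k * (k * (k * 1ℚ))))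
            + ι 16 * (k * (k * (k * 1ℚ))) - ι 14 * (k * (k * 1ℚ)) + ι 6 * k - 1ℚ) ≡
          ι 2 * (ι 32 * (k * k * k * k * k * k) - ι 44 * (k * k * k * k * k) + ι 9 * (k * k * k * k) + ι 16 * (k * k * k) - ι 14 * (k * k) + ι 6 * k - 1ℚ)
        lemma₀ = solve-∀ ringℚ

  hypergeometric≡leg : ∀ n x → Hypergeometric.partial ((1ℚ - x) * inv (ι 2)) (ι n) (suc n) ≡ leg x 1ℚ n
  hypergeometric≡leg n x = trans (sym (Hypergeometric.leg-hypergeometric ((1ℚ - x) * inv (ι 2)) n)) (cong (λ t → leg t 1ℚ n) (lemma x))
    where
      lemma : ∀ x → 1ℚ - ι 2 * ((1ℚ - x) * inv (ι 2)) ≡ x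
      lemma = solve-∀ ringℚ

  -- (√41 - 5)/8 is the positive root of ω; the gap above it is inherited quadratically.
  ω-from-root : ∀ κ g m → 0ℚ < g → (bisect (ι 41) m - ι 5) * inv (ι 8) + g ≤ κ → (1ℚ + ι 41) * 2^- m ≤ ι 4 * g → g * g ≤ ω κ
  ω-from-root κ g m 0<g lower small = cancel-≤ {ι 16} (0<ι 15)
      (≤-by ((ι 8 * κ + ι 5) * (ι 8 * κ + ι 5) - (s + ι 4 * g) * (s + ι 4 * g) + ι 8 * g * s + (s * s - ι 41))
        (+-nonNeg (+-nonNeg (difference≥0 (*-mono 0≤s+4g (≤-trans 0≤s+4g s+4g≤) s+4g≤ s+4g≤)) (*-nonNeg (*-nonNeg (0≤ι 8) (<⇒≤ 0<g)) 0≤s)) (difference≥0 (<⇒≤ 41<s²))) (lemma₁ κ g s))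
    where
      r w s : ℚ
      r = bisect (ι 41) m
      w = (1ℚ + ι 41) * 2^- m
      s = r + w
      41<s² : ι 41 < s * s
      41<s² = proj₂ (proj₂ (bisect-spec (ι 41) (0≤ι 41) m))
      0≤s : 0ℚ ≤ s
      0≤s = +-nonNeg (proj₁ (bisect-spec (ι 41) (0≤ι 41) m)) (*-nonNeg {1ℚ + ι 41} (0≤ι 42) (<⇒≤ (2^-pos m)))
      0≤s+4g : 0ℚ ≤ s + ι 4 * g
      0≤s+4g = +-nonNeg 0≤s (*-nonNeg (0≤ι 4) (<⇒≤ 0<g))
      s+4g≤ : s + ι 4 * g ≤ ι 8 * κ + ι 5
      s+4g≤ = ≤-by ((ι 4 * g - w) + ι 8 * (κ - ((r - ι 5) * inv (ι 8) + g)))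
        (+-nonNeg (difference≥0 small) (*-nonNeg (0≤ι 8) (difference≥0 lower))) (lemma κ g r w)
        where
          lemma : ∀ κ g r w → r + w + ι 4 * g + ((ι 4 * g - w) + ι 8 * (κ - ((r - ι 5) * inv (ι 8) + g))) ≡ ι 8 * κ + ι 5
          lemma = solve-∀ ringℚ
      lemma₁ : ∀ κ g s → ι 16 * (g * g) + ((ι 8 * κ + ι 5) * (ι 8 * κ + ι 5) - (s + ι 4 * g) * (s + ι 4 * g) + ι 8 * g * s + (s * s - ι 41)) ≡
        ι 16 * (ι 4 * κ * κ + ι 5 * κ - 1ℚ)
      lemma₁ = solve-∀ ringℚ

-- Passage to real k

open import Defs
open import Data.Rational as ℚ using (ℚ; 0ℚ; 1ℚ; ½)
open RationalLemmas using (ι; bisect; leibniz; inv; 2^-_)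
open Rationals using (ringℚ; sum; sum-cong; ≤-by; difference≥0; 0<ι; leg; Q; module Original; ω; central; hypergeometric-coeff; hypergeometric≡leg; Approximates; sum-original-limit; module AtRational; ω-from-root)

seq-partialSum : ∀ f n m → seq (partialSum f n) m ≡ sum (λ i → seq (f i) m) n
seq-partialSum f zero m = refl
seq-partialSum f (suc n) m = cong (ℚ._+ seq (f n) m) (seq-partialSum f n m)

seq-^ : ∀ x n m → seq (x ^ n) m ≡ seq x m Rationals.^ n
seq-^ x zero m = refl
seq-^ x (suc n) m = cong (seq x m ℚ.*_) (seq-^ x n m)

seq-legendre : ∀ n x m → seq (legendre n x) m ≡ leg (seq x m) 1ℚ n
seq-legendre n x m = trans (seq-partialSum _ (suc n) m)
  (trans (sum-cong (λ j → cong₂ ℚ._*_ (hypergeometric-coeff n j {{j ℕₚ.!* j !≢0}}) (seq-^ ((1 - x) / 2 [ numeral#0 2 ]) j m)) (suc n)) (hypergeometric≡leg n (seq x m)))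

module _ (k : ℝ) (lower : lowerBound < k) where

  private
    x z C₃ C₂ C₁ C₀ : ℝ
    x  = (1 - 3 * k + 2 * k ^ 2 - 2 * k ^ 3) / (4 * k ^ 2 - 3 * k + 1) [ quadratic#0 lower ]
    z  = (- (1 + k) * (4 * k ^ 2 - 3 * k + 1)) / (64 * k) [ 64k#0 lower ]
    C₃ = ((4 * (k - 1) ^ 2) / (k + 1) [ k+1#0 lower ]) * (2 * k - 1) * (4 * k ^ 2 + 3 * k + 1) ^ 2
    C₂ = 12 * (k - 1) * (2 * k - 1) * (16 * k ^ 4 + k ^ 2 - 1)
    C₁ = 288 * k ^ 6 - 400 * k ^ 5 + 102 * k ^ 4 + 97 * k ^ 3 - 93 * k ^ 2 + 47 * k - 9
    C₀ = 2 * (32 * k ^ 6 - 44 * k ^ 5 + 9 * k ^ 4 + 16 * k ^ 3 - 14 * k ^ 2 + 6 * k - 1)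

  summand : ℕ → ℝ
  summand n = fromℕ ((2 ℕ.* n) C n) ^ 2 * legendre n x * z ^ n
    * (C₃ * fromℕ n ^ 3 + C₂ * fromℕ n ^ 2 + C₁ * fromℕ n + C₀)

  total : ℝ
  total = (8 * √ k ^ 3 * (4 * k ^ 2 - 3 * k + 1)) / π [ π#0 ]

  -- Real operations are pointwise, so the m-th term computes to the rational expression by
  -- reduction. Only the Legendre value and the n-th power are recursive in n and have to be
  -- rewritten.
  seq-summand : ∀ m (0<κ : 0ℚ ℚ.< seq k m) → seq k m ℚ.< 1ℚ → ∀ n → seq (summand n) m ≡ AtRational.O.original (seq k m) 0<κ n
  seq-summand m 0<κ κ<1 n = trans
    (cong (ℚ._* (R.C₃ ℚ.* (ι n ℚ.* (ι n ℚ.* (ι n ℚ.* 1ℚ))) ℚ.+ R.C₂ ℚ.* (ι n ℚ.* (ι n ℚ.* 1ℚ)) ℚ.+ R.C₁ ℚ.* ι n ℚ.+ R.C₀))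
      (cong₂ (λ s t → central n ℚ.* (central n ℚ.* 1ℚ) ℚ.* s ℚ.* t) (seq-legendre n x m) (seq-^ z n m)))
    (R.summand≡original κ<1 n)
    where
      module R = AtRational (seq k m) 0<κ

  -- Stage m of `√` is the m-th bisection of |κ|; positivity of κ removes the absolute value.
  seq-total : ∀ m (0<κ : 0ℚ ℚ.< seq k m) → let κ = seq k m; r = bisect κ m in
    seq total m ≡ ι 8 ℚ.* (r ℚ.* r ℚ.* r) ℚ.* Q κ ℚ.* inv (leibniz m)
  seq-total m 0<κ = trans (cong (λ a → ι 8 ℚ.* (bisect a m ℚ.* (bisect a m ℚ.* (bisect a m ℚ.* 1ℚ))) ℚ.* AtRational.quadratic κ 0<κ ℚ.* inv (leibniz m)) (ℚₚ.0≤p⇒∣p∣≡p (ℚₚ.<⇒≤ 0<κ)))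
    (cong₂ (λ s t → ι 8 ℚ.* s ℚ.* t ℚ.* inv (leibniz m)) (lemma (bisect κ m)) (AtRational.quadratic≡Q κ 0<κ))
    where
      κ : ℚ
      κ = seq k m
      lemma : ∀ r → r ℚ.* (r ℚ.* (r ℚ.* 1ℚ)) ≡ r ℚ.* r ℚ.* r
      lemma = solve-∀ ringℚ

module _ (k : ℝ) (lower : lowerBound < k) (m : ℕ) (0<κ : 0ℚ ℚ.< seq k m) (κ<1 : seq k m ℚ.< 1ℚ) where

  private
    module R = AtRational (seq k m) 0<κ
    r : ℚ
    r = bisect (seq k m) m

  seq-error : ∀ n {e} → ℚ.∣ sum R.O.original n ℚ.- ι 8 ℚ.* (r ℚ.* r ℚ.* r) ℚ.* Q (seq k m) ℚ.* inv (leibniz m) ∣ ℚ.≤ e →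
    seq ∣ partialSum (summand k lower) n - total k lower ∣ m ℚ.≤ e
  seq-error n {e} = subst (λ t → ℚ.∣ t ∣ ℚ.≤ e) (sym (cong₂ (λ s t → s ℚ.+ ℚ.- t)
    (trans (seq-partialSum (summand k lower) n m) (sum-cong (seq-summand k lower m 0<κ κ<1) n))
    (seq-total k lower m 0<κ)))

-- Strict inequality of reals asks for a rational gap: half of the gap `e` of ε bounds the error,
-- and the other half is the gap returned.
hasSum-from-rational : ∀ {k} (lower : lowerBound < k) η κ̄ N₀ → κ̄ ℚ.< 1ℚ →
  (∀ m → N₀ ℕ.≤ m → 0ℚ ℚ.< seq k m × η ℚ.≤ ω (seq k m) × seq k m ℚ.≤ κ̄) →
  (∀ e → 0ℚ ℚ.< e → ∃[ N ] ∀ n → N ℕ.≤ n → ∃[ N′ ] ∀ m → N′ ℕ.≤ m → Approximates η κ̄ e n m) →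
  HasSum (summand k lower) (total k lower)
hasSum-from-rational {k} lower η κ̄ N₀ κ̄<1 region limit ε (separated e 0<e N₁ ε-large) =
    proj₁ half , λ n N≤n → eventually n (proj₂ half n N≤n)
  where
    half : ∃[ N ] ∀ n → N ℕ.≤ n → ∃[ N′ ] ∀ m → N′ ℕ.≤ m → Approximates η κ̄ (½ ℚ.* e) n m
    half = limit (½ ℚ.* e) (RationalLemmas.½-pos 0<e)
    eventually : ∀ n → (∃[ N′ ] ∀ m → N′ ℕ.≤ m → Approximates η κ̄ (½ ℚ.* e) n m) →
      ∣ partialSum (summand k lower) n - total k lower ∣ < ε
    eventually n (N′ , small) = separated (½ ℚ.* e) (RationalLemmas.½-pos 0<e) (N₀ ℕ.+ (N₁ ℕ.+ N′)) λ m start≤m →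
      finish m (region m (ℕₚ.m+n≤o⇒m≤o N₀ start≤m)) (ℕₚ.m+n≤o⇒m≤o N₁ (ℕₚ.m+n≤o⇒n≤o N₀ start≤m)) (small m (ℕₚ.m+n≤o⇒n≤o N₁ (ℕₚ.m+n≤o⇒n≤o N₀ start≤m)))
      where
        finish : ∀ m → 0ℚ ℚ.< seq k m × η ℚ.≤ ω (seq k m) × seq k m ℚ.≤ κ̄ → N₁ ℕ.≤ m → Approximates η κ̄ (½ ℚ.* e) n m →
          seq ∣ partialSum (summand k lower) n - total k lower ∣ m ℚ.+ ½ ℚ.* e ℚ.≤ seq ε m
        finish m (0<κ , η≤ω , κ≤κ̄) N₁≤m small = ℚₚ.≤-trans
          (ℚₚ.+-monoˡ-≤ (½ ℚ.* e) (seq-error k lower m 0<κ (ℚₚ.≤-<-trans κ≤κ̄ κ̄<1) n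
            (small (seq k m) (AtRational.k≢0 (seq k m) 0<κ) (inv (seq k m ℚ.+ 1ℚ)) (AtRational.k+1≢0 (seq k m) 0<κ) 0<κ η≤ω κ≤κ̄)))
          (ℚₚ.≤-trans (ℚₚ.≤-reflexive (trans (RationalLemmas.½+½ e) (sym (ℚₚ.+-identityˡ e)))) (ε-large m N₁≤m))

-- The gaps contained in the two strict inequalities become uniform margins: g² for ω, by
-- `ω-from-root` once the bisection width for √41 is at most 4g, and 1 - g′ as an upper bound for
-- the approximants.
eventual-region : ∀ {k} → lowerBound < k → k < 1 → ∃[ η ] ∃[ κ̄ ] ∃[ N ] 0ℚ ℚ.< η × κ̄ ℚ.< 1ℚ ×
  (∀ m → N ℕ.≤ m → 0ℚ ℚ.< seq k m × η ℚ.≤ ω (seq k m) × seq k m ℚ.≤ κ̄)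
eventual-region {k} lower upper = η , κ̄ , N₁ ℕ.+ (N₂ ℕ.+ (N₃ ℕ.+ proj₁ narrow)) , RationalLemmas.*-pos (_<_.gap>0 lower) (_<_.gap>0 lower) , κ̄<1 , λ m N≤m →
    let N≤m₂ = ℕₚ.m+n≤o⇒n≤o N₁ N≤m
        N≤m₃ = ℕₚ.m+n≤o⇒n≤o N₂ N≤m₂
    in ℚₚ.<-≤-trans (_<_.gap>0 k>0) (subst (ℚ._≤ seq k m) (ℚₚ.+-identityˡ (_<_.gap k>0)) (_<_.separates k>0 m (ℕₚ.m+n≤o⇒m≤o N₃ N≤m₃))) ,
      ω-from-root (seq k m) g m (_<_.gap>0 lower) (_<_.separates lower m (ℕₚ.m+n≤o⇒m≤o N₁ N≤m))
        (ℚₚ.<⇒≤ (proj₂ narrow m (ℕₚ.m+n≤o⇒n≤o N₃ N≤m₃))) ,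
      ≤-by (1ℚ ℚ.- (seq k m ℚ.+ g′)) (difference≥0 (_<_.separates upper m (ℕₚ.m+n≤o⇒m≤o N₂ N≤m₂))) (lemma (seq k m) g′)
  where
    k>0 : 0 < k
    k>0 = 0<k {k} lower
    g g′ η κ̄ : ℚ
    g = _<_.gap lower
    g′ = _<_.gap upper
    η = g ℚ.* g
    κ̄ = 1ℚ ℚ.- g′
    N₁ N₂ N₃ : ℕ
    N₁ = _<_.from lower
    N₂ = _<_.from upper
    N₃ = _<_.from k>0
    κ̄<1 : κ̄ ℚ.< 1ℚ
    κ̄<1 = subst (κ̄ ℚ.<_) (ℚₚ.+-identityʳ 1ℚ) (ℚₚ.+-monoʳ-< 1ℚ (ℚₚ.neg-antimono-< (_<_.gap>0 upper)))
    narrow = RationalLemmas.2^-small (1ℚ ℚ.+ ι 41) (ι 4 ℚ.* g) (RationalLemmas.*-pos {ι 4} (0<ι 3) (_<_.gap>0 lower))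
    lemma : ∀ κ g → κ ℚ.+ (1ℚ ℚ.- (κ ℚ.+ g)) ≡ 1ℚ ℚ.- g
    lemma = solve-∀ ringℚ

theorem2 : (k : ℝ) (lower : (√ 41 - 5) / 8 [ numeral#0 8 ] < k) (upper : k < 1) →
    let
    x  = (1 - 3 * k + 2 * k ^ 2 - 2 * k ^ 3) / (4 * k ^ 2 - 3 * k + 1) [ quadratic#0 lower ]
    z  = (- (1 + k) * (4 * k ^ 2 - 3 * k + 1)) / (64 * k) [ 64k#0 lower ]
    C₃ = ((4 * (k - 1) ^ 2) / (k + 1) [ k+1#0 lower ]) * (2 * k - 1) * (4 * k ^ 2 + 3 * k + 1) ^ 2
    C₂ = 12 * (k - 1) * (2 * k - 1) * (16 * k ^ 4 + k ^ 2 - 1)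
    C₁ = 288 * k ^ 6 - 400 * k ^ 5 + 102 * k ^ 4 + 97 * k ^ 3 - 93 * k ^ 2 + 47 * k - 9
    C₀ = 2 * (32 * k ^ 6 - 44 * k ^ 5 + 9 * k ^ 4 + 16 * k ^ 3 - 14 * k ^ 2 + 6 * k - 1)
    in
    HasSum
    (λ n → fromℕ ((2 ℕ.* n) C n) ^ 2 * legendre n x * z ^ n
    * (C₃ * fromℕ n ^ 3 + C₂ * fromℕ n ^ 2 + C₁ * fromℕ n + C₀))
    ((8 * √ k ^ 3 * (4 * k ^ 2 - 3 * k + 1)) / π [ π#0 ])
theorem2 k lower upper =
  let η , κ̄ , N , 0<η , κ̄<1 , holds = eventual-region lower upper
  in hasSum-from-rational lower η κ̄ N κ̄<1 holds (sum-original-limit η κ̄ 0<η κ̄<1)
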